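{- Let $f(x),g(x)\in\mathbb{Z}[x]$, let $f(x)$ be separable with $\deg f(x)>2$, and let $$g(y)=g_1(y)^{\gamma_1}g_2(y)^{\gamma_2}\cdots g_n(y)^{\gamma_n},$$ where $n$ is a positive integer, $\gamma_1,\gamma_2,\dots,\gamma_n$ are integers $\ge 2$, and $g_i(x)\in\mathbb{Z}[x]$ for $i=1,2,\dots,n$. If the $ABC$-Conjecture is assumed, then the equation $f(x)=g(y)$ has only finitely many solutions $(x,y)$ in integers.
   Context: A polynomial is separable if it has no repeated roots (in $\mathbb{C}$). The $ABC$-Conjecture is the following assertion: for every fixed $\epsilon>0$ there is a constant $C_\epsilon$ such that, whenever $a,b,c$ are coprime positive integers with $a+b=c$, one has $c\le C_\epsilon\,N(a,b,c)^{1+\epsilon}$, where $N(a,b,c)$ is the product of the distinct prime divisors of $abc$.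
   Formalization: The formal theorem additionally assumes that g is non-constant; without this the statement fails, e.g. f(x) = x^3+1 and g(y) = 1 = 1^2, where every (0, y) is a solution. -}

module Defs where

open import Algebra.Bundles using (RawRing)
import Algebra.Definitions.RawSemiring as RawSemiringDefinitions
open import Data.Integer.Base as ℤ using (ℤ)
open import Data.List.Base as List using (List; []; _∷_; filter; upTo)
open import Data.List.Membership.Propositional using (_∈_)
open import Data.Nat.Base as ℕ using (ℕ; zero; suc)
open import Data.Nat.Divisibility using (_∣?_)
open import Data.Nat.GCD using (gcd)
import Data.Nat.Properties as ℕ
open import Data.Nat.Primality using (prime?)
open import Data.Product.Base using (∃; ∃-syntax; _×_; _,_)
open import Data.Rational.Base as ℚ using (ℚ; 0ℚ; 1ℚ; ½; _÷_; ∣_∣; ↥_; ↧ₙ_)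
import Data.Rational.Properties as ℚ
open import Data.Rational.Solver using (module +-*-Solver)
open import Level using (0ℓ; _⊔_)
open import Relation.Binary.PropositionalEquality using (_≡_; refl; sym; trans; cong; subst)
open import Relation.Nullary.Decidable using (_×-dec_)
open import Relation.Nullary.Negation using (¬_)

------------------------------------------------------------------------
-- Real and complex numbers

-- Real numbers are Cauchy sequences of rationals, compared by _≈ᴿ_.

record ℝ : Set where
  field
    seq    : ℕ → ℚ
    cauchy : ∀ ε → 0ℚ ℚ.< ε →
             ∃[ N ] (∀ m n → N ℕ.≤ m → N ℕ.≤ n → ∣ seq m ℚ.- seq n ∣ ℚ.< ε)

open ℝ

infix 4 _≈ᴿ_
_≈ᴿ_ : ℝ → ℝ → Set
x ≈ᴿ y = ∀ ε → 0ℚ ℚ.< ε → ∃[ N ] (∀ n → N ℕ.≤ n → ∣ seq x n ℚ.- seq y n ∣ ℚ.< ε)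

private
  open +-*-Solver using (solve; _:+_; _:*_; _:-_; :-_; _:=_)

  half-pos : ∀ {ε} → 0ℚ ℚ.< ε → 0ℚ ℚ.< ½ ℚ.* ε
  half-pos {ε} 0<ε = subst (ℚ._< ½ ℚ.* ε) (ℚ.*-zeroʳ ½) (ℚ.*-monoʳ-<-pos ½ 0<ε)

  half+half : ∀ ε → ½ ℚ.* ε ℚ.+ ½ ℚ.* ε ≡ ε
  half+half ε = trans (sym (ℚ.*-distribʳ-+ ε ½ ½)) (ℚ.*-identityˡ ε)

  +-cauchy-step : ∀ a b c d ε → ∣ a ℚ.- c ∣ ℚ.< ½ ℚ.* ε → ∣ b ℚ.- d ∣ ℚ.< ½ ℚ.* ε →
                  ∣ (a ℚ.+ b) ℚ.- (c ℚ.+ d) ∣ ℚ.< ε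
  +-cauchy-step a b c d ε p q = begin-strict
    ∣ (a ℚ.+ b) ℚ.- (c ℚ.+ d) ∣     ≡⟨ cong ∣_∣ (rearrange a b c d) ⟩
    ∣ (a ℚ.- c) ℚ.+ (b ℚ.- d) ∣     ≤⟨ ℚ.∣p+q∣≤∣p∣+∣q∣ (a ℚ.- c) (b ℚ.- d) ⟩
    ∣ a ℚ.- c ∣ ℚ.+ ∣ b ℚ.- d ∣     <⟨ ℚ.+-mono-< p q ⟩
    ½ ℚ.* ε ℚ.+ ½ ℚ.* ε             ≡⟨ half+half ε ⟩
    ε                               ∎
    where
    open ℚ.≤-Reasoning
    rearrange : ∀ a b c d → (a ℚ.+ b) ℚ.- (c ℚ.+ d) ≡ (a ℚ.- c) ℚ.+ (b ℚ.- d)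
    rearrange = solve 4 (λ a b c d → (a :+ b) :- (c :+ d) := (a :- c) :+ (b :- d)) refl

  neg-step : ∀ a b → ∣ ℚ.- a ℚ.- ℚ.- b ∣ ≡ ∣ a ℚ.- b ∣
  neg-step a b = trans (cong ∣_∣ (rearrange a b)) (ℚ.∣-p∣≡∣p∣ (a ℚ.- b))
    where
    rearrange : ∀ a b → ℚ.- a ℚ.- ℚ.- b ≡ ℚ.- (a ℚ.- b)
    rearrange = solve 2 (λ a b → (:- a) :- (:- b) := :- (a :- b)) refl

  EventuallyBounded : ℝ → Set
  EventuallyBounded x = ∃[ K ] ∃[ N ] (0ℚ ℚ.< K × (∀ n → N ℕ.≤ n → ∣ seq x n ∣ ℚ.≤ K))

  eventually-bounded : ∀ x → EventuallyBounded x
  eventually-bounded x with cauchy x 1ℚ (ℚ.positive⁻¹ 1ℚ)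
  ... | N , close = 1ℚ ℚ.+ ∣ seq x N ∣ , N , K-pos , bound
    where
    open ℚ.≤-Reasoning
    K-pos : 0ℚ ℚ.< 1ℚ ℚ.+ ∣ seq x N ∣
    K-pos = ℚ.+-mono-<-≤ (ℚ.positive⁻¹ 1ℚ) (ℚ.0≤∣p∣ (seq x N))
    split : ∀ a b → a ≡ (a ℚ.- b) ℚ.+ b
    split = solve 2 (λ a b → a := (a :- b) :+ b) refl
    bound : ∀ n → N ℕ.≤ n → ∣ seq x n ∣ ℚ.≤ 1ℚ ℚ.+ ∣ seq x N ∣
    bound n N≤n = begin
      ∣ seq x n ∣                                ≡⟨ cong ∣_∣ (split (seq x n) (seq x N)) ⟩
      ∣ (seq x n ℚ.- seq x N) ℚ.+ seq x N ∣      ≤⟨ ℚ.∣p+q∣≤∣p∣+∣q∣ (seq x n ℚ.- seq x N) (seq x N) ⟩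
      ∣ seq x n ℚ.- seq x N ∣ ℚ.+ ∣ seq x N ∣    ≤⟨ ℚ.+-monoˡ-≤ ∣ seq x N ∣ (ℚ.<⇒≤ (close n N N≤n ℕ.≤-refl)) ⟩
      1ℚ ℚ.+ ∣ seq x N ∣                         ∎

  *-close : ∀ K .{{_ : ℚ.Positive K}} a b δ → ∣ a ∣ ℚ.≤ K → ∣ b ∣ ℚ.< (δ ÷ K) {{ℚ.pos⇒nonZero K}} →
            ∣ a ℚ.* b ∣ ℚ.< δ
  *-close K a b δ a≤K b<δ/K = begin-strict
    ∣ a ℚ.* b ∣       ≡⟨ ℚ.∣p*q∣≡∣p∣*∣q∣ a b ⟩
    ∣ a ∣ ℚ.* ∣ b ∣   ≤⟨ ℚ.*-monoʳ-≤-nonNeg ∣ b ∣ {{ℚ.∣-∣-nonNeg b}} a≤K ⟩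
    K ℚ.* ∣ b ∣       <⟨ ℚ.*-monoʳ-<-pos K b<δ/K ⟩
    K ℚ.* (δ ÷ K)     ≡⟨ rearrange K δ (ℚ.1/ K) ⟩
    δ ℚ.* (K ÷ K)     ≡⟨ cong (δ ℚ.*_) (ℚ.*-inverseʳ K) ⟩
    δ ℚ.* 1ℚ          ≡⟨ ℚ.*-identityʳ δ ⟩
    δ                 ∎
    where
    open ℚ.≤-Reasoning
    instance
      K≢0 : ℚ.NonZero K
      K≢0 = ℚ.pos⇒nonZero K
    rearrange : ∀ K δ i → K ℚ.* (δ ℚ.* i) ≡ δ ℚ.* (K ℚ.* i)
    rearrange = solve 3 (λ K δ i → K :* (δ :* i) := δ :* (K :* i)) refl

  ÷-pos : ∀ K .{{_ : ℚ.Positive K}} {δ} → 0ℚ ℚ.< δ → 0ℚ ℚ.< (δ ÷ K) {{ℚ.pos⇒nonZero K}}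
  ÷-pos K {δ} 0<δ = subst (ℚ._< δ ÷ K) (ℚ.*-zeroˡ (ℚ.1/ K))
                      (ℚ.*-monoˡ-<-pos (ℚ.1/ K) {{ℚ.1/pos⇒pos K}} 0<δ)
    where
    instance
      K≢0 : ℚ.NonZero K
      K≢0 = ℚ.pos⇒nonZero K

  *-cauchy-step : ∀ K L .{{_ : ℚ.Positive K}} .{{_ : ℚ.Positive L}} a b c d ε →
                  ∣ a ∣ ℚ.≤ K → ∣ d ∣ ℚ.≤ L →
                  ∣ b ℚ.- d ∣ ℚ.< (½ ℚ.* ε ÷ K) {{ℚ.pos⇒nonZero K}} →
                  ∣ a ℚ.- c ∣ ℚ.< (½ ℚ.* ε ÷ L) {{ℚ.pos⇒nonZero L}} →
                  ∣ a ℚ.* b ℚ.- c ℚ.* d ∣ ℚ.< ε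
  *-cauchy-step K L a b c d ε a≤K d≤L p q = begin-strict
    ∣ a ℚ.* b ℚ.- c ℚ.* d ∣                        ≡⟨ cong ∣_∣ (split a b c d) ⟩
    ∣ a ℚ.* (b ℚ.- d) ℚ.+ d ℚ.* (a ℚ.- c) ∣        ≤⟨ ℚ.∣p+q∣≤∣p∣+∣q∣ (a ℚ.* (b ℚ.- d)) (d ℚ.* (a ℚ.- c)) ⟩
    ∣ a ℚ.* (b ℚ.- d) ∣ ℚ.+ ∣ d ℚ.* (a ℚ.- c) ∣    <⟨ ℚ.+-mono-< (*-close K a (b ℚ.- d) (½ ℚ.* ε) a≤K p)
                                                                 (*-close L d (a ℚ.- c) (½ ℚ.* ε) d≤L q) ⟩
    ½ ℚ.* ε ℚ.+ ½ ℚ.* ε                            ≡⟨ half+half ε ⟩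
    ε                                              ∎
    where
    open ℚ.≤-Reasoning
    split : ∀ a b c d → a ℚ.* b ℚ.- c ℚ.* d ≡ a ℚ.* (b ℚ.- d) ℚ.+ d ℚ.* (a ℚ.- c)
    split = solve 4 (λ a b c d → a :* b :- c :* d := a :* (b :- d) :+ d :* (a :- c)) refl

  *-cauchy : ∀ x y → EventuallyBounded x → EventuallyBounded y → ∀ ε → 0ℚ ℚ.< ε →
             ∃[ P ] (∀ m n → P ℕ.≤ m → P ℕ.≤ n →
                     ∣ seq x m ℚ.* seq y m ℚ.- seq x n ℚ.* seq y n ∣ ℚ.< ε)
  *-cauchy x y (K , M , 0<K , x≤K) (L , N , 0<L , y≤L) ε 0<ε =
    combine (cauchy y _ (÷-pos K (half-pos 0<ε))) (cauchy x _ (÷-pos L (half-pos 0<ε)))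
    where
    instance
      K>0 : ℚ.Positive K
      K>0 = ℚ.positive 0<K
      L>0 : ℚ.Positive L
      L>0 = ℚ.positive 0<L
    Close : ℝ → ℚ → ℕ → Set
    Close z δ P = ∀ m n → P ℕ.≤ m → P ℕ.≤ n → ∣ seq z m ℚ.- seq z n ∣ ℚ.< δ
    combine : ∃ (Close y ((½ ℚ.* ε ÷ K) {{ℚ.pos⇒nonZero K}})) →
              ∃ (Close x ((½ ℚ.* ε ÷ L) {{ℚ.pos⇒nonZero L}})) →
              ∃[ P ] (∀ m n → P ℕ.≤ m → P ℕ.≤ n →
                      ∣ seq x m ℚ.* seq y m ℚ.- seq x n ℚ.* seq y n ∣ ℚ.< ε)
    combine (P , p) (Q , q) = (M ℕ.⊔ N) ℕ.⊔ (P ℕ.⊔ Q) , λ m n m≥ n≥ →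
      *-cauchy-step K L (seq x m) (seq y m) (seq x n) (seq y n) ε
        (x≤K m (ℕ.m⊔n≤o⇒m≤o M N (ℕ.m⊔n≤o⇒m≤o (M ℕ.⊔ N) (P ℕ.⊔ Q) m≥)))
        (y≤L n (ℕ.m⊔n≤o⇒n≤o M N (ℕ.m⊔n≤o⇒m≤o (M ℕ.⊔ N) (P ℕ.⊔ Q) n≥)))
        (p m n (ℕ.m⊔n≤o⇒m≤o P Q (ℕ.m⊔n≤o⇒n≤o (M ℕ.⊔ N) (P ℕ.⊔ Q) m≥))
               (ℕ.m⊔n≤o⇒m≤o P Q (ℕ.m⊔n≤o⇒n≤o (M ℕ.⊔ N) (P ℕ.⊔ Q) n≥)))
        (q m n (ℕ.m⊔n≤o⇒n≤o P Q (ℕ.m⊔n≤o⇒n≤o (M ℕ.⊔ N) (P ℕ.⊔ Q) m≥))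
               (ℕ.m⊔n≤o⇒n≤o P Q (ℕ.m⊔n≤o⇒n≤o (M ℕ.⊔ N) (P ℕ.⊔ Q) n≥)))

fromℚ : ℚ → ℝ
fromℚ q = record
  { seq    = λ _ → q
  ; cauchy = λ ε 0<ε → 0 , λ _ _ _ _ →
      subst (ℚ._< ε) (sym (cong ∣_∣ (ℚ.+-inverseʳ q))) 0<ε
  }

infixl 6 _+ᴿ_ _-ᴿ_
infixl 7 _*ᴿ_

_+ᴿ_ : ℝ → ℝ → ℝ
seq    (x +ᴿ y) n = seq x n ℚ.+ seq y n
cauchy (x +ᴿ y) ε 0<ε with cauchy x (½ ℚ.* ε) (half-pos 0<ε) | cauchy y (½ ℚ.* ε) (half-pos 0<ε)
... | M , p | N , q = M ℕ.⊔ N , λ m n m≥ n≥ →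
  +-cauchy-step (seq x m) (seq y m) (seq x n) (seq y n) ε
    (p m n (ℕ.m⊔n≤o⇒m≤o M N m≥) (ℕ.m⊔n≤o⇒m≤o M N n≥))
    (q m n (ℕ.m⊔n≤o⇒n≤o M N m≥) (ℕ.m⊔n≤o⇒n≤o M N n≥))

-ᴿ_ : ℝ → ℝ
seq    (-ᴿ x) n = ℚ.- seq x n
cauchy (-ᴿ x) ε 0<ε with cauchy x ε 0<ε
... | N , p = N , λ m n m≥ n≥ →
  subst (ℚ._< ε) (sym (neg-step (seq x m) (seq x n))) (p m n m≥ n≥)

_-ᴿ_ : ℝ → ℝ → ℝ
x -ᴿ y = x +ᴿ (-ᴿ y)

_*ᴿ_ : ℝ → ℝ → ℝ
seq    (x *ᴿ y) n = seq x n ℚ.* seq y n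
cauchy (x *ᴿ y) = *-cauchy x y (eventually-bounded x) (eventually-bounded y)

record ℂ : Set where
  constructor _+i_
  field
    re im : ℝ

open ℂ

ℂ-rawRing : RawRing 0ℓ 0ℓ
ℂ-rawRing = record
  { Carrier = ℂ
  ; _≈_     = λ z w → (re z ≈ᴿ re w) × (im z ≈ᴿ im w)
  ; _+_     = λ z w → (re z +ᴿ re w) +i (im z +ᴿ im w)
  ; _*_     = λ z w → (re z *ᴿ re w -ᴿ im z *ᴿ im w) +i (re z *ᴿ im w +ᴿ im z *ᴿ re w)
  ; -_      = λ z → (-ᴿ re z) +i (-ᴿ im z)
  ; 0#      = fromℚ 0ℚ +i fromℚ 0ℚ
  ; 1#      = fromℚ 1ℚ +i fromℚ 0ℚ
  }

fromℤ : ℤ → ℂ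
fromℤ k = fromℚ (k ℚ./ 1) +i fromℚ 0ℚ

------------------------------------------------------------------------
-- Polynomials in one variable

module Polynomial {c ℓ} (R : RawRing c ℓ) where

  open RawRing R

  -- Coefficients in order of increasing degree.  Trailing zeros are
  -- allowed, and _≋_ ignores them.
  Poly : Set c
  Poly = List Carrier

  coeff : Poly → ℕ → Carrier
  coeff []      _       = 0#
  coeff (a ∷ p) zero    = a
  coeff (a ∷ p) (suc k) = coeff p k

  infix 4 _≋_
  _≋_ : Poly → Poly → Set ℓ
  p ≋ q = ∀ k → coeff p k ≈ coeff q k

  _+ᴾ_ : Poly → Poly → Poly
  []      +ᴾ q       = q
  (a ∷ p) +ᴾ []      = a ∷ p
  (a ∷ p) +ᴾ (b ∷ q) = (a + b) ∷ (p +ᴾ q)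

  _*ᴾ_ : Poly → Poly → Poly
  []      *ᴾ q = []
  (a ∷ p) *ᴾ q = List.map (a *_) q +ᴾ (0# ∷ (p *ᴾ q))

  rawRing : RawRing c ℓ
  rawRing = record
    { Carrier = Poly
    ; _≈_     = _≋_
    ; _+_     = _+ᴾ_
    ; _*_     = _*ᴾ_
    ; -_      = List.map (-_)
    ; 0#      = []
    ; 1#      = 1# ∷ []
    }

  -- _^_, product and divisibility in the polynomial ring.
  open RawSemiringDefinitions (RawRing.rawSemiring rawRing) public
    using (_^_; product; _∣_)

  eval : Poly → Carrier → Carrier
  eval []      x = 0#
  eval (a ∷ p) x = a + x * eval p x

  HasDegree : Poly → ℕ → Set ℓ
  HasDegree p d = ¬ (coeff p d ≈ 0#) × (∀ k → d ℕ.< k → coeff p k ≈ 0#)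

  X-_ : Carrier → Poly
  X- α = (- α) ∷ 1# ∷ []

  RepeatedRoot : Poly → Carrier → Set (c ⊔ ℓ)
  RepeatedRoot p α = (X- α) ^ 2 ∣ p

module ℤ[X] = Polynomial ℤ.+-*-rawRing
module ℂ[X] = Polynomial ℂ-rawRing

Separable : ℤ[X].Poly → Set
Separable f = ∀ α → ¬ ℂ[X].RepeatedRoot (List.map fromℤ f) α

FinitelyManySolutions : (ℤ → ℤ → Set) → Set
FinitelyManySolutions P = ∃[ S ] (∀ x y → P x y → (x , y) ∈ S)

------------------------------------------------------------------------
-- The ABC conjecture

-- The product of the distinct primes dividing n, for n > 0.
radical : ℕ → ℕ
radical n = List.foldr ℕ._*_ 1 (filter (λ p → prime? p ×-dec (p ∣? n)) (upTo (suc n)))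

-- ε runs over the positive rationals.  Writing ε = p / q in lowest terms,
-- c ≤ C N ^ (1 + ε) becomes c ^ q ≤ C ^ q * N ^ (q + p).  The constant may be
-- rounded up to a natural number.
ABCConjecture : Set
ABCConjecture =
  ∀ (ε : ℚ) → 0ℚ ℚ.< ε →
  ∃[ C ] (∀ a b c → 0 ℕ.< a → 0 ℕ.< b → 0 ℕ.< c →
          gcd a (gcd b c) ≡ 1 → a ℕ.+ b ≡ c →
          let N = radical (a ℕ.* b ℕ.* c)
              p = ℤ.∣ ↥ ε ∣
              q = ↧ₙ ε
          in c ℕ.^ q ℕ.≤ C ℕ.^ q ℕ.* N ℕ.^ (q ℕ.+ p))

{-# OPTIONS --safe #-}

-- Let F be the polynomial f.  Belyi's theorem, in its polynomial form, gives φ ∈ ℤ[X] and μ ≠ 0 such that φ sends the roots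
-- of F and its own critical points into {0, μ}.  Since F is squarefree this says φ(φ − μ) = φ′ F h up to a constant, and then
-- every prime factor of φ(x)(φ(x) − μ) μ divides c F(x) h(x) for a fixed c.  If F(x) = g(y), each prime factor of F(x)
-- divides ∏ gᵢ(y), whose square is at most |F(x)|.  Hence the radical in the ABC conjecture, applied to
-- φ(x) = (φ(x) − μ) + μ, is at most c |F(x)|^½ |h(x)| = O(|x|^(δ + 1 − d/2)) with δ = deg φ, against φ(x) ≍ |x|^δ.
-- As d > 2, this bounds x, and then y.
--
-- Separability is a statement about ℂ, so a polynomial over ℤ with a nontrivial gcd(f, f′) must be shown to have a complex
-- root.  The squarefree part R of the gcd takes arbitrarily small values at Gaussian rationals (d'Alembert's descent), and
-- from such a value Newton's iteration converges to a root.

module Submission where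

open import Defs
open import Algebra.Bundles using (CommutativeRing; RawRing)
import Algebra.Definitions.RawMagma as RawMagma
import Algebra.Solver.Ring.NaturalCoefficients.Default as SemiringSolver
open import Algebra.Structures using (IsCommutativeRing)
open import Data.Empty using (⊥-elim)
open import Data.Fin.Base using (Fin)
open import Data.Integer.Base as ℤ using (ℤ; -[1+_]; 0ℤ; 1ℤ)
import Data.Integer.Properties as ℤ
open import Data.List.Base as List using (List; []; _∷_; _++_; length; upTo)
open import Data.List.Membership.Propositional using (_∈_)
open import Data.List.Membership.Propositional.Properties using (∈-cartesianProduct⁺; ∈-map⁺; ∈-++⁺ˡ; ∈-++⁺ʳ; ∈-upTo⁺)
import Data.List.Properties as List
open import Data.List.Relation.Binary.Permutation.Propositional as Perm using (_↭_)
import Data.List.Relation.Binary.Permutation.Propositional.Properties as Perm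
open import Data.List.Relation.Unary.All as All using (All; []; _∷_)
open import Data.List.Relation.Unary.All.Properties using (all-filter)
open import Data.List.Relation.Unary.AllPairs using (_∷_; [])
open import Data.List.Relation.Unary.Linked using (Linked; _∷_)
open import Data.List.Relation.Unary.Unique.Propositional using (Unique)
open import Data.List.Relation.Unary.Unique.Propositional.Properties using (upTo⁺; filter⁺)
open import Data.Maybe.Base using (just; nothing)
open import Data.Nat.Base as ℕ using (ℕ; zero; suc; z≤n; s≤s)
open import Data.Nat.Coprimality using (1-coprimeTo)
import Data.Nat.Divisibility as ℕ∣
open import Data.Nat.Primality using (Prime; prime?; euclidsLemma)
open import Data.Nat.Primality.Factorisation using (factorisationHasAllPrimeFactors)
import Data.Nat.Properties as ℕ
import Data.Nat.Tactic.RingSolver as ℕSolver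
open import Data.Product.Base using (∃; ∃-syntax; _×_; _,_; proj₁; proj₂)
open import Data.Rational.Base as ℚ using (ℚ; mkℚ; 0ℚ; 1ℚ; ½)
import Data.Rational.Properties as ℚ
open import Data.Rational.Unnormalised.Base as ℚᵘ using (mkℚᵘ; *≡*)
import Data.Rational.Unnormalised.Properties as ℚᵘ
open import Data.Sum.Base using (_⊎_; inj₁; inj₂; [_,_]′)
open import Function.Base using (_∘_)
open import Level using (0ℓ; _⊔_)
open import Relation.Binary.PropositionalEquality hiding (setoid)
open import Relation.Nullary using (¬_; yes; no)
open import Relation.Nullary.Decidable using (_×-dec_)

-- The exponent comes from a degree count. φ(φ - μ) has degree 2δ, φ′ has degree δ - 1 and F has
-- degree d, so h has degree δ + 1 - d; F(x) contributes d/2 instead of d to the radical, and d ≥ 3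
-- brings the total to at most δ - 1/2, strictly below the degree of φ. That φ′F divides φ(φ - μ) is
-- the Riemann-Hurwitz count: where φ takes the value 0 or μ with multiplicity e, φ′ vanishes e - 1
-- times, which leaves room for exactly one simple root of F. No algebraic numbers enter: "the roots
-- of s go to roots of T" is read as "s divides a power of T ∘ φ over ℚ", and critical values come
-- from linear algebra. Separability only says that no complex number is a repeated root, so a root
-- must be built as a Cauchy sequence with explicit rates. Hence everything happens in ℚ(i): powers
-- of one unit replace the extraction of roots, the gain of a descent step is bounded below
-- uniformly on a disc, and the root is sought for a squarefree R, whose Bézout identity with R′
-- controls Newton's step.

-- Integer arithmetic

module Integers where

  open import Data.Integer.Base using (+_; _+_; _*_; ∣_∣)

  *-cancel-zero : ∀ {a b} → a ≢ 0ℤ → a * b ≡ 0ℤ → b ≡ 0ℤ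
  *-cancel-zero {a} a≢0 ab≡0 with ℤ.i*j≡0⇒i≡0∨j≡0 a ab≡0
  ... | inj₁ a≡0 = ⊥-elim (a≢0 a≡0)
  ... | inj₂ b≡0 = b≡0

  *-nonzero : ∀ {a b} → a ≢ 0ℤ → b ≢ 0ℤ → a * b ≢ 0ℤ
  *-nonzero a≢0 b≢0 ab≡0 = b≢0 (*-cancel-zero a≢0 ab≡0)

  nonzeroˡ : ∀ {a b} → a * b ≢ 0ℤ → a ≢ 0ℤ
  nonzeroˡ {b = b} ab≢0 refl = ab≢0 (ℤ.*-zeroˡ b)

  nonzeroʳ : ∀ {a b} → a * b ≢ 0ℤ → b ≢ 0ℤ
  nonzeroʳ {a} ab≢0 refl = ab≢0 (ℤ.*-zeroʳ a)

  *-cancelˡ : ∀ a b c → a ≢ 0ℤ → a * b ≡ a * c → b ≡ c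
  *-cancelˡ a b c a≢0 eq = ℤ.*-cancelˡ-≡ a b c {{ℤ.≢-nonZero a≢0}} eq

  -- The discrete substitute for a limit: a quantity divisible by arbitrarily large `n` is 0.
  -- Derivatives and coefficients of polynomials are recovered from integer values in this way.
  small-multiple : ∀ a b n → ∣ a ∣ ℕ.< n → a ≡ + n * b → a ≡ 0ℤ
  small-multiple a b n a<n a≡nb = ℤ.∣i∣≡0⇒i≡0 (go (∣ b ∣) (trans (cong ∣_∣ a≡nb) (ℤ.abs-* (+ n) b)))
    where
    go : ∀ k → ∣ a ∣ ≡ n ℕ.* k → ∣ a ∣ ≡ 0
    go zero    eq = trans eq (ℕ.*-zeroʳ n)
    go (suc k) eq = ⊥-elim (ℕ.<⇒≱ a<n (subst (n ℕ.≤_) (sym eq) (ℕ.m≤m*n n (suc k))))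

open Integers

-- Rational inequalities and the norms of ℚ(i)

module GaussianRationals where

  open import Data.Integer.Base using (+_)
  open import Data.Rational.Base using (_+_; _*_; _-_; -_; _≤_; _<_; ∣_∣; *≤*; toℚᵘ; 1/_; NonZero; Positive; positive; nonNegative) renaming (_/_ to _/ℚ_)
  open import Tactic.RingSolver using (solve-∀)
  open import Tactic.RingSolver.Core.AlmostCommutativeRing using (AlmostCommutativeRing; fromCommutativeRing)

  -- The ordered field ℚ

  ℚ-ring : AlmostCommutativeRing 0ℓ 0ℓ
  ℚ-ring = fromCommutativeRing ℚ.+-*-commutativeRing λ { (mkℚ (+ 0) 0 _) → just refl ; _ → nothing }

  ≤-by : ∀ {a b} e → 0ℚ ≤ e → a + e ≡ b → a ≤ b
  ≤-by {a} e 0≤e refl = subst (_≤ a + e) (ℚ.+-identityʳ a) (ℚ.+-monoʳ-≤ a 0≤e)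

  difference-nonneg : ∀ {a b} → a ≤ b → 0ℚ ≤ b - a
  difference-nonneg {a} {b} a≤b = subst (_≤ b - a) (ℚ.+-inverseʳ a) (ℚ.+-monoˡ-≤ (- a) a≤b)

  0≤+ : ∀ {a b} → 0ℚ ≤ a → 0ℚ ≤ b → 0ℚ ≤ a + b
  0≤+ 0≤a 0≤b = ℚ.+-mono-≤ 0≤a 0≤b

  *-monoʳ : ∀ {a b} c → 0ℚ ≤ c → a ≤ b → c * a ≤ c * b
  *-monoʳ c 0≤c = ℚ.*-monoˡ-≤-nonNeg c {{nonNegative 0≤c}}

  *-monoˡ : ∀ {a b} c → 0ℚ ≤ c → a ≤ b → a * c ≤ b * c
  *-monoˡ c 0≤c = ℚ.*-monoʳ-≤-nonNeg c {{nonNegative 0≤c}}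

  0≤* : ∀ {a b} → 0ℚ ≤ a → 0ℚ ≤ b → 0ℚ ≤ a * b
  0≤* {a} {b} 0≤a 0≤b = subst (_≤ a * b) (ℚ.*-zeroʳ a) (*-monoʳ a 0≤a 0≤b)

  0<* : ∀ {a b} → 0ℚ < a → 0ℚ < b → 0ℚ < a * b
  0<* {a} {b} 0<a 0<b = subst (_< a * b) (ℚ.*-zeroʳ a) (ℚ.*-monoʳ-<-pos a {{positive 0<a}} 0<b)

  *-mono : ∀ {a b c d} → 0ℚ ≤ a → 0ℚ ≤ d → a ≤ b → c ≤ d → a * c ≤ b * d
  *-mono {a} {b} {c} {d} 0≤a 0≤d a≤b c≤d = ℚ.≤-trans (*-monoʳ a 0≤a c≤d) (*-monoˡ d 0≤d a≤b)

  <⇒≱ : ∀ {a b} → a < b → ¬ b ≤ a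
  <⇒≱ a<b b≤a = ℚ.<-irrefl refl (ℚ.<-≤-trans a<b b≤a)

  square-nonneg : ∀ a → 0ℚ ≤ a * a
  square-nonneg a with ℚ.≤-total 0ℚ a
  ... | inj₁ 0≤a = 0≤* 0≤a 0≤a
  ... | inj₂ a≤0 = subst (0ℚ ≤_) (eq a) (0≤* (ℚ.neg-antimono-≤ a≤0) (ℚ.neg-antimono-≤ a≤0))
    where
    eq : ∀ a → - a * - a ≡ a * a
    eq = solve-∀ ℚ-ring

  square-cancel-≤ : ∀ {a b} → 0ℚ ≤ b → a * a ≤ b * b → a ≤ b
  square-cancel-≤ {a} {b} 0≤b a²≤b² = ℚ.≮⇒≥ λ b<a → <⇒≱ (ℚ.≤-<-trans (*-monoʳ b 0≤b (ℚ.<⇒≤ b<a))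
    (ℚ.*-monoˡ-<-pos a {{positive (ℚ.≤-<-trans 0≤b b<a)}} b<a)) a²≤b²

  *-cancel-≤ : ∀ {a b} c → 0ℚ < c → c * a ≤ c * b → a ≤ b
  *-cancel-≤ {a} {b} c 0<c ca≤cb = ℚ.≮⇒≥ λ b<a → <⇒≱ (ℚ.*-monoʳ-<-pos c {{positive 0<c}} b<a) ca≤cb

  p≤∣p∣ : ∀ p → p ≤ ∣ p ∣
  p≤∣p∣ p with ℚ.≤-total 0ℚ p
  ... | inj₁ 0≤p = ℚ.≤-reflexive (sym (ℚ.0≤p⇒∣p∣≡p 0≤p))
  ... | inj₂ p≤0 = ℚ.≤-trans p≤0 (ℚ.0≤∣p∣ p)

  ∣p∣*∣p∣ : ∀ p → ∣ p ∣ * ∣ p ∣ ≡ p * p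
  ∣p∣*∣p∣ p = trans (sym (ℚ.∣p*q∣≡∣p∣*∣q∣ p p)) (ℚ.0≤p⇒∣p∣≡p (square-nonneg p))

  reciprocal : ∀ a → 0ℚ < a → ∃[ b ] (0ℚ < b × a * b ≡ 1ℚ)
  reciprocal a 0<a = (1/ a) , ℚ.positive⁻¹ (1/ a) {{ℚ.1/pos⇒pos a}} , ℚ.*-inverseʳ a
    where
    instance
      _ : Positive a
      _ = positive 0<a
      _ : NonZero a
      _ = ℚ.pos⇒nonZero a

  scale-below : ∀ a b → 0ℚ ≤ a → 0ℚ < b → ∃[ t ] (0ℚ < t × t ≤ 1ℚ × a * t ≤ b)
  -- The witness is `b / (a + b)`, which works for `a = 0` as well.
  scale-below a b 0≤a 0<b = let c , 0<c , inv = reciprocal (a + b) 0<a+b in b * c , 0<* 0<b 0<c ,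
    ≤-by (a * c) (0≤* 0≤a (ℚ.<⇒≤ 0<c)) (trans (eq a b c) inv) ,
    ≤-by (b * (b * c)) (0≤* (ℚ.<⇒≤ 0<b) (0≤* (ℚ.<⇒≤ 0<b) (ℚ.<⇒≤ 0<c))) (trans (eq′ a b c) (trans (cong (b *_) inv)
      (ℚ.*-identityʳ b)))
    where
    0<a+b : 0ℚ < a + b
    0<a+b = ℚ.+-mono-≤-< 0≤a 0<b
    eq : ∀ a b c → b * c + a * c ≡ (a + b) * c
    eq = solve-∀ ℚ-ring
    eq′ : ∀ a b c → a * (b * c) + b * (b * c) ≡ b * ((a + b) * c)
    eq′ = solve-∀ ℚ-ring

  positive-lower-bound : ∀ {a b} → 0ℚ < a → 0ℚ < b → ∃[ c ] (0ℚ < c × c ≤ a × c ≤ b)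
  positive-lower-bound {a} {b} 0<a 0<b with ℚ.≤-total a b
  ... | inj₁ a≤b = a , 0<a , ℚ.≤-refl , a≤b
  ... | inj₂ b≤a = b , 0<b , b≤a , ℚ.≤-refl

  -- The embedding of ℤ

  ι : ℤ → ℚ
  ι k = k /ℚ 1

  ι≃ : ∀ k → toℚᵘ (ι k) ℚᵘ.≃ mkℚᵘ k 0
  ι≃ k = ℚ.toℚᵘ-fromℚᵘ (mkℚᵘ k 0)

  ι-+ : ∀ a b → ι (a ℤ.+ b) ≡ ι a + ι b
  ι-+ a b = ℚ.toℚᵘ-injective (ℚᵘ.≃-trans (ι≃ (a ℤ.+ b)) (ℚᵘ.≃-sym (ℚᵘ.≃-trans (ℚ.toℚᵘ-homo-+ (ι a) (ι b))
    (ℚᵘ.≃-trans (ℚᵘ.+-cong (ι≃ a) (ι≃ b)) (*≡* (cong (ℤ._* 1ℤ) (cong₂ ℤ._+_ (ℤ.*-identityʳ a) (ℤ.*-identityʳ b))))))))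

  ι-* : ∀ a b → ι (a ℤ.* b) ≡ ι a * ι b
  ι-* a b = ℚ.toℚᵘ-injective (ℚᵘ.≃-trans (ι≃ (a ℤ.* b)) (ℚᵘ.≃-sym (ℚᵘ.≃-trans (ℚ.toℚᵘ-homo-* (ι a) (ι b))
    (ℚᵘ.≃-trans (ℚᵘ.*-cong (ι≃ a) (ι≃ b)) (*≡* refl)))))

  ι-injective : ∀ {a b} → ι a ≡ ι b → a ≡ b
  ι-injective {a} {b} eq with ℚᵘ.≃-trans (ℚᵘ.≃-sym (ι≃ a)) (ℚᵘ.≃-trans (ℚ.toℚᵘ-cong eq) (ι≃ b))
  ... | *≡* a*1≡b*1 = trans (sym (ℤ.*-identityʳ a)) (trans a*1≡b*1 (ℤ.*-identityʳ b))

  0≤ι+ : ∀ n → 0ℚ ≤ ι (+ n)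
  0≤ι+ zero    = ℚ.≤-refl
  0≤ι+ (suc n) = subst (0ℚ ≤_) (sym (ι-+ 1ℤ (+ n))) (0≤+ (ℚ.<⇒≤ (ℚ.positive⁻¹ 1ℚ)) (0≤ι+ n))

  1≤ι+ : ∀ n → 1ℚ ≤ ι (+ suc n)
  1≤ι+ n = ≤-by (ι (+ n)) (0≤ι+ n) (sym (ι-+ 1ℤ (+ n)))

  1≤∣ι∣ : ∀ {k} → k ≢ 0ℤ → 1ℚ ≤ ∣ ι k ∣
  1≤∣ι∣ {+ zero}  k≢0 = ⊥-elim (k≢0 refl)
  1≤∣ι∣ {+ suc n} k≢0 = ℚ.≤-trans (1≤ι+ n) (p≤∣p∣ (ι (+ suc n)))
  1≤∣ι∣ { -[1+ n ]} k≢0 = subst (1ℚ ≤_) (sym (trans (cong ∣_∣ neg) (ℚ.∣-p∣≡∣p∣ (ι (+ suc n))))) (ℚ.≤-trans (1≤ι+ n)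
    (p≤∣p∣ (ι (+ suc n))))
    where
    neg : ι -[1+ n ] ≡ - ι (+ suc n)
    neg = refl

  archimedean : ∀ q → ∃[ n ] q ≤ ι (+ n)
  archimedean q@(mkℚ k d _) = ℤ.∣ k ∣ , ℚ.toℚᵘ-cancel-≤ (ℚᵘ.≤-respʳ-≃ (ℚᵘ.≃-sym (ι≃ (+ ℤ.∣ k ∣))) (ℚᵘ.*≤* (k≤ k)))
    where
    k≤ : ∀ k → k ℤ.* 1ℤ ℤ.≤ + ℤ.∣ k ∣ ℤ.* + suc d
    k≤ k = subst₂ ℤ._≤_ (sym (ℤ.*-identityʳ k)) (ℤ.pos-* ℤ.∣ k ∣ (suc d)) (ℤ.≤-trans (i≤∣i∣ k) (ℤ.+≤+ (ℕ.m≤m*n ℤ.∣ k ∣ (suc d))))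
      where
      i≤∣i∣ : ∀ i → i ℤ.≤ + ℤ.∣ i ∣
      i≤∣i∣ (+ n)    = ℤ.≤-refl
      i≤∣i∣ -[1+ n ] = ℤ.-≤+

  infix 5 _+ⁱ_
  record 𝔾 : Set where
    constructor _+ⁱ_
    field
      re im : ℚ

  open 𝔾 public

  infixl 6 _∔_ _⊖_
  infixl 7 _·_

  _∔_ _·_ _⊖_ : 𝔾 → 𝔾 → 𝔾
  z ∔ w = (re z + re w) +ⁱ (im z + im w)
  z · w = (re z * re w - im z * im w) +ⁱ (re z * im w + im z * re w)
  z ⊖ w = (re z - re w) +ⁱ (im z - im w)

  neg conj : 𝔾 → 𝔾
  neg z = (- re z) +ⁱ (- im z)
  conj z = re z +ⁱ (- im z)

  real : ℚ → 𝔾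
  real q = q +ⁱ 0ℚ

  0𝔾 1𝔾 : 𝔾
  0𝔾 = real 0ℚ
  1𝔾 = real 1ℚ

  𝔾-≡ : ∀ {a b c d} → a ≡ c → b ≡ d → (a +ⁱ b) ≡ (c +ⁱ d)
  𝔾-≡ refl refl = refl

  opaque
    𝔾-isCommutativeRing : IsCommutativeRing _≡_ _∔_ _·_ neg 0𝔾 1𝔾
    𝔾-isCommutativeRing = record
        { isRing = record
          { +-isAbelianGroup = record
            { isGroup = record
              { isMonoid = record
                { isSemigroup = record
                  { isMagma = record { isEquivalence = isEquivalence ; ∙-cong = cong₂ _∔_ }
                  ; assoc = λ x y z → 𝔾-≡ (ℚ.+-assoc (re x) (re y) (re z)) (ℚ.+-assoc (im x) (im y) (im z)) }
                ; identity = (λ x → 𝔾-≡ (ℚ.+-identityˡ (re x)) (ℚ.+-identityˡ (im x))) , (λ x → 𝔾-≡ (ℚ.+-identityʳ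
                  (re x)) (ℚ.+-identityʳ (im x))) }
              ; inverse = (λ x → 𝔾-≡ (ℚ.+-inverseˡ (re x)) (ℚ.+-inverseˡ (im x))) , (λ x → 𝔾-≡ (ℚ.+-inverseʳ (re x))
                (ℚ.+-inverseʳ (im x)))
              ; ⁻¹-cong = cong neg }
            ; comm = λ x y → 𝔾-≡ (ℚ.+-comm (re x) (re y)) (ℚ.+-comm (im x) (im y)) }
          ; *-cong = cong₂ _·_
          ; *-assoc = λ x y z → 𝔾-≡ (assoc-re (re x) (im x) (re y) (im y) (re z) (im z)) (assoc-im (re x) (im x)
            (re y) (im y) (re z) (im z))
          ; *-identity = (λ x → 𝔾-≡ (idˡ-re (re x) (im x)) (idˡ-im (re x) (im x))) , (λ x → 𝔾-≡ (idʳ-re (re x)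
            (im x)) (idʳ-im (re x) (im x)))
          ; distrib = (λ x y z → 𝔾-≡ (distˡ-re (re x) (im x) (re y) (im y) (re z) (im z)) (distˡ-im (re x) (im x)
            (re y) (im y) (re z) (im z)))
                    , (λ x y z → 𝔾-≡ (distʳ-re (re x) (im x) (re y) (im y) (re z) (im z)) (distʳ-im (re x) (im x)
                      (re y) (im y) (re z) (im z))) }
        ; *-comm = λ x y → 𝔾-≡ (comm-re (re x) (im x) (re y) (im y)) (comm-im (re x) (im x) (re y) (im y)) }
      where
      assoc-re : ∀ a b c d e f → (a * c - b * d) * e - (a * d + b * c) * f ≡ a * (c * e - d * f) - b * (c * f + d * e)
      assoc-re = solve-∀ ℚ-ring
      assoc-im : ∀ a b c d e f → (a * c - b * d) * f + (a * d + b * c) * e ≡ a * (c * f + d * e) + b * (c * e - d * f)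
      assoc-im = solve-∀ ℚ-ring
      idˡ-re : ∀ a b → 1ℚ * a - 0ℚ * b ≡ a
      idˡ-re = solve-∀ ℚ-ring
      idˡ-im : ∀ a b → 1ℚ * b + 0ℚ * a ≡ b
      idˡ-im = solve-∀ ℚ-ring
      idʳ-re : ∀ a b → a * 1ℚ - b * 0ℚ ≡ a
      idʳ-re = solve-∀ ℚ-ring
      idʳ-im : ∀ a b → a * 0ℚ + b * 1ℚ ≡ b
      idʳ-im = solve-∀ ℚ-ring
      distˡ-re : ∀ a b c d e f → a * (c + e) - b * (d + f) ≡ (a * c - b * d) + (a * e - b * f)
      distˡ-re = solve-∀ ℚ-ring
      distˡ-im : ∀ a b c d e f → a * (d + f) + b * (c + e) ≡ (a * d + b * c) + (a * f + b * e)
      distˡ-im = solve-∀ ℚ-ring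
      distʳ-re : ∀ a b c d e f → (c + e) * a - (d + f) * b ≡ (c * a - d * b) + (e * a - f * b)
      distʳ-re = solve-∀ ℚ-ring
      distʳ-im : ∀ a b c d e f → (c + e) * b + (d + f) * a ≡ (c * b + d * a) + (e * b + f * a)
      distʳ-im = solve-∀ ℚ-ring
      comm-re : ∀ a b c d → a * c - b * d ≡ c * a - d * b
      comm-re = solve-∀ ℚ-ring
      comm-im : ∀ a b c d → a * d + b * c ≡ c * b + d * a
      comm-im = solve-∀ ℚ-ring

  𝔾-commutativeRing : CommutativeRing 0ℓ 0ℓ
  𝔾-commutativeRing = record { isCommutativeRing = 𝔾-isCommutativeRing }

  𝔾-ring : AlmostCommutativeRing 0ℓ 0ℓ
  𝔾-ring = fromCommutativeRing 𝔾-commutativeRing λ { (mkℚ (+ 0) 0 _ +ⁱ mkℚ (+ 0) 0 _) → just refl ; _ → nothing }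

  -- The taxicab norm is submultiplicative and rational; N is the square of the modulus.

  ‖_‖ N : 𝔾 → ℚ
  ‖ z ‖ = ∣ re z ∣ + ∣ im z ∣
  N z = re z * re z + im z * im z

  0≤‖‖ : ∀ z → 0ℚ ≤ ‖ z ‖
  0≤‖‖ z = 0≤+ (ℚ.0≤∣p∣ (re z)) (ℚ.0≤∣p∣ (im z))

  ‖∔‖ : ∀ z w → ‖ z ∔ w ‖ ≤ ‖ z ‖ + ‖ w ‖
  ‖∔‖ z w = ℚ.≤-trans (ℚ.+-mono-≤ (ℚ.∣p+q∣≤∣p∣+∣q∣ (re z) (re w)) (ℚ.∣p+q∣≤∣p∣+∣q∣ (im z) (im w)))
    (ℚ.≤-reflexive (eq (∣ re z ∣) (∣ re w ∣) (∣ im z ∣) (∣ im w ∣)))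
    where
    eq : ∀ a b c d → (a + b) + (c + d) ≡ (a + c) + (b + d)
    eq = solve-∀ ℚ-ring

  ‖neg‖ : ∀ z → ‖ neg z ‖ ≡ ‖ z ‖
  ‖neg‖ z = cong₂ _+_ (ℚ.∣-p∣≡∣p∣ (re z)) (ℚ.∣-p∣≡∣p∣ (im z))

  ‖conj‖ : ∀ z → ‖ conj z ‖ ≡ ‖ z ‖
  ‖conj‖ z = cong (λ t → ∣ re z ∣ + t) (ℚ.∣-p∣≡∣p∣ (im z))

  ‖⊖‖ : ∀ z w → ‖ z ⊖ w ‖ ≤ ‖ z ‖ + ‖ w ‖
  ‖⊖‖ z w = subst (λ t → ‖ z ⊖ w ‖ ≤ ‖ z ‖ + t) (‖neg‖ w) (‖∔‖ z (neg w))

  ‖·‖ : ∀ z w → ‖ z · w ‖ ≤ ‖ z ‖ * ‖ w ‖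
  ‖·‖ z w = ℚ.≤-trans
    (ℚ.+-mono-≤ (ℚ.≤-trans (ℚ.∣p-q∣≤∣p∣+∣q∣ (re z * re w) (im z * im w)) (ℚ.≤-reflexive (cong₂ _+_ (ℚ.∣p*q∣≡∣p∣*∣q∣
        (re z) (re w)) (ℚ.∣p*q∣≡∣p∣*∣q∣ (im z) (im w)))))
                (ℚ.≤-trans (ℚ.∣p+q∣≤∣p∣+∣q∣ (re z * im w) (im z * re w)) (ℚ.≤-reflexive (cong₂ _+_ (ℚ.∣p*q∣≡∣p∣*∣q∣
                    (re z) (im w)) (ℚ.∣p*q∣≡∣p∣*∣q∣ (im z) (re w))))))
    (ℚ.≤-reflexive (eq (∣ re z ∣) (∣ im z ∣) (∣ re w ∣) (∣ im w ∣)))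
    where
    eq : ∀ a b c d → (a * c + b * d) + (a * d + b * c) ≡ (a + b) * (c + d)
    eq = solve-∀ ℚ-ring

  ‖real‖ : ∀ q → ‖ real q ‖ ≡ ∣ q ∣
  ‖real‖ q = ℚ.+-identityʳ ∣ q ∣

  real-re : ∀ q z → real q · z ≡ ((q * re z) +ⁱ (q * im z))
  real-re q z = 𝔾-≡ (eq q (re z) (im z)) (eq′ q (re z) (im z))
    where
    eq : ∀ q a b → q * a - 0ℚ * b ≡ q * a
    eq = solve-∀ ℚ-ring
    eq′ : ∀ q a b → q * b + 0ℚ * a ≡ q * b
    eq′ = solve-∀ ℚ-ring

  ‖real·‖ : ∀ q z → ‖ real q · z ‖ ≡ ∣ q ∣ * ‖ z ‖
  ‖real·‖ q z = trans (cong ‖_‖ (real-re q z)) (trans (cong₂ _+_ (ℚ.∣p*q∣≡∣p∣*∣q∣ q (re z)) (ℚ.∣p*q∣≡∣p∣*∣q∣ q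
    (im z))) (sym (ℚ.*-distribˡ-+ ∣ q ∣ (∣ re z ∣) (∣ im z ∣))))

  N-· : ∀ z w → N (z · w) ≡ N z * N w
  N-· z w = eq (re z) (im z) (re w) (im w)
    where
    eq : ∀ a b c d → (a * c - b * d) * (a * c - b * d) + (a * d + b * c) * (a * d + b * c) ≡ (a * a + b * b) * (c * c + d * d)
    eq = solve-∀ ℚ-ring

  0≤N : ∀ z → 0ℚ ≤ N z
  0≤N z = 0≤+ (square-nonneg (re z)) (square-nonneg (im z))

  2ℚ : ℚ
  2ℚ = 1ℚ + 1ℚ

  N≤‖‖² : ∀ z → N z ≤ ‖ z ‖ * ‖ z ‖
  N≤‖‖² z = ≤-by (2ℚ * (∣ re z ∣ * ∣ im z ∣)) (0≤* (ℚ.<⇒≤ (ℚ.positive⁻¹ 2ℚ)) (0≤* (ℚ.0≤∣p∣ (re z)) (ℚ.0≤∣p∣ (im z))))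
    (trans (cong (_+ 2ℚ * (∣ re z ∣ * ∣ im z ∣)) (sym (cong₂ _+_ (∣p∣*∣p∣ (re z)) (∣p∣*∣p∣ (im z))))) (eq (∣ re z ∣) (∣ im z ∣)))
    where
    eq : ∀ a b → a * a + b * b + (1ℚ + 1ℚ) * (a * b) ≡ (a + b) * (a + b)
    eq = solve-∀ ℚ-ring

  ‖‖²≤2N : ∀ z → ‖ z ‖ * ‖ z ‖ ≤ 2ℚ * N z
  ‖‖²≤2N z = ≤-by ((∣ re z ∣ - ∣ im z ∣) * (∣ re z ∣ - ∣ im z ∣)) (square-nonneg (∣ re z ∣ - ∣ im z ∣))
    (trans (eq (∣ re z ∣) (∣ im z ∣)) (cong (2ℚ *_) (cong₂ _+_ (∣p∣*∣p∣ (re z)) (∣p∣*∣p∣ (im z)))))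
    where
    eq : ∀ a b → (a + b) * (a + b) + (a - b) * (a - b) ≡ (1ℚ + 1ℚ) * (a * a + b * b)
    eq = solve-∀ ℚ-ring

  -- After squaring, both sides are compared with the multiplicative `N` through
  -- `N z ≤ ‖z‖² ≤ 2 N z`. The factor 2 is the price of a norm without square roots.
  ‖·‖-lower : ∀ z w → ‖ z ‖ * ‖ w ‖ ≤ 2ℚ * ‖ z · w ‖
  ‖·‖-lower z w = square-cancel-≤ (0≤* (ℚ.<⇒≤ (ℚ.positive⁻¹ 2ℚ)) (0≤‖‖ (z · w))) (ℚ.≤-trans
    (ℚ.≤-reflexive (eq (‖ z ‖) (‖ w ‖)))
    (ℚ.≤-trans (*-mono (0≤* (0≤‖‖ z) (0≤‖‖ z)) (0≤* (ℚ.<⇒≤ (ℚ.positive⁻¹ 2ℚ)) (0≤N w)) (‖‖²≤2N z) (‖‖²≤2N w))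
    (ℚ.≤-trans (ℚ.≤-reflexive (trans (eq′ (N z) (N w)) (cong ((2ℚ * 2ℚ) *_) (sym (N-· z w)))))
    (ℚ.≤-trans (*-monoʳ (2ℚ * 2ℚ) (ℚ.<⇒≤ (ℚ.positive⁻¹ (2ℚ * 2ℚ))) (N≤‖‖² (z · w))) (ℚ.≤-reflexive (eq″ (‖ z · w ‖)))))))
    where
    eq : ∀ a b → (a * b) * (a * b) ≡ (a * a) * (b * b)
    eq = solve-∀ ℚ-ring
    eq′ : ∀ a b → ((1ℚ + 1ℚ) * a) * ((1ℚ + 1ℚ) * b) ≡ ((1ℚ + 1ℚ) * (1ℚ + 1ℚ)) * (a * b)
    eq′ = solve-∀ ℚ-ring
    eq″ : ∀ a → ((1ℚ + 1ℚ) * (1ℚ + 1ℚ)) * (a * a) ≡ ((1ℚ + 1ℚ) * a) * ((1ℚ + 1ℚ) * a)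
    eq″ = solve-∀ ℚ-ring

  ∣re∣≤‖‖ : ∀ z → ∣ re z ∣ ≤ ‖ z ‖
  ∣re∣≤‖‖ z = ≤-by (∣ im z ∣) (ℚ.0≤∣p∣ (im z)) refl

  ∣im∣≤‖‖ : ∀ z → ∣ im z ∣ ≤ ‖ z ‖
  ∣im∣≤‖‖ z = ≤-by (∣ re z ∣) (ℚ.0≤∣p∣ (re z)) (ℚ.+-comm (∣ im z ∣) (∣ re z ∣))

  re≤‖‖ : ∀ z → re z ≤ ‖ z ‖
  re≤‖‖ z = ℚ.≤-trans (p≤∣p∣ (re z)) (∣re∣≤‖‖ z)

-- Rational directions pointing against a given number

module Directions where

  open import Data.Rational.Base using (_+_; _*_; _-_; -_; _≤_; _<_) renaming (_/_ to _/ℚ_)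
  open import Tactic.RingSolver using (solve-∀)
  open import Data.Integer.Tactic.RingSolver using () renaming (ring to ℤ-ring)
  open GaussianRationals

  infixr 8 _^𝔾_ _^ℚ_
  _^𝔾_ : 𝔾 → ℕ → 𝔾
  z ^𝔾 zero  = 1𝔾
  z ^𝔾 suc n = z · z ^𝔾 n

  _^ℚ_ : ℚ → ℕ → ℚ
  q ^ℚ zero  = 1ℚ
  q ^ℚ suc n = q * q ^ℚ n

  num : ℕ → ℚ
  num n = ι (ℤ.+ n)

  0≤num : ∀ n → 0ℚ ≤ num n
  0≤num = 0≤ι+

  0<num : ∀ n → 0ℚ < num (suc n)
  0<num n = ℚ.<-≤-trans (ℚ.positive⁻¹ 1ℚ) (1≤ι+ n)

  num-suc : ∀ n → num (suc n) ≡ 1ℚ + num n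
  num-suc n = ι-+ 1ℤ (ℤ.+ n)

  N-^ : ∀ {z} → N z ≡ 1ℚ → ∀ n → N (z ^𝔾 n) ≡ 1ℚ
  N-^     Nz≡1 zero    = refl
  N-^ {z} Nz≡1 (suc n) = trans (N-· z (z ^𝔾 n)) (cong₂ _*_ Nz≡1 (N-^ {z} Nz≡1 n))

  ^𝔾-* : ∀ z m n → (z ^𝔾 m) ^𝔾 n ≡ z ^𝔾 (n ℕ.* m)
  ^𝔾-+ : ∀ z m n → z ^𝔾 (m ℕ.+ n) ≡ z ^𝔾 m · z ^𝔾 n
  ^𝔾-+ z zero    n = eq (z ^𝔾 n)
    where
    eq : ∀ a → a ≡ 1𝔾 · a
    eq = solve-∀ 𝔾-ring
  ^𝔾-+ z (suc m) n = trans (cong (z ·_) (^𝔾-+ z m n)) (eq z (z ^𝔾 m) (z ^𝔾 n))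
    where
    eq : ∀ a b c → a · (b · c) ≡ (a · b) · c
    eq = solve-∀ 𝔾-ring
  ^𝔾-* z m zero    = refl
  ^𝔾-* z m (suc n) = trans (cong (z ^𝔾 m ·_) (^𝔾-* z m n)) (sym (^𝔾-+ z m (n ℕ.* m)))

  ^𝔾-· : ∀ z w n → (z · w) ^𝔾 n ≡ z ^𝔾 n · w ^𝔾 n
  ^𝔾-· z w zero    = refl
  ^𝔾-· z w (suc n) = trans (cong (z · w ·_) (^𝔾-· z w n)) (eq z w (z ^𝔾 n) (w ^𝔾 n))
    where
    eq : ∀ a b c d → (a · b) · (c · d) ≡ (a · c) · (b · d)
    eq = solve-∀ 𝔾-ring

  real-· : ∀ p q → real p · real q ≡ real (p * q)
  real-· p q = 𝔾-≡ (eq p q) (eq′ p q)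
    where
    eq : ∀ p q → p * q - 0ℚ * 0ℚ ≡ p * q
    eq = solve-∀ ℚ-ring
    eq′ : ∀ p q → p * 0ℚ + 0ℚ * q ≡ 0ℚ
    eq′ = solve-∀ ℚ-ring

  real-^ : ∀ q n → real q ^𝔾 n ≡ real (q ^ℚ n)
  real-^ q zero    = refl
  real-^ q (suc n) = trans (cong (real q ·_) (real-^ q n)) (real-· q (q ^ℚ n))

  ι-neg : ∀ a → ι (ℤ.- a) ≡ - ι a
  ι-neg (ℤ.+ zero)  = refl
  ι-neg (ℤ.+ suc n) = refl
  ι-neg -[1+ n ]    = sym (neg-involutive (ι (ℤ.+ suc n)))
    where
    neg-involutive : ∀ q → - - q ≡ q
    neg-involutive = solve-∀ ℚ-ring

  -- The powers of (3 + 4i)/5 never return to 1, because those of 3 + 4i are ≡ 3 + 4i modulo 5.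
  unit : 𝔾
  unit = (ℤ.+ 3 /ℚ 5) +ⁱ (ℤ.+ 4 /ℚ 5)

  integral : ℤ → ℤ → 𝔾
  integral a b = ι a +ⁱ ι b

  powers-mod-5 : ∀ n → ∃[ s ] ∃[ t ] (integral (ℤ.+ 3) (ℤ.+ 4) ^𝔾 suc n ≡ integral (ℤ.+ 5 ℤ.* s ℤ.+ ℤ.+ 3) (ℤ.+ 5 ℤ.* t ℤ.+ ℤ.+ 4))
  powers-mod-5 zero    = 0ℤ , 0ℤ , refl
  powers-mod-5 (suc n) = let s , t , eq = powers-mod-5 n in
    ℤ.+ 3 ℤ.* s ℤ.- ℤ.+ 4 ℤ.* t ℤ.- ℤ.+ 2 , ℤ.+ 4 ℤ.* s ℤ.+ ℤ.+ 3 ℤ.* t ℤ.+ ℤ.+ 4 ,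
    trans (cong (integral (ℤ.+ 3) (ℤ.+ 4) ·_) eq) (𝔾-≡
      (trans (sym (trans (cong ι (re≡ s t)) (trans (ι-+ (ℤ.+ 3 ℤ.* (ℤ.+ 5 ℤ.* s ℤ.+ ℤ.+ 3))
          (ℤ.- (ℤ.+ 4 ℤ.* (ℤ.+ 5 ℤ.* t ℤ.+ ℤ.+ 4))))
        (cong₂ _+_ (ι-* (ℤ.+ 3) (ℤ.+ 5 ℤ.* s ℤ.+ ℤ.+ 3)) (trans (ι-neg (ℤ.+ 4 ℤ.* (ℤ.+ 5 ℤ.* t ℤ.+ ℤ.+ 4)))
            (cong -_ (ι-* (ℤ.+ 4) (ℤ.+ 5 ℤ.* t ℤ.+ ℤ.+ 4)))))))) refl)
      (sym (trans (cong ι (im≡ s t)) (trans (ι-+ (ℤ.+ 3 ℤ.* (ℤ.+ 5 ℤ.* t ℤ.+ ℤ.+ 4)) (ℤ.+ 4 ℤ.* (ℤ.+ 5 ℤ.* s ℤ.+ ℤ.+ 3)))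
        (cong₂ _+_ (ι-* (ℤ.+ 3) (ℤ.+ 5 ℤ.* t ℤ.+ ℤ.+ 4)) (ι-* (ℤ.+ 4) (ℤ.+ 5 ℤ.* s ℤ.+ ℤ.+ 3)))))))
    where
    re≡ : ∀ s t → ℤ.+ 5 ℤ.* (ℤ.+ 3 ℤ.* s ℤ.- ℤ.+ 4 ℤ.* t ℤ.- ℤ.+ 2) ℤ.+ ℤ.+ 3 ≡ ℤ.+ 3 ℤ.* (ℤ.+ 5 ℤ.* s ℤ.+ ℤ.+ 3) ℤ.- ℤ.+ 4 ℤ.* (ℤ.+ 5 ℤ.* t ℤ.+ ℤ.+ 4)
    re≡ = solve-∀ ℤ-ring
    im≡ : ∀ s t → ℤ.+ 5 ℤ.* (ℤ.+ 4 ℤ.* s ℤ.+ ℤ.+ 3 ℤ.* t ℤ.+ ℤ.+ 4) ℤ.+ ℤ.+ 4 ≡ ℤ.+ 3 ℤ.* (ℤ.+ 5 ℤ.* t ℤ.+ ℤ.+ 4) ℤ.+ ℤ.+ 4 ℤ.* (ℤ.+ 5 ℤ.* s ℤ.+ ℤ.+ 3)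
    im≡ = solve-∀ ℤ-ring

  unit-power≢1 : ∀ n → unit ^𝔾 suc n ≢ 1𝔾
  unit-power≢1 n unitⁿ≡1 = let s , t , eq = powers-mod-5 n in no-zero t (ι-injective {ℤ.+ 5 ℤ.* t ℤ.+ ℤ.+ 4} {0ℤ}
    (trans (cong im (sym eq)) (trans (cong im (trans (^𝔾-· (real (num 5)) unit (suc n)) (cong₂ _·_ (real-^ (num 5)
        (suc n)) unitⁿ≡1))) (zero-im (num 5 ^ℚ suc n)))))
    where
    zero-im : ∀ q → q * 0ℚ + 0ℚ * 1ℚ ≡ 0ℚ
    zero-im = solve-∀ ℚ-ring
    no-zero : ∀ t → ℤ.+ 5 ℤ.* t ℤ.+ ℤ.+ 4 ≢ 0ℤ
    no-zero t eq with small-multiple (ℤ.+ 4) (ℤ.- t) 5 (s≤s (s≤s (s≤s (s≤s (s≤s z≤n))))) (trans (move t)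
      (trans (cong (λ y → ℤ.+ 5 ℤ.* ℤ.- t ℤ.+ y) eq) (ℤ.+-identityʳ (ℤ.+ 5 ℤ.* ℤ.- t))))
      where
      move : ∀ t → ℤ.+ 4 ≡ ℤ.+ 5 ℤ.* ℤ.- t ℤ.+ (ℤ.+ 5 ℤ.* t ℤ.+ ℤ.+ 4)
      move = solve-∀ ℤ-ring
    ... | ()

  geometric : 𝔾 → ℕ → 𝔾
  geometric v zero    = 0𝔾
  geometric v (suc m) = geometric v m ∔ v ^𝔾 m

  geometric-sum : ∀ v m → (1𝔾 ⊖ v) · geometric v m ≡ 1𝔾 ⊖ v ^𝔾 m
  geometric-sum v zero    = eq v
    where
    eq : ∀ v → (1𝔾 ∔ neg v) · 0𝔾 ≡ 1𝔾 ∔ neg 1𝔾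
    eq = solve-∀ 𝔾-ring
  geometric-sum v (suc m) = trans (distrib v (geometric v m) (v ^𝔾 m)) (trans (cong (_∔ (1𝔾 ∔ neg v) · v ^𝔾 m)
    (geometric-sum v m)) (collect v (v ^𝔾 m)))
    where
    distrib : ∀ v s y → (1𝔾 ∔ neg v) · (s ∔ y) ≡ (1𝔾 ∔ neg v) · s ∔ (1𝔾 ∔ neg v) · y
    distrib = solve-∀ 𝔾-ring
    collect : ∀ v y → (1𝔾 ∔ neg y) ∔ (1𝔾 ∔ neg v) · y ≡ 1𝔾 ∔ neg (v · y)
    collect = solve-∀ 𝔾-ring

  ‖unit‖≤2 : ∀ {z} → N z ≡ 1ℚ → ‖ z ‖ ≤ 2ℚ
  ‖unit‖≤2 {z} Nz≡1 = square-cancel-≤ (ℚ.<⇒≤ (ℚ.positive⁻¹ 2ℚ)) (ℚ.≤-trans (‖‖²≤2N z) (ℚ.≤-trans (ℚ.≤-reflexive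
    (cong (2ℚ *_) Nz≡1))
    (≤-by 2ℚ (ℚ.<⇒≤ (ℚ.positive⁻¹ 2ℚ)) refl)))

  ‖‖≡0⇒≡0 : ∀ z → ‖ z ‖ ≤ 0ℚ → z ≡ 0𝔾
  ‖‖≡0⇒≡0 z z≤0 = 𝔾-≡ (ℚ.∣p∣≡0⇒p≡0 (re z) (ℚ.≤-antisym (ℚ.≤-trans (∣re∣≤‖‖ z) z≤0) (ℚ.0≤∣p∣ (re z))))
                      (ℚ.∣p∣≡0⇒p≡0 (im z) (ℚ.≤-antisym (ℚ.≤-trans (∣im∣≤‖‖ z) z≤0) (ℚ.0≤∣p∣ (im z))))

  geometric-bounded : ∀ v → N v ≡ 1ℚ → v ≢ 1𝔾 → ∃[ K ] (∀ m → ‖ geometric v m ‖ ≤ K)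
  -- The constant is `6 = 2 * (1 + 2)`: the factor 2 of `‖·‖-lower`, times the bound `1 + 2` for
  -- `‖1 − vᵐ‖`.
  geometric-bounded v Nv≡1 v≢1 = let b , 0<b , inv = reciprocal (‖ 1𝔾 ⊖ v ‖) 0<1-v in num 6 * b , λ m →
    *-cancel-≤ (‖ 1𝔾 ⊖ v ‖) 0<1-v (ℚ.≤-trans (‖·‖-lower (1𝔾 ⊖ v) (geometric v m))
      (ℚ.≤-trans (*-monoʳ 2ℚ (ℚ.<⇒≤ (ℚ.positive⁻¹ 2ℚ)) (ℚ.≤-trans (ℚ.≤-reflexive (cong ‖_‖ (geometric-sum v m)))
        (ℚ.≤-trans (‖⊖‖ 1𝔾 (v ^𝔾 m)) (ℚ.+-monoʳ-≤ 1ℚ (‖unit‖≤2 {v ^𝔾 m} (N-^ {v} Nv≡1 m))))))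
        (ℚ.≤-reflexive (sym (trans (eq (‖ 1𝔾 ⊖ v ‖) b (num 6)) (trans (cong (num 6 *_) inv) refl))))))
    where
    eq : ∀ a b c → a * (c * b) ≡ c * (a * b)
    eq = solve-∀ ℚ-ring
    0<1-v : 0ℚ < ‖ 1𝔾 ⊖ v ‖
    0<1-v = ℚ.≰⇒> λ ≤0 → v≢1 (trans (add v) (cong (λ t → 1𝔾 ∔ neg t) (‖‖≡0⇒≡0 (1𝔾 ⊖ v) ≤0)))
      where
      add : ∀ v → v ≡ 1𝔾 ∔ neg (1𝔾 ∔ neg v)
      add = solve-∀ 𝔾-ring

  -- If all Re (c vⁱ) with i < m exceeded −‖c‖/8, then the sum of the (8 Re (c vⁱ) + ‖c‖)(‖c‖ − Re (c vⁱ)) would be nonnegative,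
  -- whereas Re (c vⁱ) averages to 0 and its square to N c / 2.
  module Direction (v : 𝔾) (Nv≡1 : N v ≡ 1ℚ) where

    -- The closed form of the sum of `(8 Re (c vⁱ) + ‖c‖)(‖c‖ − Re (c vⁱ))`, obtained from
    -- `2 (Re z)² = N z + Re z²`. It involves only geometric sums in `v` and `v²`.
    total : 𝔾 → ℕ → ℚ
    total c m = num 7 * ‖ c ‖ * re (c · geometric v m) - num 4 * (num m * N c + re ((c · c) · geometric (v · v) m)) + num m * (‖ c ‖ * ‖ c ‖)

    total-suc : ∀ c m → total c (suc m) ≡ total c m + (num 8 * re (c · v ^𝔾 m) + ‖ c ‖) * (‖ c ‖ - re (c · v ^𝔾 m))
    total-suc c m = trans (cong₂ (λ s n → num 7 * ‖ c ‖ * re (c · geometric v (suc m)) - num 4 * (n * N c + re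
      ((c · c) · (geometric (v · v) m ∔ s))) + n * (‖ c ‖ * ‖ c ‖)) (^𝔾-· v v m) (num-suc m))
      (trans (expand (re c) (im c) (re V) (im V) (re (geometric v m)) (im (geometric v m)) (re (geometric (v · v) m))
          (im (geometric (v · v) m)) (‖ c ‖) (num m))
        (trans (cong (λ t → total c m + (num 8 * re (c · V) + ‖ c ‖) * (‖ c ‖ - re (c · V)) + num 4 * N c * (t - 1ℚ))
            (N-^ {v} Nv≡1 m)) (drop (total c m + (num 8 * re (c · V) + ‖ c ‖) * (‖ c ‖ - re (c · V))) (num 4 * N c))))
      where
      V = v ^𝔾 m
      drop : ∀ a b → a + b * (1ℚ - 1ℚ) ≡ a
      drop = solve-∀ ℚ-ring
      expand : ∀ a b x y g h p q s n →
        num 7 * s * (a * (g + x) - b * (h + y)) - num 4 * ((1ℚ + n) * (a * a + b * b) + ((a * a - b * b) * (p + (x * x - y * y)) - (a * b + b * a) * (q + (x * y + y * x)))) + (1ℚ + n) * (s * s) ≡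
        num 7 * s * (a * g - b * h) - num 4 * (n * (a * a + b * b) + ((a * a - b * b) * p - (a * b + b * a) * q)) + n * (s * s)
        + (num 8 * (a * x - b * y) + s) * (s - (a * x - b * y)) + num 4 * (a * a + b * b) * ((x * x + y * y) - 1ℚ)
      expand = solve-∀ ℚ-ring

    re≤‖c‖ : ∀ c m → re (c · v ^𝔾 m) ≤ ‖ c ‖
    re≤‖c‖ c m = square-cancel-≤ (0≤‖‖ c) (ℚ.≤-trans (≤-by (im (c · v ^𝔾 m) * im (c · v ^𝔾 m)) (square-nonneg
      (im (c · v ^𝔾 m))) refl)
      (ℚ.≤-trans (ℚ.≤-reflexive (trans (N-· c (v ^𝔾 m)) (trans (cong (N c *_) (N-^ {v} Nv≡1 m)) (ℚ.*-identityʳ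
          (N c))))) (N≤‖‖² c)))

    search : ∀ c m → (∃[ i ] num 8 * re (c · v ^𝔾 i) + ‖ c ‖ ≤ 0ℚ) ⊎ 0ℚ ≤ total c m
    search c zero    = inj₂ (ℚ.≤-reflexive (sym (eq (re c) (im c) (‖ c ‖))))
      where
      eq : ∀ a b s → num 7 * s * (a * 0ℚ - b * 0ℚ) - num 4 * (0ℚ * (a * a + b * b) + ((a * a - b * b) * 0ℚ - (a * b + b * a) * 0ℚ)) + 0ℚ * (s * s) ≡ 0ℚ
      eq = solve-∀ ℚ-ring
    search c (suc m) with search c m | ℚ.≤-total (num 8 * re (c · v ^𝔾 m) + ‖ c ‖) 0ℚ
    ... | inj₁ found   | _            = inj₁ found
    ... | inj₂ _       | inj₁ ≤0      = inj₁ (m , ≤0)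
    ... | inj₂ 0≤total | inj₂ 0≤      = inj₂ (subst (0ℚ ≤_) (sym (total-suc c m)) (0≤+ 0≤total (0≤* 0≤ (difference-nonneg (re≤‖c‖ c m)))))

    module _ (v≢1 : v ≢ 1𝔾) (v²≢1 : v · v ≢ 1𝔾) where

      total-upper : ∃[ m ] (∀ c → total c m ≤ - (‖ c ‖ * ‖ c ‖))
      total-upper =
        let K , K≥   = geometric-bounded v Nv≡1 v≢1
            K′ , K′≥ = geometric-bounded (v · v) (trans (N-· v v) (cong₂ _*_ Nv≡1 Nv≡1)) v²≢1
            -- `4 m N c ≥ 2 m ‖c‖²` outweighs the term `m ‖c‖²`. What is left, `− m ‖c‖²`, must beat
            -- the bounded geometric sums, which contribute at most `(7 K + 4 K′) ‖c‖²`, with one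
            -- `‖c‖²` to spare.
            m , m≥   = archimedean (num 7 * K + num 4 * K′ + 1ℚ)
        in m , λ c → upper c m K K′ (K≥ m) (K′≥ m) m≥
        where
        upper : ∀ c m K K′ → ‖ geometric v m ‖ ≤ K → ‖ geometric (v · v) m ‖ ≤ K′ →
          num 7 * K + num 4 * K′ + 1ℚ ≤ num m → total c m ≤ - (‖ c ‖ * ‖ c ‖)
        upper c m K K′ S≤K S′≤K′ m≥ = ≤-by
          (num 7 * s * (s * K - r) + num 4 * (s * s * K′ + r′) + num 2 * num m * (2ℚ * N c - s * s) + s * s * (num m - (num 7 * K + num 4 * K′ + 1ℚ)))
          (0≤+ (0≤+ (0≤+ (0≤* (0≤* (0≤num 7) (0≤‖‖ c)) (difference-nonneg r≤)) (0≤* (0≤num 4) 0≤r′))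
                    (0≤* (0≤* (0≤num 2) (0≤num m)) (difference-nonneg (‖‖²≤2N c)))) (0≤* (0≤* (0≤‖‖ c) (0≤‖‖ c)) (difference-nonneg m≥)))
          (eq s r (num m) (N c) r′ K K′)
          where
          s = ‖ c ‖
          r = re (c · geometric v m)
          r′ = re ((c · c) · geometric (v · v) m)
          r≤ : r ≤ s * K
          r≤ = ℚ.≤-trans (re≤‖‖ (c · geometric v m)) (ℚ.≤-trans (‖·‖ c (geometric v m)) (*-monoʳ s (0≤‖‖ c) S≤K))
          0≤r′ : 0ℚ ≤ s * s * K′ + r′
          0≤r′ = subst (0ℚ ≤_) (add (s * s * K′) r′) (difference-nonneg (ℚ.≤-trans (p≤∣p∣ (- r′))
            (ℚ.≤-trans (ℚ.≤-reflexive (ℚ.∣-p∣≡∣p∣ r′))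
            (ℚ.≤-trans (∣re∣≤‖‖ ((c · c) · geometric (v · v) m)) (ℚ.≤-trans (‖·‖ (c · c) (geometric (v · v) m))
              (*-mono (0≤‖‖ (c · c)) (ℚ.≤-trans (0≤‖‖ (geometric (v · v) m)) S′≤K′) (‖·‖ c c) S′≤K′))))))
            where
            add : ∀ a b → a - - b ≡ a + b
            add = solve-∀ ℚ-ring
          eq : ∀ s r m n r′ K K′ → num 7 * s * r - num 4 * (m * n + r′) + m * (s * s) +
               (num 7 * s * (s * K - r) + num 4 * (s * s * K′ + r′) + num 2 * m * ((1ℚ + 1ℚ) * n - s * s) + s * s * (m - (num 7 * K + num 4 * K′ + 1ℚ))) ≡ - (s * s)
          eq = solve-∀ ℚ-ring

      direction : ∀ c → ∃[ i ] num 8 * re (c · v ^𝔾 i) + ‖ c ‖ ≤ 0ℚ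
      -- If the search finds nothing, the total is both nonnegative and at most `− ‖c‖²`; then
      -- `c = 0` and the exponent 0 serves.
      direction c = let m , ≤-s² = total-upper in [ (λ found → found) , (λ 0≤total → 0 , zero-case (ℚ.≤-trans 0≤total (≤-s² c))) ]′ (search c m)
        where
        zero-case : 0ℚ ≤ - (‖ c ‖ * ‖ c ‖) → num 8 * re (c · 1𝔾) + ‖ c ‖ ≤ 0ℚ
        zero-case 0≤-s² = subst (λ z → num 8 * re (z · 1𝔾) + ‖ z ‖ ≤ 0ℚ) (sym c≡0) ℚ.≤-refl
          where
          c≡0 : c ≡ 0𝔾
          c≡0 = ‖‖≡0⇒≡0 c (square-cancel-≤ ℚ.≤-refl (subst (_≤ 0ℚ) (neg-neg (‖ c ‖ * ‖ c ‖)) (ℚ.neg-antimono-≤ 0≤-s²)))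
            where
            neg-neg : ∀ a → - - a ≡ a
            neg-neg = solve-∀ ℚ-ring

  opaque
    -- The search runs over the powers of `v = unit ^ (1 + j)`. The `i`-th of them is also the
    -- `(1 + j)`-th power of `unit ^ i`, so a solution `u` is found without extracting a root, which
    -- ℚ(i) need not contain.
    negative-direction : ∀ j c → ∃[ u ] (N u ≡ 1ℚ × num 8 * re (c · u ^𝔾 suc j) + ‖ c ‖ ≤ 0ℚ)
    negative-direction j c =
      let i , ≤0 = Direction.direction (unit ^𝔾 suc j) (N-^ {unit} refl (suc j)) (unit-power≢1 j)
                     (λ v²≡1 → unit-power≢1 (j ℕ.+ suc j) (trans (^𝔾-+ unit (suc j) (suc j)) v²≡1)) c
      in unit ^𝔾 i , N-^ {unit} refl i , subst (λ z → num 8 * re (c · z) + ‖ c ‖ ≤ 0ℚ) (trans (^𝔾-* unit (suc j) i)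
          (trans (cong (unit ^𝔾_) (ℕ.*-comm i (suc j))) (sym (^𝔾-* unit i (suc j))))) ≤0

-- D'Alembert's descent: arbitrarily small values of a polynomial

module ApproximateRoots where

  open import Data.Rational.Base using (_+_; _*_; _-_; -_; _≤_; _<_)
  open import Tactic.RingSolver using (solve-∀)
  open GaussianRationals
  open Directions

  -- Polynomials over ℚ(i), as coefficient lists

  eval𝔾 : List 𝔾 → 𝔾 → 𝔾
  eval𝔾 []      w = 0𝔾
  eval𝔾 (a ∷ l) w = a ∔ w · eval𝔾 l w

  -- The lower bound 1 for the leading coefficient comes for free over ℤ, and it survives every
  -- translation of the variable. It keeps the constants of the descent uniform.
  data Lead : List 𝔾 → ℕ → Set where
    last : ∀ {c} → 1ℚ ≤ ‖ c ‖ → Lead (c ∷ []) 0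
    _∷_  : ∀ a {l n} → Lead l n → Lead (a ∷ l) (suc n)

  Bounded : ℚ → List 𝔾 → Set
  Bounded A = All (λ b → ‖ b ‖ ≤ A)

  0<^ : ∀ {t} → 0ℚ < t → ∀ n → 0ℚ < t ^ℚ n
  0<^ 0<t zero    = ℚ.positive⁻¹ 1ℚ
  0<^ 0<t (suc n) = 0<* 0<t (0<^ 0<t n)

  ^ℚ-≤1 : ∀ {t} → 0ℚ < t → t ≤ 1ℚ → ∀ n → t ^ℚ n ≤ 1ℚ
  ^ℚ-≤1     0<t t≤1 zero    = ℚ.≤-refl
  ^ℚ-≤1 {t} 0<t t≤1 (suc n) = *-mono {t} {1ℚ} {t ^ℚ n} {1ℚ} (ℚ.<⇒≤ 0<t) (ℚ.<⇒≤ (ℚ.positive⁻¹ 1ℚ)) t≤1 (^ℚ-≤1 0<t t≤1 n)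

  ^ℚ-antitone : ∀ {t} → 0ℚ < t → t ≤ 1ℚ → ∀ {m n} → m ℕ.≤ n → t ^ℚ n ≤ t ^ℚ m
  ^ℚ-antitone     0<t t≤1 {zero}  {n}     _         = ^ℚ-≤1 0<t t≤1 n
  ^ℚ-antitone {t} 0<t t≤1 {suc m} {suc n} (s≤s m≤n) = *-monoʳ t (ℚ.<⇒≤ 0<t) (^ℚ-antitone 0<t t≤1 m≤n)

  -- `as` is the part of a polynomial that starts in degree `j`, and `a` is the coefficient whose
  -- term wins at scale `t`. With `t ≤ 1`, earlier coefficients are bounded without their powers of
  -- `t` and later ones with a single `t`; this covers all the corresponding terms.
  record Dominant (θ σ κ : ℚ) (j : ℕ) (as : List 𝔾) : Set where
    constructor mkDominant
    field
      pre     : List 𝔾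
      a       : 𝔾
      post    : List 𝔾
      t       : ℚ
      split   : as ≡ pre ++ a ∷ post
      0<t     : 0ℚ < t
      t≤σ     : t ≤ σ
      κ≤      : κ ≤ t ^ℚ (j ℕ.+ length pre) * ‖ a ‖
      pre≤    : Bounded (θ * (t ^ℚ (j ℕ.+ length pre) * ‖ a ‖)) pre
      post≤   : All (λ b → ‖ b ‖ * t ≤ θ * ‖ a ‖) post

  -- At a suitable small scale t one of the terms a_k t^k dominates all others. The size κ of that term does not depend on
  -- the coefficients, only on bounds for them.
  module _ (A θ σ : ℚ) (0≤A : 0ℚ ≤ A) (0<θ : 0ℚ < θ) (0<σ : 0ℚ < σ) (σ≤1 : σ ≤ 1ℚ) where

    dominant : ∀ n j → ∃[ κ ] (0ℚ < κ × (∀ as → Lead as n → Bounded A as → Dominant θ σ κ j as))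
    dominant zero j = σ ^ℚ j , 0<^ 0<σ j , λ where
      (a ∷ []) (last 1≤a) _ → mkDominant [] a [] σ refl 0<σ ℚ.≤-refl
        (subst₂ _≤_ (ℚ.*-identityʳ (σ ^ℚ j)) (cong (λ i → σ ^ℚ i * ‖ a ‖) (sym (ℕ.+-identityʳ j))) (*-monoʳ (σ ^ℚ j)
            (ℚ.<⇒≤ (0<^ 0<σ j)) 1≤a)) [] []
    dominant (suc n) j =
      let κ′ , 0<κ′ , rec    = dominant n (suc j)
          -- The threshold for the first coefficient. Below it, the term that dominates the tail, of
          -- size at least `κ′`, also dominates `a`; above it, `a` itself dominates as soon as `t`
          -- is so small that `A * t ≤ θ * η`.
          η                  = θ * κ′
          0<η                = 0<* 0<θ 0<κ′
          s , 0<s , s≤1 , As≤ = scale-below A (θ * η) 0≤A (0<* 0<θ 0<η)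
          t                  = σ * s
          0<t                = 0<* 0<σ 0<s
          κ , 0<κ , κ≤κ′ , κ≤ = positive-lower-bound 0<κ′ (0<* (0<^ 0<t j) 0<η)
      in κ , 0<κ , λ where
        (a ∷ as) (_ ∷ lead) (a≤A ∷ as≤A) → cases κ′ κ s κ≤κ′ κ≤ 0<s s≤1 As≤ a as a≤A as≤A (rec as lead as≤A) (ℚ.≤-total ‖ a ‖ η)
      where
      cases : ∀ κ′ κ s → κ ≤ κ′ → κ ≤ (σ * s) ^ℚ j * (θ * κ′) → 0ℚ < s → s ≤ 1ℚ → A * s ≤ θ * (θ * κ′) →
              ∀ a as → ‖ a ‖ ≤ A → Bounded A as → Dominant θ σ κ′ (suc j) as → ‖ a ‖ ≤ θ * κ′ ⊎ θ * κ′ ≤ ‖ a ‖ →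
                Dominant θ σ κ j (a ∷ as)
      cases κ′ κ s κ≤κ′ κ≤ 0<s s≤1 As≤ a as a≤A as≤A (mkDominant pre b post t split 0<t t≤σ κ′≤ pre≤ post≤) (inj₁ a≤η) =
        mkDominant (a ∷ pre) b post t (cong (a ∷_) split) 0<t t≤σ
          (ℚ.≤-trans κ≤κ′ (subst (λ i → κ′ ≤ t ^ℚ i * ‖ b ‖) (sym (ℕ.+-suc j (length pre))) κ′≤))
          (subst (λ i → Bounded (θ * (t ^ℚ i * ‖ b ‖)) (a ∷ pre)) (sym (ℕ.+-suc j (length pre))) (ℚ.≤-trans a≤η
              (*-monoʳ θ (ℚ.<⇒≤ 0<θ) κ′≤) ∷ pre≤)) post≤
      cases κ′ κ s κ≤κ′ κ≤ 0<s s≤1 As≤ a as a≤A as≤A _ (inj₂ η≤a) =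
        mkDominant [] a as (σ * s) refl 0<t (ℚ.≤-trans (*-monoʳ σ (ℚ.<⇒≤ 0<σ) s≤1) (ℚ.≤-reflexive (ℚ.*-identityʳ σ)))
          (ℚ.≤-trans κ≤ (subst (λ i → (σ * s) ^ℚ j * (θ * κ′) ≤ (σ * s) ^ℚ i * ‖ a ‖) (sym (ℕ.+-identityʳ j))
              (*-monoʳ ((σ * s) ^ℚ j) (ℚ.<⇒≤ (0<^ 0<t j)) η≤a)))
          [] (All.map (λ {b} b≤A → ℚ.≤-trans (*-monoˡ (σ * s) (ℚ.<⇒≤ 0<t) b≤A) (ℚ.≤-trans (*-monoʳ A 0≤A σs≤s)
            (ℚ.≤-trans As≤ (*-monoʳ θ (ℚ.<⇒≤ 0<θ) η≤a)))) as≤A)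
        where
        0<t = 0<* 0<σ 0<s
        σs≤s : σ * s ≤ s
        σs≤s = ℚ.≤-trans (*-monoˡ s (ℚ.<⇒≤ 0<s) σ≤1) (ℚ.≤-reflexive (ℚ.*-identityˡ s))

  eval-++ : ∀ l l′ w → eval𝔾 (l ++ l′) w ≡ eval𝔾 l w ∔ w ^𝔾 length l · eval𝔾 l′ w
  eval-++ []      l′ w = eq (eval𝔾 l′ w)
    where
    eq : ∀ a → a ≡ 0𝔾 ∔ 1𝔾 · a
    eq = solve-∀ 𝔾-ring
  eval-++ (a ∷ l) l′ w = trans (cong (λ t → a ∔ w · t) (eval-++ l l′ w)) (eq a w (eval𝔾 l w) (w ^𝔾 length l) (eval𝔾 l′ w))
    where
    eq : ∀ a w x y z → a ∔ w · (x ∔ y · z) ≡ (a ∔ w · x) ∔ (w · y) · z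
    eq = solve-∀ 𝔾-ring

  tail-bound : ∀ {w τ γ} → 0ℚ ≤ γ → ∀ l m → (∀ i → m ℕ.≤ i → ‖ w ^𝔾 i ‖ ≤ τ) → All (λ b → τ * ‖ b ‖ ≤ γ) l →
    ‖ w ^𝔾 m · eval𝔾 l w ‖ ≤ num (length l) * γ
  tail-bound {w} {τ} {γ} 0≤γ [] m powers [] = ℚ.≤-reflexive (trans (cong ‖_‖ (eq (w ^𝔾 m))) (sym (ℚ.*-zeroˡ γ)))
    where
    eq : ∀ a → a · 0𝔾 ≡ 0𝔾
    eq = solve-∀ 𝔾-ring
  tail-bound {w} {τ} {γ} 0≤γ (b ∷ l) m powers (b≤ ∷ l≤) = ℚ.≤-trans (ℚ.≤-reflexive (cong ‖_‖ (eq w (w ^𝔾 m) b (eval𝔾 l w))))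
    (ℚ.≤-trans (‖∔‖ (w ^𝔾 m · b) (w ^𝔾 suc m · eval𝔾 l w)) (ℚ.≤-trans (ℚ.+-mono-≤
      (ℚ.≤-trans (‖·‖ (w ^𝔾 m) b) (ℚ.≤-trans (*-monoˡ (‖ b ‖) (0≤‖‖ b) (powers m ℕ.≤-refl)) b≤))
      (tail-bound 0≤γ l (suc m) (λ i m<i → powers i (ℕ.<⇒≤ m<i)) l≤))
      (ℚ.≤-reflexive (trans (eq′ γ (num (length l))) (cong (_* γ) (sym (num-suc (length l))))))))
    where
    eq : ∀ w y b e → y · (b ∔ w · e) ≡ y · b ∔ (w · y) · e
    eq = solve-∀ 𝔾-ring
    eq′ : ∀ g n → g + n * g ≡ (1ℚ + n) * g
    eq′ = solve-∀ ℚ-ring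

  -- Descent from a₀: the dominant term v is pointed against a₀, and e collects the other terms.
  descent : ∀ a₀ v e {M} → num 16 * re (conj a₀ · v) + ‖ a₀ ‖ * M ≤ 0ℚ → N v ≤ M * M → ‖ v ‖ ≤ 2ℚ * M →
    num 64 * ‖ e ‖ ≤ M → num 64 * M ≤ ‖ a₀ ‖ → 0ℚ ≤ M →
            num 32 * N (a₀ ∔ v ∔ e) + ‖ a₀ ‖ * M ≤ num 32 * N a₀
  descent a₀ v e {M} against Nv≤ v≤ e≤ M≤ 0≤M = ≤-by
    -- A certificate: the difference of the two sides is a combination, with nonnegative
    -- coefficients, of the gaps in the hypotheses and their consequences, so that a single ring
    -- identity remains.
    (num 4 * α + num 32 * β + num 64 * γ + num 32 * δ + (m₀ + 2ℚ * M) * ε + num 32 * ζ + num 2 * M * η + num 62 * (M * M))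
    (0≤+ (0≤+ (0≤+ (0≤+ (0≤+ (0≤+ (0≤+ (0≤* (0≤num 4) 0≤α) (0≤* (0≤num 32) (difference-nonneg Nv≤))) (0≤* (0≤num 64) (difference-nonneg cross)))
      (0≤* (0≤num 32) (difference-nonneg (N≤‖‖² e)))) (0≤* (0≤+ (0≤‖‖ a₀) (0≤* (0≤num 2) 0≤M)) (difference-nonneg e≤))) (0≤* (0≤num 32) 0≤ζ))
      (0≤* (0≤* (0≤num 2) 0≤M) (difference-nonneg M≤))) (0≤* (0≤num 62) (0≤* 0≤M 0≤M)))
    (eq (re a₀) (im a₀) (re v) (im v) (re e) (im e) m₀ M E)
    where
    m₀ = ‖ a₀ ‖
    E = ‖ e ‖
    α = 0ℚ - (num 16 * re (conj a₀ · v) + m₀ * M)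
    β = M * M - N v
    γ = (m₀ + 2ℚ * M) * E - re (conj (a₀ ∔ v) · e)
    δ = E * E - N e
    ε = M - num 64 * E
    ζ = M * M - E * E
    η = m₀ - num 64 * M
    0≤α : 0ℚ ≤ α
    0≤α = difference-nonneg against
    cross : re (conj (a₀ ∔ v) · e) ≤ (m₀ + 2ℚ * M) * E
    cross = ℚ.≤-trans (re≤‖‖ (conj (a₀ ∔ v) · e)) (ℚ.≤-trans (‖·‖ (conj (a₀ ∔ v)) e) (*-monoˡ E (0≤‖‖ e)
      (ℚ.≤-trans (ℚ.≤-reflexive (‖conj‖ (a₀ ∔ v))) (ℚ.≤-trans (‖∔‖ a₀ v) (ℚ.+-monoʳ-≤ m₀ v≤)))))
    E≤M : E ≤ M
    E≤M = ℚ.≤-trans (≤-by (num 63 * E) (0≤* (0≤num 63) (0≤‖‖ e)) (add E)) e≤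
      where
      add : ∀ E → E + num 63 * E ≡ num 64 * E
      add = solve-∀ ℚ-ring
    0≤ζ : 0ℚ ≤ ζ
    0≤ζ = difference-nonneg (*-mono (0≤‖‖ e) 0≤M E≤M E≤M)
    eq : ∀ a b c d x y m M E →
      num 32 * ((a + c + x) * (a + c + x) + (b + d + y) * (b + d + y)) + m * M +
      (num 4 * (0ℚ - (num 16 * (a * c - - b * d) + m * M)) + num 32 * (M * M - (c * c + d * d)) +
       num 64 * ((m + (1ℚ + 1ℚ) * M) * E - ((a + c) * x - - (b + d) * y)) + num 32 * (E * E - (x * x + y * y)) +
       (m + (1ℚ + 1ℚ) * M) * (M - num 64 * E) + num 32 * (M * M - E * E) + num 2 * M * (m - num 64 * M) + num 62 * (M * M))
      ≡ num 32 * (a * a + b * b)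
    eq = solve-∀ ℚ-ring

  -- The Taylor expansion at z

  shift-step : 𝔾 → 𝔾 → List 𝔾 → List 𝔾
  shift-step z b []       = b ∷ []
  shift-step z b (s ∷ ss) = b ∔ z · s ∷ shift-step z s ss

  shift : 𝔾 → List 𝔾 → List 𝔾
  shift z []      = []
  shift z (a ∷ l) = shift-step z a (shift z l)

  eval-shift-step : ∀ z b s w → eval𝔾 (shift-step z b s) w ≡ b ∔ (z ∔ w) · eval𝔾 s w
  eval-shift-step z b []       w = eq z b w
    where
    eq : ∀ z b w → b ∔ w · 0𝔾 ≡ b ∔ (z ∔ w) · 0𝔾
    eq = solve-∀ 𝔾-ring
  eval-shift-step z b (s ∷ ss) w = trans (cong (λ t → b ∔ z · s ∔ w · t) (eval-shift-step z s ss w)) (eq z b s w (eval𝔾 ss w))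
    where
    eq : ∀ z b s w e → b ∔ z · s ∔ w · (s ∔ (z ∔ w) · e) ≡ b ∔ (z ∔ w) · (s ∔ w · e)
    eq = solve-∀ 𝔾-ring

  eval-shift : ∀ z l w → eval𝔾 (shift z l) w ≡ eval𝔾 l (z ∔ w)
  eval-shift z []      w = refl
  eval-shift z (a ∷ l) w = trans (eval-shift-step z a (shift z l) w) (cong (λ t → a ∔ (z ∔ w) · t) (eval-shift z l w))

  shift-step-Lead : ∀ z b {s n} → Lead s n → Lead (shift-step z b s) (suc n)
  shift-step-Lead z b (last {c} 1≤c) = (b ∔ z · c) ∷ last 1≤c
  shift-step-Lead z b (s ∷ lead)     = (b ∔ z · s) ∷ shift-step-Lead z s lead

  shift-Lead : ∀ z {l n} → Lead l n → Lead (shift z l) n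
  shift-Lead z (last 1≤c) = last 1≤c
  shift-Lead z (a ∷ lead) = shift-step-Lead z a (shift-Lead z lead)

  shift-step-Bounded : ∀ {z b s A Z} → 0ℚ ≤ A → ‖ z ‖ ≤ Z → ‖ b ‖ ≤ A → Bounded A s → Bounded (A + Z * A) (shift-step z b s)
  shift-step-Bounded {z} {b} {[]} {A} {Z} 0≤A z≤Z b≤A [] = ℚ.≤-trans b≤A (≤-by (Z * A)
    (0≤* (ℚ.≤-trans (0≤‖‖ z) z≤Z) 0≤A) refl) ∷ []
  shift-step-Bounded {z} {b} {s ∷ ss} {A} {Z} 0≤A z≤Z b≤A (s≤A ∷ ss≤A) =
    ℚ.≤-trans (‖∔‖ b (z · s)) (ℚ.+-mono-≤ b≤A (ℚ.≤-trans (‖·‖ z s)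
      (*-mono (0≤‖‖ z) 0≤A z≤Z s≤A))) ∷ shift-step-Bounded 0≤A z≤Z s≤A ss≤A

  shift-Bounded : ∀ l Z → 0ℚ ≤ Z → ∃[ A ] (0ℚ ≤ A × (∀ z → ‖ z ‖ ≤ Z → Bounded A (shift z l)))
  shift-Bounded []      Z 0≤Z = 0ℚ , ℚ.≤-refl , λ z z≤Z → []
  shift-Bounded (a ∷ l) Z 0≤Z =
    let A , 0≤A , l≤A = shift-Bounded l Z 0≤Z
        A′            = ‖ a ‖ + A
        0≤A′          = 0≤+ (0≤‖‖ a) 0≤A
        A≤A′          = ≤-by (‖ a ‖) (0≤‖‖ a) (ℚ.+-comm A (‖ a ‖))
    in A′ + Z * A′ , 0≤+ 0≤A′ (0≤* 0≤Z 0≤A′) , λ z z≤Z → shift-step-Bounded 0≤A′ z≤Z (≤-by A 0≤A refl)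
        (All.map (λ b≤A → ℚ.≤-trans b≤A A≤A′) (l≤A z z≤Z))

  Lead-length : ∀ {l n} → Lead l n → length l ≡ suc n
  Lead-length (last _) = refl
  Lead-length (a ∷ lead) = cong suc (Lead-length lead)

  -- From z, with a₀ = p(z) not small, some step w = t u lowers N p by a fixed amount.
  module Step {θ σ κ : ℚ} {n : ℕ} {as : List 𝔾} (lead : Lead as n) (0<θ : 0ℚ < θ)
              (θ≤ : num 128 * num (suc n) * θ ≤ 1ℚ) (σ≤1 : σ ≤ 1ℚ) (dom : Dominant θ σ κ 1 as) (a₀ : 𝔾)
              (A : ℚ) (as≤A : Bounded A as) (A≤ : num 64 * (A * σ) ≤ ‖ a₀ ‖) (0≤A : 0ℚ ≤ A) where
    open Dominant dom

    k = length pre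
    M = t ^ℚ suc k * ‖ a ‖
    t≤1 = ℚ.≤-trans t≤σ σ≤1
    tᵏ = t ^ℚ suc k
    0<tᵏ = 0<^ 0<t (suc k)
    0≤M : 0ℚ ≤ M
    0≤M = 0≤* (ℚ.<⇒≤ 0<tᵏ) (0≤‖‖ a)

    c = conj a₀ · (real tᵏ · a)

    u : 𝔾
    u = proj₁ (negative-direction k c)
    Nu≡1 : N u ≡ 1ℚ
    Nu≡1 = proj₁ (proj₂ (negative-direction k c))
    u-against : num 8 * re (c · u ^𝔾 suc k) + ‖ c ‖ ≤ 0ℚ
    u-against = proj₂ (proj₂ (negative-direction k c))

    w v e : 𝔾
    w = real t · u
    v = w ^𝔾 suc k · a
    e = w · eval𝔾 pre w ∔ w ^𝔾 suc (suc k) · eval𝔾 post w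

    w^ : ∀ i → w ^𝔾 i ≡ real (t ^ℚ i) · u ^𝔾 i
    w^ i = trans (^𝔾-· (real t) u i) (cong (_· u ^𝔾 i) (real-^ t i))

    ‖w^‖ : ∀ i → ‖ w ^𝔾 i ‖ ≤ t ^ℚ i * 2ℚ
    ‖w^‖ i = ℚ.≤-trans (ℚ.≤-reflexive (trans (cong ‖_‖ (w^ i)) (trans (‖real·‖ (t ^ℚ i) (u ^𝔾 i))
      (cong (_* ‖ u ^𝔾 i ‖) (ℚ.0≤p⇒∣p∣≡p (ℚ.<⇒≤ (0<^ 0<t i)))))))
      (*-monoʳ (t ^ℚ i) (ℚ.<⇒≤ (0<^ 0<t i)) (‖unit‖≤2 {u ^𝔾 i} (N-^ {u} Nu≡1 i)))

    expansion : eval𝔾 (a₀ ∷ as) w ≡ a₀ ∔ v ∔ e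
    expansion = trans (cong (λ l → a₀ ∔ w · eval𝔾 l w) split) (trans (cong (λ s → a₀ ∔ w · s) (eval-++ pre
      (a ∷ post) w)) (eq a₀ w (eval𝔾 pre w) (w ^𝔾 k) a (eval𝔾 post w)))
      where
      eq : ∀ a₀ w x y a z → a₀ ∔ w · (x ∔ y · (a ∔ w · z)) ≡ a₀ ∔ (w · y) · a ∔ (w · x ∔ (w · (w · y)) · z)
      eq = solve-∀ 𝔾-ring

    ‖tᵏa‖ : ‖ real tᵏ · a ‖ ≡ M
    ‖tᵏa‖ = trans (‖real·‖ tᵏ a) (cong (_* ‖ a ‖) (ℚ.0≤p⇒∣p∣≡p (ℚ.<⇒≤ 0<tᵏ)))

    c·u≡ : c · u ^𝔾 suc k ≡ conj a₀ · v
    c·u≡ = trans (eq (conj a₀) (real tᵏ) a (u ^𝔾 suc k)) (cong (λ s → conj a₀ · (s · a)) (sym (w^ (suc k))))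
      where
      eq : ∀ x y a z → (x · (y · a)) · z ≡ x · ((y · z) · a)
      eq = solve-∀ 𝔾-ring

    against : num 16 * re (conj a₀ · v) + ‖ a₀ ‖ * M ≤ 0ℚ
    -- `16 = 2 * 8`: by `‖·‖-lower` the norm of `c` is at least `‖a₀‖ M / 2`, so twice the
    -- inequality for `u` is needed.
    against = ℚ.≤-trans (ℚ.+-monoʳ-≤ (num 16 * re (conj a₀ · v)) (ℚ.≤-trans (ℚ.≤-reflexive
      (cong₂ _*_ (sym (‖conj‖ a₀)) (sym ‖tᵏa‖))) (‖·‖-lower (conj a₀) (real tᵏ · a))))
      (ℚ.≤-trans (ℚ.≤-reflexive (trans (eq (re (conj a₀ · v)) (‖ c ‖)) (cong (λ z → 2ℚ * (num 8 * re z + ‖ c ‖))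
          (sym c·u≡)))) (*-monoʳ 2ℚ (0≤num 2) u-against))
      where
      eq : ∀ r s → num 16 * r + (1ℚ + 1ℚ) * s ≡ (1ℚ + 1ℚ) * (num 8 * r + s)
      eq = solve-∀ ℚ-ring

    v≡ : v ≡ u ^𝔾 suc k · (real tᵏ · a)
    v≡ = trans (cong (_· a) (w^ (suc k))) (eq (real tᵏ) (u ^𝔾 suc k) a)
      where
      eq : ∀ x y a → (x · y) · a ≡ y · (x · a)
      eq = solve-∀ 𝔾-ring

    Nv≤ : N v ≤ M * M
    Nv≤ = ℚ.≤-trans (ℚ.≤-reflexive (trans (cong N v≡) (trans (N-· (u ^𝔾 suc k) (real tᵏ · a))
      (trans (cong (_* N (real tᵏ · a)) (N-^ {u} Nu≡1 (suc k))) (ℚ.*-identityˡ (N (real tᵏ · a)))))))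
      (ℚ.≤-trans (N≤‖‖² (real tᵏ · a)) (ℚ.≤-reflexive (cong₂ _*_ ‖tᵏa‖ ‖tᵏa‖)))

    v≤ : ‖ v ‖ ≤ 2ℚ * M
    v≤ = ℚ.≤-trans (ℚ.≤-reflexive (cong ‖_‖ v≡)) (ℚ.≤-trans (‖·‖ (u ^𝔾 suc k) (real tᵏ · a))
      (ℚ.≤-trans (*-monoˡ (‖ real tᵏ · a ‖) (0≤‖‖ (real tᵏ · a)) (‖unit‖≤2 {u ^𝔾 suc k} (N-^ {u} Nu≡1 (suc k))))
      (ℚ.≤-reflexive (cong (2ℚ *_) ‖tᵏa‖))))

    γ = 2ℚ * (θ * M)
    0≤γ : 0ℚ ≤ γ
    0≤γ = 0≤* (0≤num 2) (0≤* (ℚ.<⇒≤ 0<θ) 0≤M)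

    pre-bound : ‖ w ^𝔾 1 · eval𝔾 pre w ‖ ≤ num (length pre) * γ
    pre-bound = tail-bound 0≤γ pre 1 (λ i _ → ℚ.≤-trans (‖w^‖ i) (ℚ.≤-trans (*-monoˡ 2ℚ (0≤num 2) (^ℚ-≤1 0<t t≤1 i))
      (ℚ.≤-reflexive (ℚ.*-identityˡ 2ℚ))))
      (All.map (λ b≤ → *-monoʳ 2ℚ (0≤num 2) b≤) pre≤)

    post-bound : ‖ w ^𝔾 suc (suc k) · eval𝔾 post w ‖ ≤ num (length post) * γ
    post-bound = tail-bound 0≤γ post (suc (suc k)) (λ i k≤i → ℚ.≤-trans (‖w^‖ i) (*-monoˡ 2ℚ (0≤num 2) (^ℚ-antitone 0<t t≤1 k≤i)))
      (All.map (λ {b} b≤ → ℚ.≤-trans (ℚ.≤-reflexive (eq t tᵏ (‖ b ‖))) (ℚ.≤-trans (*-monoʳ (2ℚ * tᵏ) (0≤* (0≤num 2)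
          (ℚ.<⇒≤ 0<tᵏ)) b≤) (ℚ.≤-reflexive (eq′ tᵏ θ (‖ a ‖))))) post≤)
      where
      eq : ∀ t s b → (t * s) * (1ℚ + 1ℚ) * b ≡ (1ℚ + 1ℚ) * s * (b * t)
      eq = solve-∀ ℚ-ring
      eq′ : ∀ s θ a → (1ℚ + 1ℚ) * s * (θ * a) ≡ (1ℚ + 1ℚ) * (θ * (s * a))
      eq′ = solve-∀ ℚ-ring

    lengths : suc n ≡ suc (length pre ℕ.+ length post)
    lengths = trans (sym (Lead-length lead)) (trans (cong length split) (trans (List.length-++ pre)
      (ℕ.+-suc (length pre) (length post))))

    e≤ : num 64 * ‖ e ‖ ≤ M
    e≤ = ℚ.≤-trans (*-monoʳ (num 64) (0≤num 64) (ℚ.≤-trans (‖∔‖ (w · eval𝔾 pre w) (w ^𝔾 suc (suc k) · eval𝔾 post w))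
      (ℚ.+-mono-≤ (subst (λ z → ‖ z · eval𝔾 pre w ‖ ≤ num (length pre) * γ) (w¹ w) pre-bound) post-bound)))
      (ℚ.≤-trans (≤-by (num 128 * θ * M) (0≤* (0≤* (0≤num 128) (ℚ.<⇒≤ 0<θ)) 0≤M) (trans (eq (num (length pre))
          (num (length post)) θ M) (cong (λ s → num 128 * s * θ * M) (sym count))))
        (ℚ.≤-trans (*-monoˡ M 0≤M θ≤) (ℚ.≤-reflexive (ℚ.*-identityˡ M))))
      where
      w¹ : ∀ w → w · 1𝔾 ≡ w
      w¹ = solve-∀ 𝔾-ring
      eq : ∀ x y θ M → num 64 * (x * ((1ℚ + 1ℚ) * (θ * M)) + y * ((1ℚ + 1ℚ) * (θ * M))) + num 128 * θ * M ≡ num 128 * (1ℚ + (x + y)) * θ * M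
      eq = solve-∀ ℚ-ring
      count : num (suc n) ≡ 1ℚ + (num (length pre) + num (length post))
      count = trans (cong num lengths) (trans (num-suc (length pre ℕ.+ length post)) (cong (1ℚ +_)
        (ι-+ (ℤ.+ length pre) (ℤ.+ length post))))

    M≤ : num 64 * M ≤ ‖ a₀ ‖
    M≤ = ℚ.≤-trans (*-monoʳ (num 64) (0≤num 64) (ℚ.≤-trans (*-monoˡ (‖ a ‖) (0≤‖‖ a) tᵏ≤σ) (ℚ.≤-trans (ℚ.≤-reflexive
      (ℚ.*-comm σ (‖ a ‖))) (*-monoˡ σ (ℚ.≤-trans (ℚ.<⇒≤ 0<t) t≤σ) a≤A)))) A≤
      where
      tᵏ≤σ : tᵏ ≤ σ
      tᵏ≤σ = ℚ.≤-trans (^ℚ-antitone 0<t t≤1 {1} {suc k} (s≤s z≤n)) (ℚ.≤-trans (ℚ.≤-reflexive (ℚ.*-identityʳ t)) t≤σ)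
      a≤A : ‖ a ‖ ≤ A
      a≤A = middle pre (subst (Bounded A) split as≤A)
        where
        middle : ∀ l {b r} → Bounded A (l ++ b ∷ r) → ‖ b ‖ ≤ A
        middle []      (b≤A ∷ _) = b≤A
        middle (_ ∷ l) (_ ∷ r)   = middle l r

    lowered : num 32 * N (eval𝔾 (a₀ ∷ as) w) + ‖ a₀ ‖ * κ ≤ num 32 * N a₀
    lowered = ℚ.≤-trans (ℚ.+-mono-≤ (ℚ.≤-reflexive (cong (λ z → num 32 * N z) expansion)) (*-monoʳ (‖ a₀ ‖) (0≤‖‖ a₀) κ≤))
      (descent a₀ v e against Nv≤ v≤ e≤ M≤ 0≤M)

  opaque
    -- The gain `κ` must not depend on `z`, or the descent might stall. All Taylor expansions at
    -- points of the disc have coefficients under one bound `A`, and `dominant` extracts its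
    -- constant from such a bound alone.
    lowering : ∀ l n → Lead l (suc n) → ∀ Z δ → 0ℚ ≤ Z → 0ℚ < δ →
               ∃[ κ ] (0ℚ < κ × (∀ z → ‖ z ‖ ≤ Z → δ ≤ ‖ eval𝔾 l z ‖ → ∃[ z′ ] N (eval𝔾 l z′) + κ ≤ N (eval𝔾 l z)))
    lowering l n lead Z δ 0≤Z 0<δ =
      let A , 0≤A , bounded           = shift-Bounded l Z 0≤Z
          -- `128 = 64 * 2`: `descent` wants the sum of the `n` other terms below `M / 64`, and each
          -- of them is at most `2 θ M`, where 2 bounds the taxicab norm of a unit. Likewise `σ`
          -- keeps the dominant term below `‖a₀‖ / 64`. The 32 in the gain is that of `descent`.
          θ , 0<θ , _ , θ≤            = scale-below (num 128 * num (suc n)) 1ℚ (0≤* (0≤num 128) (0≤num (suc n))) (ℚ.positive⁻¹ 1ℚ)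
          σ , 0<σ , σ≤1 , Aσ≤         = scale-below (num 64 * A) δ (0≤* (0≤num 64) 0≤A) 0<δ
          κ , 0<κ , dom               = dominant A θ σ 0≤A 0<θ 0<σ σ≤1 n 1
          r , 0<r , inv               = reciprocal (num 32) (0<num 31)
      in r * (δ * κ) , 0<* 0<r (0<* 0<δ 0<κ) , λ z z≤Z δ≤ →
           step A θ σ κ r 0≤A 0<θ θ≤ σ≤1 Aσ≤ 0<κ dom inv 0<r z (shift z l) (shift-Lead z lead) (bounded z z≤Z)
             (λ w → eval-shift z l w) δ≤
      where
      step : ∀ A θ σ κ r → 0ℚ ≤ A → 0ℚ < θ → num 128 * num (suc n) * θ ≤ 1ℚ → σ ≤ 1ℚ → num 64 * A * σ ≤ δ → 0ℚ < κ →
             (∀ as → Lead as n → Bounded A as → Dominant θ σ κ 1 as) → num 32 * r ≡ 1ℚ → 0ℚ < r →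
             ∀ z s → Lead s (suc n) → Bounded A s → (∀ w → eval𝔾 s w ≡ eval𝔾 l (z ∔ w)) → δ ≤ ‖ eval𝔾 l z ‖ →
             ∃[ z′ ] N (eval𝔾 l z′) + r * (δ * κ) ≤ N (eval𝔾 l z)
      step A θ σ κ r 0≤A 0<θ θ≤ σ≤1 Aσ≤ 0<κ dom inv 0<r z (a₀ ∷ as) (_ ∷ lead) (_ ∷ as≤A) eval≡ δ≤ = z ∔ S.w ,
        *-cancel-≤ (num 32) (0<num 31) (ℚ.≤-trans (ℚ.≤-reflexive (trans (distrib (num 32) (N (eval𝔾 l (z ∔ S.w))) r
          (δ * κ)) (trans (cong (λ t → num 32 * N (eval𝔾 l (z ∔ S.w)) + t * (δ * κ)) inv)
          (cong₂ (λ x y → num 32 * N x + y) (sym (eval≡ S.w)) (ℚ.*-identityˡ (δ * κ))))))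
          (ℚ.≤-trans (ℚ.+-monoʳ-≤ (num 32 * N (eval𝔾 (a₀ ∷ as) S.w)) (*-monoˡ κ (ℚ.<⇒≤ 0<κ) (ℚ.≤-trans δ≤
              (ℚ.≤-reflexive (cong ‖_‖ (sym a₀≡))))))
            (ℚ.≤-trans S.lowered (ℚ.≤-reflexive (cong (λ x → num 32 * N x) a₀≡)))))
        where
        distrib : ∀ c x r y → c * (x + r * y) ≡ c * x + (c * r) * y
        distrib = solve-∀ ℚ-ring
        a₀≡ : a₀ ≡ eval𝔾 l z
        a₀≡ = trans (at-zero a₀ (eval𝔾 as 0𝔾)) (trans (eval≡ 0𝔾) (cong (eval𝔾 l) (z∔0 z)))
          where
          at-zero : ∀ a b → a ≡ a ∔ 0𝔾 · b
          at-zero = solve-∀ 𝔾-ring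
          z∔0 : ∀ z → z ∔ 0𝔾 ≡ z
          z∔0 = solve-∀ 𝔾-ring
        module S = Step lead 0<θ θ≤ σ≤1 (dom as lead as≤A) a₀ A as≤A
          (ℚ.≤-trans (ℚ.≤-reflexive (sym (ℚ.*-assoc (num 64) A σ))) (ℚ.≤-trans Aσ≤ (ℚ.≤-trans δ≤ (ℚ.≤-reflexive
              (cong ‖_‖ (sym a₀≡)))))) 0≤A

  opaque
    coercive : ∀ {l n} → Lead l n → ∃[ Z ] (0ℚ ≤ Z × (∀ z → Z ≤ ‖ z ‖ → 1ℚ ≤ ‖ eval𝔾 l z ‖))
    -- Horner's scheme: outside a disc the tail has norm at least 1, so `z` times the tail has norm
    -- at least `‖z‖ / 2` and outgrows `K + ‖a‖`.
    coercive′ : ∀ {l n} → Lead l (suc n) → ∀ K → 0ℚ ≤ K → ∃[ Z ] (0ℚ ≤ Z × (∀ z → Z ≤ ‖ z ‖ → K ≤ ‖ eval𝔾 l z ‖))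

    coercive (last {c} 1≤c)     = 0ℚ , ℚ.≤-refl , λ z _ → subst (λ t → 1ℚ ≤ ‖ t ‖) (eq c z) 1≤c
      where
      eq : ∀ c z → c ≡ c ∔ z · 0𝔾
      eq = solve-∀ 𝔾-ring
    coercive (a ∷ lead@(last _)) = coercive′ (a ∷ lead) 1ℚ (ℚ.<⇒≤ (ℚ.positive⁻¹ 1ℚ))
    coercive (a ∷ lead@(_ ∷ _))  = coercive′ (a ∷ lead) 1ℚ (ℚ.<⇒≤ (ℚ.positive⁻¹ 1ℚ))

    coercive′ {a ∷ l} (a ∷ lead) K 0≤K =
      let Z , 0≤Z , l≥1 = coercive lead
      in Z + 2ℚ * (K + ‖ a ‖) , 0≤+ 0≤Z (0≤* (0≤num 2) 0≤K+a) , λ z Z≤z → bound z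
          (l≥1 z (ℚ.≤-trans (≤-by (2ℚ * (K + ‖ a ‖)) (0≤* (0≤num 2) 0≤K+a) refl) Z≤z))
          (ℚ.≤-trans (≤-by Z 0≤Z (ℚ.+-comm (2ℚ * (K + ‖ a ‖)) Z)) Z≤z)
      where
      0≤K+a : 0ℚ ≤ K + ‖ a ‖
      0≤K+a = 0≤+ 0≤K (0≤‖‖ a)
      bound : ∀ z → 1ℚ ≤ ‖ eval𝔾 l z ‖ → 2ℚ * (K + ‖ a ‖) ≤ ‖ z ‖ → K ≤ ‖ a ∔ z · eval𝔾 l z ‖
      bound z 1≤l 2K≤z = subst₂ _≤_ (cancel K (‖ a ‖)) (cancel (‖ a ∔ z · eval𝔾 l z ‖) (‖ a ‖)) (ℚ.+-monoˡ-≤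
        (- ‖ a ‖) (*-cancel-≤ {K + ‖ a ‖} {‖ a ∔ z · eval𝔾 l z ‖ + ‖ a ‖} 2ℚ (0<num 1) (ℚ.≤-trans 2K≤z
        (ℚ.≤-trans (ℚ.≤-reflexive (sym (ℚ.*-identityʳ (‖ z ‖)))) (ℚ.≤-trans (*-monoʳ (‖ z ‖) (0≤‖‖ z) 1≤l)
            (ℚ.≤-trans (‖·‖-lower z (eval𝔾 l z))
          (*-monoʳ 2ℚ (0≤num 2) (ℚ.≤-trans (ℚ.≤-reflexive (cong ‖_‖ (isolate a (z · eval𝔾 l z))))
              (‖⊖‖ (a ∔ z · eval𝔾 l z) a)))))))))
        where
        cancel : ∀ x y → x + y - y ≡ x
        cancel = solve-∀ ℚ-ring
        isolate : ∀ a b → b ≡ (a ∔ b) ∔ neg a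
        isolate = solve-∀ 𝔾-ring

  N≤0⇒‖‖≤ : ∀ z {κ δ} → N z ≤ num 0 * κ → 0ℚ ≤ δ → ‖ z ‖ ≤ δ
  N≤0⇒‖‖≤ z {κ} {δ} Nz≤ 0≤δ = ℚ.≤-trans (square-cancel-≤ {‖ z ‖} {0ℚ} ℚ.≤-refl (ℚ.≤-trans (‖‖²≤2N z)
    (ℚ.≤-trans (*-monoʳ 2ℚ (0≤num 2) Nz≤) (ℚ.≤-reflexive (zero-product κ))))) 0≤δ
    where
    zero-product : ∀ k → (1ℚ + 1ℚ) * (0ℚ * k) ≡ 0ℚ * 0ℚ
    zero-product = solve-∀ ℚ-ring

  remaining : ∀ {x y κ} m → x + κ ≤ y → y ≤ num (suc m) * κ → x ≤ num m * κ
  remaining {x} {y} {κ} m x+κ≤y y≤ = subst₂ _≤_ (cancel x κ) (trans (cong (λ t → t * κ - κ) (num-suc m))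
    (cancel′ (num m) κ)) (ℚ.+-monoˡ-≤ (- κ) (ℚ.≤-trans x+κ≤y y≤))
    where
    cancel : ∀ x y → x + y - y ≡ x
    cancel = solve-∀ ℚ-ring
    cancel′ : ∀ n k → (1ℚ + n) * k - k ≡ n * k
    cancel′ = solve-∀ ℚ-ring

  -- `m` bounds the number of decrements by `κ` that are still possible; when none is left,
  -- `F z ≤ 0`, and `stop` concludes.
  lower-repeatedly : ∀ {P : 𝔾 → Set} (F : 𝔾 → ℚ) F₀ κ → 0ℚ ≤ κ → (∀ z → F z ≤ F₀ → F z ≤ num 0 * κ → P z) →
                     (∀ z → F z ≤ F₀ → P z ⊎ (∃[ z′ ] F z′ + κ ≤ F z)) → ∀ m z → F z ≤ F₀ → F z ≤ num m * κ → ∃ P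
  lower-repeatedly F F₀ κ 0≤κ stop step zero    z Fz≤ Fz≤mκ = z , stop z Fz≤ Fz≤mκ
  lower-repeatedly F F₀ κ 0≤κ stop step (suc m) z Fz≤ Fz≤mκ with step z Fz≤
  ... | inj₁ found        = z , found
  ... | inj₂ (z′ , Fz′≤) = lower-repeatedly F F₀ κ 0≤κ stop step m z′ (ℚ.≤-trans (≤-by {F z′} {F z′ + κ} κ 0≤κ refl)
      (ℚ.≤-trans Fz′≤ Fz≤)) (remaining {F z′} {F z} {κ} m Fz′≤ Fz≤mκ)

  module _ {l : List 𝔾} {Z N₀ K δ κ : ℚ} (0<δ : 0ℚ < δ) (0<κ : 0ℚ < κ)
           (large : ∀ z → Z ≤ ‖ z ‖ → K ≤ ‖ eval𝔾 l z ‖) (small : ∀ x → x * x ≤ num 2 * N₀ → x < K)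
           (lower : ∀ z → ‖ z ‖ ≤ Z → δ ≤ ‖ eval𝔾 l z ‖ → ∃[ z′ ] N (eval𝔾 l z′) + κ ≤ N (eval𝔾 l z)) where

    -- The descent never raises `N` above its initial value, so coercivity confines it to the disc
    -- on which one `κ` serves throughout.
    inside : ∀ z → N (eval𝔾 l z) ≤ N₀ → ‖ z ‖ ≤ Z
    inside z Nz≤ with ℚ.≤-total Z (‖ z ‖)
    ... | inj₂ z≤Z = z≤Z
    ... | inj₁ Z≤z = ⊥-elim (<⇒≱ (small (‖ eval𝔾 l z ‖) (ℚ.≤-trans (‖‖²≤2N (eval𝔾 l z)) (*-monoʳ 2ℚ (0≤num 2) Nz≤)))
        (large z Z≤z))

    stop-or-lower : ∀ z → N (eval𝔾 l z) ≤ N₀ → (‖ z ‖ ≤ Z × ‖ eval𝔾 l z ‖ ≤ δ) ⊎ (∃[ z′ ] N (eval𝔾 l z′) + κ ≤ N (eval𝔾 l z))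
    stop-or-lower z Nz≤ with ℚ.≤-total (‖ eval𝔾 l z ‖) δ
    ... | inj₁ ≤δ = inj₁ (inside z Nz≤ , ≤δ)
    ... | inj₂ δ≤ = inj₂ (lower z (inside z Nz≤) δ≤)

    descend : N (eval𝔾 l 0𝔾) ≤ N₀ → ∃[ z ] (‖ z ‖ ≤ Z × ‖ eval𝔾 l z ‖ ≤ δ)
    descend N₀≥ =
      let r , 0<r , inv = reciprocal κ 0<κ
          m , m≥        = archimedean (N₀ * r)
      in lower-repeatedly (λ z → N (eval𝔾 l z)) N₀ κ (ℚ.<⇒≤ 0<κ) (λ z Nz≤ Nz≤0 → inside z Nz≤ , N≤0⇒‖‖≤
          (eval𝔾 l z) {κ} Nz≤0 (ℚ.<⇒≤ 0<δ)) stop-or-lower m 0𝔾 N₀≥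
        (ℚ.≤-trans N₀≥ (ℚ.≤-trans (ℚ.≤-reflexive (sym (trans (ℚ.*-assoc N₀ r κ)
            (trans (cong (N₀ *_) (trans (ℚ.*-comm r κ) inv)) (ℚ.*-identityʳ N₀))))) (*-monoˡ κ (ℚ.<⇒≤ 0<κ) m≥)))

  -- `2 y + 2` is a rational stand-in for the square root of `2 y`: its square exceeds `2 y` by
  -- `4 y² + 6 y + 4`.
  below-coercive : ∀ y → 0ℚ ≤ y → ∀ x → x * x ≤ num 2 * y → x < num 2 * y + num 2
  below-coercive y 0≤y x x²≤ = ℚ.≰⇒> λ K≤x → <⇒≱ (ℚ.<-≤-trans positive-gap (*-mono 0≤K (ℚ.≤-trans 0≤K K≤x) K≤x K≤x)) x²≤
    where
    0≤K : 0ℚ ≤ num 2 * y + num 2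
    0≤K = 0≤+ (0≤* (0≤num 2) 0≤y) (0≤num 2)
    eq : ∀ y → num 2 * y + num 4 + (num 4 * (y * y) + num 6 * y) ≡ (num 2 * y + num 2) * (num 2 * y + num 2)
    eq = solve-∀ ℚ-ring
    positive-gap : num 2 * y < (num 2 * y + num 2) * (num 2 * y + num 2)
    positive-gap = ℚ.<-≤-trans (subst (_< num 2 * y + num 4) (ℚ.+-identityʳ (num 2 * y)) (ℚ.+-monoʳ-< (num 2 * y) (0<num 3)))
      (≤-by (num 4 * (y * y) + num 6 * y) (0≤+ (0≤* (0≤num 4) (0≤* 0≤y 0≤y)) (0≤* (0≤num 6) 0≤y)) (eq y))

  opaque
    -- `Z` is fixed before `δ`, because the accuracy that Newton's iteration demands depends on
    -- bounds over the disc of radius `Z`.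
    approximate-root : ∀ {l n} → Lead l (suc n) → ∃[ Z ] (0ℚ ≤ Z × (∀ δ → 0ℚ < δ → ∃[ z ] (‖ z ‖ ≤ Z × ‖ eval𝔾 l z ‖ ≤ δ)))
    approximate-root {l} {n} lead =
      let N₀              = N (eval𝔾 l 0𝔾)
          0≤N₀            = 0≤N (eval𝔾 l 0𝔾)
          Z , 0≤Z , large = coercive′ lead (num 2 * N₀ + num 2) (0≤+ (0≤* (0≤num 2) 0≤N₀) (0≤num 2))
      in Z , 0≤Z , λ δ 0<δ → let κ , 0<κ , lower = lowering l n lead Z δ 0≤Z 0<δ in descend {l} 0<δ 0<κ large (below-coercive N₀ 0≤N₀) lower ℚ.≤-refl

-- Integer polynomials as expressions, and their derivatives

module Polynomials where

  open import Data.Integer.Base using (+_; -_; _+_; _*_; _-_; ∣_∣)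
  open import Data.Integer.Tactic.RingSolver using (solve-∀)

  infixl 6 _⊕_
  infixl 7 _⊗_
  infixr 8 _^^_

  -- Polynomials are syntax compared by their values on ℤ: evaluation commutes with the operations
  -- by definition, and polynomial identities become integer identities in `⟦ p ⟧ x`. Coefficient
  -- lists are consulted only for degrees and for transfer to other rings.
  data Expr : Set where
    con     : ℤ → Expr
    X       : Expr
    _⊕_ _⊗_ : Expr → Expr → Expr

  ⟦_⟧ : Expr → ℤ → ℤ
  ⟦ con a ⟧ x = a
  ⟦ X ⟧     x = x
  ⟦ p ⊕ q ⟧ x = ⟦ p ⟧ x + ⟦ q ⟧ x
  ⟦ p ⊗ q ⟧ x = ⟦ p ⟧ x * ⟦ q ⟧ x

  infix 4 _≐_
  _≐_ : Expr → Expr → Set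
  p ≐ q = ∀ x → ⟦ p ⟧ x ≡ ⟦ q ⟧ x

  D : Expr → Expr
  D (con a) = con 0ℤ
  D X       = con 1ℤ
  D (p ⊕ q) = D p ⊕ D q
  D (p ⊗ q) = D p ⊗ q ⊕ p ⊗ D q

  _^^_ : Expr → ℕ → Expr
  p ^^ zero  = con 1ℤ
  p ^^ suc n = p ⊗ p ^^ n

  infixr 9 _∘ᴱ_
  _∘ᴱ_ : Expr → Expr → Expr
  con a   ∘ᴱ φ = con a
  X       ∘ᴱ φ = φ
  (p ⊕ q) ∘ᴱ φ = (p ∘ᴱ φ) ⊕ (q ∘ᴱ φ)
  (p ⊗ q) ∘ᴱ φ = (p ∘ᴱ φ) ⊗ (q ∘ᴱ φ)

  ⟦∘ᴱ⟧ : ∀ p φ x → ⟦ p ∘ᴱ φ ⟧ x ≡ ⟦ p ⟧ (⟦ φ ⟧ x)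
  ⟦∘ᴱ⟧ (con a) φ x = refl
  ⟦∘ᴱ⟧ X       φ x = refl
  ⟦∘ᴱ⟧ (p ⊕ q) φ x = cong₂ _+_ (⟦∘ᴱ⟧ p φ x) (⟦∘ᴱ⟧ q φ x)
  ⟦∘ᴱ⟧ (p ⊗ q) φ x = cong₂ _*_ (⟦∘ᴱ⟧ p φ x) (⟦∘ᴱ⟧ q φ x)

  D-∘ᴱ : ∀ p φ x → ⟦ D (p ∘ᴱ φ) ⟧ x ≡ ⟦ D p ⟧ (⟦ φ ⟧ x) * ⟦ D φ ⟧ x
  D-∘ᴱ (con a) φ x = refl
  D-∘ᴱ X       φ x = sym (ℤ.*-identityˡ _)
  D-∘ᴱ (p ⊕ q) φ x = trans (cong₂ _+_ (D-∘ᴱ p φ x) (D-∘ᴱ q φ x)) (sym (ℤ.*-distribʳ-+ (⟦ D φ ⟧ x) (⟦ D p ⟧ (⟦ φ ⟧ x))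
    (⟦ D q ⟧ (⟦ φ ⟧ x))))
  D-∘ᴱ (p ⊗ q) φ x = trans
    (cong₂ _+_ (cong₂ _*_ (D-∘ᴱ p φ x) (⟦∘ᴱ⟧ q φ x)) (cong₂ _*_ (⟦∘ᴱ⟧ p φ x) (D-∘ᴱ q φ x)))
    (product-rule (⟦ D p ⟧ (⟦ φ ⟧ x)) (⟦ q ⟧ (⟦ φ ⟧ x)) (⟦ p ⟧ (⟦ φ ⟧ x)) (⟦ D q ⟧ (⟦ φ ⟧ x)) (⟦ D φ ⟧ x))
    where
    product-rule : ∀ a b c d e → (a * e) * b + c * (d * e) ≡ (a * b + c * d) * e
    product-rule = solve-∀

  -- The Taylor expansion to first order determines D p as a function of p alone.
  taylor₁ : ∀ p x h → ∃[ r ] ⟦ p ⟧ (x + h) ≡ ⟦ p ⟧ x + h * ⟦ D p ⟧ x + h * h * r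
  taylor₁ (con a) x h = 0ℤ , eq a h
    where
    eq : ∀ a h → a ≡ a + h * 0ℤ + h * h * 0ℤ
    eq = solve-∀
  taylor₁ X x h = 0ℤ , eq x h
    where
    eq : ∀ x h → x + h ≡ x + h * 1ℤ + h * h * 0ℤ
    eq = solve-∀
  taylor₁ (p ⊕ q) x h with taylor₁ p x h | taylor₁ q x h
  ... | r , pr | s , qs = r + s , trans (cong₂ _+_ pr qs) (eq (⟦ p ⟧ x) (⟦ q ⟧ x) (⟦ D p ⟧ x) (⟦ D q ⟧ x) h r s)
    where
    eq : ∀ a b c d h r s → (a + h * c + h * h * r) + (b + h * d + h * h * s) ≡ (a + b) + h * (c + d) + h * h * (r + s)
    eq = solve-∀
  taylor₁ (p ⊗ q) x h with taylor₁ p x h | taylor₁ q x h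
  ... | r , pr | s , qs = _ , trans (cong₂ _*_ pr qs) (eq (⟦ p ⟧ x) (⟦ q ⟧ x) (⟦ D p ⟧ x) (⟦ D q ⟧ x) h r s)
    where
    eq : ∀ a b c d h r s → (a + h * c + h * h * r) * (b + h * d + h * h * s) ≡
         (a * b) + h * (c * b + a * d) + h * h * (a * s + c * d + r * b + h * (c * s + r * d) + h * h * (r * s))
    eq = solve-∀

  -- With `d` the difference of the derivatives at `x`, the two expansions at `x + h` give
  -- `h d = h² (s − r)`, so `h` divides `d`; the choice `h = 1 + ∣d∣` leaves only `d = 0`.
  D-cong : ∀ {p q} → p ≐ q → D p ≐ D q
  D-cong {p} {q} p≐q x with taylor₁ p x (+ suc ∣ ⟦ D p ⟧ x - ⟦ D q ⟧ x ∣) | taylor₁ q x (+ suc ∣ ⟦ D p ⟧ x - ⟦ D q ⟧ x ∣)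
  ... | r , pr | s , qs = ℤ.i-j≡0⇒i≡j _ _ (small-multiple _ (s - r) (suc ∣ d ∣) ℕ.≤-refl (*-cancelˡ h d (h * (s - r)) (λ ()) hd≡))
    where
    open ≡-Reasoning
    d = ⟦ D p ⟧ x - ⟦ D q ⟧ x
    h = + suc ∣ d ∣
    lhs : ∀ a h c d e → h * (c - d) ≡ (a + h * c + e) - (a + h * d) - e
    lhs = solve-∀
    rhs : ∀ a h d r s → (a + h * d + h * h * s) - (a + h * d) - h * h * r ≡ h * (h * (s - r))
    rhs = solve-∀
    hd≡ : h * d ≡ h * (h * (s - r))
    hd≡ = begin
      h * d ≡⟨ lhs (⟦ p ⟧ x) h (⟦ D p ⟧ x) (⟦ D q ⟧ x) (h * h * r) ⟩
      (⟦ p ⟧ x + h * ⟦ D p ⟧ x + h * h * r) - (⟦ p ⟧ x + h * ⟦ D q ⟧ x) - h * h * r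
        ≡⟨ cong₂ (λ u v → u - (v + h * ⟦ D q ⟧ x) - h * h * r) (trans (sym pr) (trans (p≐q (x + h)) qs)) (p≐q x) ⟩
      (⟦ q ⟧ x + h * ⟦ D q ⟧ x + h * h * s) - (⟦ q ⟧ x + h * ⟦ D q ⟧ x) - h * h * r ≡⟨ rhs (⟦ q ⟧ x) h (⟦ D q ⟧ x) r s ⟩
      h * (h * (s - r)) ∎

  -- Coefficient lists

  toList : Expr → ℤ[X].Poly
  toList (con a) = a ∷ []
  toList X       = 0ℤ ∷ 1ℤ ∷ []
  toList (p ⊕ q) = toList p ℤ[X].+ᴾ toList q
  toList (p ⊗ q) = toList p ℤ[X].*ᴾ toList q

  fromList : ℤ[X].Poly → Expr
  fromList []      = con 0ℤ
  fromList (a ∷ p) = con a ⊕ X ⊗ fromList p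

  ⟦fromList⟧ : ∀ p x → ⟦ fromList p ⟧ x ≡ ℤ[X].eval p x
  ⟦fromList⟧ []      x = refl
  ⟦fromList⟧ (a ∷ p) x = cong (λ v → a + x * v) (⟦fromList⟧ p x)

  module Evaluation {c ℓ} (R : CommutativeRing c ℓ) where
    open CommutativeRing R renaming (_+_ to _∔_; _*_ to _·_; refl to ≈-refl; sym to ≈-sym; trans to ≈-trans)
    open SemiringSolver commutativeSemiring using (solve; _:+_; _:*_; _:=_) renaming (con to :con)
    open import Relation.Binary.Reasoning.Setoid setoid

    record Embedding : Set (c ⊔ ℓ) where
      field
        ι   : ℤ → Carrier
        ι-+ : ∀ a b → ι (a + b) ≈ ι a ∔ ι b
        ι-* : ∀ a b → ι (a * b) ≈ ι a · ι b
        ι-0 : ι 0ℤ ≈ 0#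
        ι-1 : ι 1ℤ ≈ 1#

    module _ (emb : Embedding) where
      open Embedding emb

      evalᴿ : ℤ[X].Poly → Carrier → Carrier
      evalᴿ []      x = 0#
      evalᴿ (a ∷ p) x = ι a ∔ x · evalᴿ p x

      ⟦_⟧ᴿ : Expr → Carrier → Carrier
      ⟦ con a ⟧ᴿ x = ι a
      ⟦ X ⟧ᴿ     x = x
      ⟦ p ⊕ q ⟧ᴿ x = ⟦ p ⟧ᴿ x ∔ ⟦ q ⟧ᴿ x
      ⟦ p ⊗ q ⟧ᴿ x = ⟦ p ⟧ᴿ x · ⟦ q ⟧ᴿ x

      evalᴿ-+ : ∀ p q x → evalᴿ (p ℤ[X].+ᴾ q) x ≈ evalᴿ p x ∔ evalᴿ q x
      evalᴿ-+ []      q       x = ≈-sym (+-identityˡ _)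
      evalᴿ-+ (a ∷ p) []      x = ≈-sym (+-identityʳ _)
      evalᴿ-+ (a ∷ p) (b ∷ q) x = begin
        ι (a + b) ∔ x · evalᴿ (p ℤ[X].+ᴾ q) x ≈⟨ +-cong (ι-+ a b) (*-congˡ (evalᴿ-+ p q x)) ⟩
        (ι a ∔ ι b) ∔ x · (evalᴿ p x ∔ evalᴿ q x)
          ≈⟨ solve 5 (λ a b x p q → (a :+ b) :+ x :* (p :+ q) := (a :+ x :* p) :+ (b :+ x :* q)) ≈-refl (ι a) (ι b) x
            (evalᴿ p x) (evalᴿ q x) ⟩
        (ι a ∔ x · evalᴿ p x) ∔ (ι b ∔ x · evalᴿ q x) ∎

      evalᴿ-map : ∀ a p x → evalᴿ (List.map (a *_) p) x ≈ ι a · evalᴿ p x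
      evalᴿ-map a []      x = ≈-sym (zeroʳ _)
      evalᴿ-map a (b ∷ p) x = begin
        ι (a * b) ∔ x · evalᴿ (List.map (a *_) p) x ≈⟨ +-cong (ι-* a b) (*-congˡ (evalᴿ-map a p x)) ⟩
        ι a · ι b ∔ x · (ι a · evalᴿ p x)
          ≈⟨ solve 4 (λ a b x p → a :* b :+ x :* (a :* p) := a :* (b :+ x :* p)) ≈-refl (ι a) (ι b) x (evalᴿ p x) ⟩
        ι a · (ι b ∔ x · evalᴿ p x) ∎

      evalᴿ-* : ∀ p q x → evalᴿ (p ℤ[X].*ᴾ q) x ≈ evalᴿ p x · evalᴿ q x
      evalᴿ-* []      q x = ≈-sym (zeroˡ _)
      evalᴿ-* (a ∷ p) q x = begin
        evalᴿ (List.map (a *_) q ℤ[X].+ᴾ (0ℤ ∷ (p ℤ[X].*ᴾ q))) x ≈⟨ evalᴿ-+ (List.map (a *_) q) _ x ⟩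
        evalᴿ (List.map (a *_) q) x ∔ (ι 0ℤ ∔ x · evalᴿ (p ℤ[X].*ᴾ q) x)
          ≈⟨ +-cong (evalᴿ-map a q x) (+-cong ι-0 (*-congˡ (evalᴿ-* p q x))) ⟩
        ι a · evalᴿ q x ∔ (0# ∔ x · (evalᴿ p x · evalᴿ q x))
          ≈⟨ +-congˡ (+-identityˡ _) ⟩
        ι a · evalᴿ q x ∔ x · (evalᴿ p x · evalᴿ q x)
          ≈⟨ solve 4 (λ a x p q → a :* q :+ x :* (p :* q) := (a :+ x :* p) :* q) ≈-refl (ι a) x (evalᴿ p x) (evalᴿ q x) ⟩
        (ι a ∔ x · evalᴿ p x) · evalᴿ q x ∎

      evalᴿ-toList : ∀ p x → evalᴿ (toList p) x ≈ ⟦ p ⟧ᴿ x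
      evalᴿ-toList (con a) x = ≈-trans (+-congˡ (zeroʳ x)) (+-identityʳ _)
      evalᴿ-toList X       x = begin
        ι 0ℤ ∔ x · (ι 1ℤ ∔ x · 0#) ≈⟨ +-cong ι-0 (*-congˡ (+-cong ι-1 (zeroʳ x))) ⟩
        0# ∔ x · (1# ∔ 0#)         ≈⟨ +-identityˡ _ ⟩
        x · (1# ∔ 0#)              ≈⟨ *-congˡ (+-identityʳ 1#) ⟩
        x · 1#                     ≈⟨ *-identityʳ x ⟩
        x                          ∎
      evalᴿ-toList (p ⊕ q) x = ≈-trans (evalᴿ-+ (toList p) (toList q) x) (+-cong (evalᴿ-toList p x) (evalᴿ-toList q x))
      evalᴿ-toList (p ⊗ q) x = ≈-trans (evalᴿ-* (toList p) (toList q) x) (*-cong (evalᴿ-toList p x) (evalᴿ-toList q x))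

      evalᴿ-vanish : ∀ p x → All (_≡ 0ℤ) p → evalᴿ p x ≈ 0#
      evalᴿ-vanish []      x []            = ≈-refl
      evalᴿ-vanish (a ∷ p) x (refl ∷ p≡0) = begin
        ι 0ℤ ∔ x · evalᴿ p x ≈⟨ +-cong ι-0 (*-congˡ (evalᴿ-vanish p x p≡0)) ⟩
        0# ∔ x · 0#          ≈⟨ +-identityˡ _ ⟩
        x · 0#               ≈⟨ zeroʳ x ⟩
        0#                   ∎

  module Evℤ = Evaluation ℤ.+-*-commutativeRing

  ℤ-embedding : Evℤ.Embedding
  ℤ-embedding = record { ι = λ a → a ; ι-+ = λ _ _ → refl ; ι-* = λ _ _ → refl ; ι-0 = refl ; ι-1 = refl }

  evalᴿ-ℤ : ∀ p x → Evℤ.evalᴿ ℤ-embedding p x ≡ ℤ[X].eval p x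
  evalᴿ-ℤ []      x = refl
  evalᴿ-ℤ (a ∷ p) x = cong (λ v → a + x * v) (evalᴿ-ℤ p x)

  ⟦⟧ᴿ-ℤ : ∀ p x → Evℤ.⟦_⟧ᴿ ℤ-embedding p x ≡ ⟦ p ⟧ x
  ⟦⟧ᴿ-ℤ (con a) x = refl
  ⟦⟧ᴿ-ℤ X       x = refl
  ⟦⟧ᴿ-ℤ (p ⊕ q) x = cong₂ _+_ (⟦⟧ᴿ-ℤ p x) (⟦⟧ᴿ-ℤ q x)
  ⟦⟧ᴿ-ℤ (p ⊗ q) x = cong₂ _*_ (⟦⟧ᴿ-ℤ p x) (⟦⟧ᴿ-ℤ q x)

  eval-toList : ∀ p x → ℤ[X].eval (toList p) x ≡ ⟦ p ⟧ x
  eval-toList p x = trans (sym (evalᴿ-ℤ (toList p) x)) (trans (Evℤ.evalᴿ-toList ℤ-embedding p x) (⟦⟧ᴿ-ℤ p x))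

  eval-+ : ∀ p q x → ℤ[X].eval (p ℤ[X].+ᴾ q) x ≡ ℤ[X].eval p x + ℤ[X].eval q x
  eval-+ p q x = trans (sym (evalᴿ-ℤ (p ℤ[X].+ᴾ q) x)) (trans (Evℤ.evalᴿ-+ ℤ-embedding p q x)
    (cong₂ _+_ (evalᴿ-ℤ p x) (evalᴿ-ℤ q x)))

  eval-map : ∀ a p x → ℤ[X].eval (List.map (a *_) p) x ≡ a * ℤ[X].eval p x
  eval-map a p x = trans (sym (evalᴿ-ℤ (List.map (a *_) p) x)) (trans (Evℤ.evalᴿ-map ℤ-embedding a p x) (cong (a *_)
    (evalᴿ-ℤ p x)))

  eval-* : ∀ p q x → ℤ[X].eval (p ℤ[X].*ᴾ q) x ≡ ℤ[X].eval p x * ℤ[X].eval q x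
  eval-* p q x = trans (sym (evalᴿ-ℤ (p ℤ[X].*ᴾ q) x)) (trans (Evℤ.evalᴿ-* ℤ-embedding p q x)
    (cong₂ _*_ (evalᴿ-ℤ p x) (evalᴿ-ℤ q x)))

  -- Every large `n` divides the constant coefficient, which is therefore 0; cancelling `n` passes
  -- to the tail. The bound moves to `suc N` so that the cancelled number is positive.
  vanishes : ∀ p N → (∀ n → N ℕ.≤ n → ℤ[X].eval p (+ n) ≡ 0ℤ) → All (_≡ 0ℤ) p
  vanishes []      N p≡0 = []
  vanishes (a ∷ p) N p≡0 = a≡0 ∷ vanishes p (suc N) tail≡0
    where
    n = N ℕ.⊔ suc ∣ a ∣
    move : ∀ a x v → a ≡ x * (- v) + (a + x * v)
    move = solve-∀
    a≡0 : a ≡ 0ℤ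
    a≡0 = small-multiple a (- ℤ[X].eval p (+ n)) n (ℕ.m≤n⊔m N (suc ∣ a ∣))
      (trans (move a (+ n) (ℤ[X].eval p (+ n))) (trans (cong (λ v → (+ n) * (- ℤ[X].eval p (+ n)) + v)
          (p≡0 n (ℕ.m≤m⊔n N _))) (ℤ.+-identityʳ _)))
    tail≡0 : ∀ m → suc N ℕ.≤ m → ℤ[X].eval p (+ m) ≡ 0ℤ
    tail≡0 (suc m) N≤m = *-cancel-zero {+ suc m} (λ ())
      (trans (sym (ℤ.+-identityˡ _)) (trans (cong (_+ (+ suc m * ℤ[X].eval p (+ suc m))) (sym a≡0)) (p≡0 (suc m)
          (ℕ.≤-trans (ℕ.n≤1+n N) N≤m))))

open Polynomials

-- Degrees and growth

module Degrees where

  open import Data.Integer.Base using (+_; -_; _+_; _*_; _-_; ∣_∣)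
  open import Data.Integer.Tactic.RingSolver using (solve-∀)

  infix 4 _<°_
  -- The bound is strict so that `<° 0` captures the zero polynomial; being stated through values,
  -- it is stable under `≐`.
  record _<°_ (p : Expr) (n : ℕ) : Set where
    constructor mk<°
    field
      coeffs   : ℤ[X].Poly
      length≤n : length coeffs ℕ.≤ n
      ≐coeffs  : ∀ x → ⟦ p ⟧ x ≡ ℤ[X].eval coeffs x

  record Deg (p : Expr) (n : ℕ) : Set where
    constructor mkDeg
    field
      lower     : Expr
      lead      : ℤ
      lower<°n  : lower <° n
      lead≢0    : lead ≢ 0ℤ
      ≐leading  : p ≐ lower ⊕ con lead ⊗ X ^^ n

  -- The working form of "not the zero polynomial": it passes at once to products, to divisors, and
  -- to composites with nonconstant polynomials.
  record EventuallyNonzero (p : Expr) : Set where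
    constructor _,_
    field
      from    : ℕ
      nonzero : ∀ x → from ℕ.≤ ∣ x ∣ → ⟦ p ⟧ x ≢ 0ℤ

  <°-resp : ∀ {p q n} → p ≐ q → q <° n → p <° n
  <°-resp p≐q (mk<° l len eq) = mk<° l len λ x → trans (p≐q x) (eq x)

  <°-weaken : ∀ {p m n} → m ℕ.≤ n → p <° m → p <° n
  <°-weaken m≤n (mk<° l len eq) = mk<° l (ℕ.≤-trans len m≤n) eq

  <°-toList : ∀ p → p <° length (toList p)
  <°-toList p = mk<° (toList p) ℕ.≤-refl λ x → sym (eval-toList p x)

  <°-zero : ∀ n → con 0ℤ <° n
  <°-zero n = mk<° [] z≤n λ x → refl

  <°0⇒≐0 : ∀ {p} → p <° 0 → p ≐ con 0ℤ
  <°0⇒≐0 (mk<° [] _ eq) = eq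

  <°-con : ∀ a → con a <° 1
  <°-con a = mk<° (a ∷ []) ℕ.≤-refl λ x → sym (trans (cong (λ v → a + v) (ℤ.*-zeroʳ x)) (ℤ.+-identityʳ a))

  length-+ᴾ : ∀ {n} p q → length p ℕ.≤ n → length q ℕ.≤ n → length (p ℤ[X].+ᴾ q) ℕ.≤ n
  length-+ᴾ []      q       p≤n       q≤n       = q≤n
  length-+ᴾ (a ∷ p) []      p≤n       q≤n       = p≤n
  length-+ᴾ (a ∷ p) (b ∷ q) (s≤s p≤n) (s≤s q≤n) = s≤s (length-+ᴾ p q p≤n q≤n)

  <°-⊕ : ∀ {p q n} → p <° n → q <° n → p ⊕ q <° n
  <°-⊕ (mk<° l len eq) (mk<° l′ len′ eq′) = mk<° (l ℤ[X].+ᴾ l′) (length-+ᴾ l l′ len len′)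
    λ x → trans (cong₂ _+_ (eq x) (eq′ x)) (sym (eval-+ l l′ x))

  <°-scale : ∀ k {p n} → p <° n → con k ⊗ p <° n
  <°-scale k (mk<° l len eq) = mk<° (List.map (k *_) l) (subst (ℕ._≤ _) (sym (List.length-map (k *_) l)) len)
    λ x → trans (cong (k *_) (eq x)) (sym (eval-map k l x))

  <°-X⊗ : ∀ {p n} → p <° n → X ⊗ p <° suc n
  <°-X⊗ (mk<° l len eq) = mk<° (0ℤ ∷ l) (s≤s len) λ x → trans (cong (x *_) (eq x)) (sym (ℤ.+-identityˡ _))

  <°-X^^⊗ : ∀ m {p n} → p <° n → X ^^ m ⊗ p <° m ℕ.+ n
  <°-X^^⊗ zero    {p} p<n = <°-resp {q = p} (λ x → ℤ.*-identityˡ _) p<n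
  <°-X^^⊗ (suc m) {p} p<n = <°-resp {q = X ⊗ (X ^^ m ⊗ p)} (λ x → ℤ.*-assoc x (⟦ X ^^ m ⟧ x) (⟦ p ⟧ x)) (<°-X⊗ (<°-X^^⊗ m p<n))

  <°-⊗ : ∀ {p q m n} → p <° m → q <° n → p ⊗ q <° m ℕ.+ n
  <°-⊗ {q = q} (mk<° [] len eq) q<n = <°-resp {q = con 0ℤ} (λ x → trans (cong (_* ⟦ q ⟧ x) (eq x))
    (ℤ.*-zeroˡ (⟦ q ⟧ x))) (<°-zero _)
  <°-⊗ {q = q} {suc m} {n} (mk<° (a ∷ l) (s≤s len) eq) q<n = <°-resp {q = con a ⊗ q ⊕ X ⊗ (fromList l ⊗ q)}
    (λ x → trans (cong (_* ⟦ q ⟧ x) (eq x)) (trans (distrib a x (ℤ[X].eval l x) (⟦ q ⟧ x))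
             (cong (λ v → a * ⟦ q ⟧ x + x * (v * ⟦ q ⟧ x)) (sym (⟦fromList⟧ l x)))))
    (<°-⊕ {con a ⊗ q} (<°-weaken {con a ⊗ q} (ℕ.m≤n+m n (suc m)) (<°-scale a {q} q<n)) (<°-X⊗ {fromList l ⊗ q} (<°-⊗ {fromList l} {q} (mk<° l len (⟦fromList⟧ l)) q<n)))
    where
    distrib : ∀ a x l q → (a + x * l) * q ≡ a * q + x * (l * q)
    distrib = solve-∀

  eval-split : ∀ n l → length l ℕ.≤ suc n →
               ∃[ l₀ ] ∃[ a ] (length l₀ ℕ.≤ n × (∀ x → ℤ[X].eval l x ≡ ℤ[X].eval l₀ x + a * ⟦ X ^^ n ⟧ x))
  eval-split n       []      len = [] , 0ℤ , z≤n , λ x → sym (ℤ.*-zeroˡ (⟦ X ^^ n ⟧ x))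
  eval-split zero    (a ∷ []) len = [] , a , z≤n , λ x → eq a x
    where
    eq : ∀ a x → a + x * 0ℤ ≡ 0ℤ + a * 1ℤ
    eq = solve-∀
  eval-split zero    (a ∷ b ∷ l) (s≤s ())
  eval-split (suc n) (a ∷ l) (s≤s len) with eval-split n l len
  ... | l₀ , b , len₀ , eq = a ∷ l₀ , b , s≤s len₀ , λ x →
    trans (cong (λ v → a + x * v) (eq x)) (rearrange a x (ℤ[X].eval l₀ x) b (⟦ X ^^ n ⟧ x))
    where
    rearrange : ∀ a x l b y → a + x * (l + b * y) ≡ (a + x * l) + b * (x * y)
    rearrange = solve-∀

  opaque
    <°-split : ∀ {p n} → p <° suc n → ∃[ p₀ ] ∃[ a ] (p₀ <° n × p ≐ p₀ ⊕ con a ⊗ X ^^ n)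
    <°-split {n = n} (mk<° l len eq) with eval-split n l len
    ... | l₀ , a , len₀ , eq₀ = fromList l₀ , a , mk<° l₀ len₀ (⟦fromList⟧ l₀) ,
      λ x → trans (eq x) (trans (eq₀ x) (cong (λ v → v + a * ⟦ X ^^ n ⟧ x) (sym (⟦fromList⟧ l₀ x))))

  drop-zero-term : ∀ {p₀ a n} → a ≡ 0ℤ → p₀ ⊕ con a ⊗ X ^^ n ≐ p₀
  drop-zero-term {p₀} {n = n} refl x = trans (cong (λ v → ⟦ p₀ ⟧ x + v) (ℤ.*-zeroˡ (⟦ X ^^ n ⟧ x))) (ℤ.+-identityʳ _)

  opaque
    <°⇒Deg : ∀ {p} n → p <° n → p ≐ con 0ℤ ⊎ ∃[ m ] (m ℕ.< n × Deg p m)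
    <°⇒Deg     zero    p<0 = inj₁ (<°0⇒≐0 p<0)
    <°⇒Deg {p} (suc n) p<n with <°-split {p} p<n
    ... | p₀ , a , p₀<n , p≐ with a ℤ.≟ 0ℤ
    ...   | no a≢0 = inj₂ (n , ℕ.≤-refl , mkDeg p₀ a p₀<n a≢0 p≐)
    ...   | yes a≡0 with <°⇒Deg {p} n (<°-resp {q = p₀} (λ x → trans (p≐ x) (drop-zero-term {p₀} {n = n} a≡0 x)) p₀<n)
    ...     | inj₁ p≐0 = inj₁ p≐0
    ...     | inj₂ (m , m<n , deg) = inj₂ (m , ℕ.m<n⇒m<1+n m<n , deg)

  opaque
    ≐0⊎Deg : ∀ p → p ≐ con 0ℤ ⊎ ∃ (Deg p)
    ≐0⊎Deg p with <°⇒Deg _ (<°-toList p)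
    ... | inj₁ p≐0            = inj₁ p≐0
    ... | inj₂ (m , _ , deg) = inj₂ (m , deg)

  opaque
    nonzero⇒Deg : ∀ {p n} → p <° n → ∀ x → ⟦ p ⟧ x ≢ 0ℤ → ∃[ m ] (m ℕ.< n × Deg p m)
    nonzero⇒Deg {p} {n} p<n x px≢0 with <°⇒Deg n p<n
    ... | inj₁ p≐0 = ⊥-elim (px≢0 (p≐0 x))
    ... | inj₂ deg = deg

  Deg-<° : ∀ {p n} → Deg p n → p <° suc n
  Deg-<° {p} {n} (mkDeg p₀ c p₀<n _ p≐) = <°-resp {q = p₀ ⊕ X ^^ n ⊗ con c}
    (λ x → trans (p≐ x) (cong (λ v → ⟦ p₀ ⟧ x + v) (ℤ.*-comm c _)))
    (<°-⊕ {p₀} (<°-weaken {p₀} (ℕ.n≤1+n n) p₀<n) (subst (X ^^ n ⊗ con c <°_) (ℕ.+-comm n 1) (<°-X^^⊗ n {con c} (<°-con c))))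

  D-fromList-<° : ∀ n l → length l ℕ.≤ suc n → D (fromList l) <° n
  D-fromList-<° n       []         len       = <°-zero n
  D-fromList-<° zero    (a ∷ [])   len       = mk<° [] z≤n eq
    where
    eq : ∀ x → 0ℤ + (1ℤ * 0ℤ + x * 0ℤ) ≡ 0ℤ
    eq = solve-∀
  D-fromList-<° zero    (a ∷ b ∷ l) (s≤s ())
  D-fromList-<° (suc n) (a ∷ l)    (s≤s len) = <°-resp {q = fromList l ⊕ X ⊗ D (fromList l)}
    (λ x → eq x (⟦ fromList l ⟧ x) (⟦ D (fromList l) ⟧ x))
    (<°-⊕ {fromList l} (mk<° l len (⟦fromList⟧ l)) (<°-X⊗ {D (fromList l)} (D-fromList-<° n l len)))
    where
    eq : ∀ x p d → 0ℤ + (1ℤ * p + x * d) ≡ p + x * d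
    eq = solve-∀

  D-<° : ∀ {p n} → p <° suc n → D p <° n
  D-<° {p} {n} (mk<° l len eq) = <°-resp {q = D (fromList l)}
    (D-cong {p} {fromList l} (λ x → trans (eq x) (sym (⟦fromList⟧ l x)))) (D-fromList-<° n l len)

  D-^^ : ∀ p n x → ⟦ D (p ^^ suc n) ⟧ x ≡ + suc n * (⟦ p ^^ n ⟧ x * ⟦ D p ⟧ x)
  D-^^ p zero    x = eq (⟦ p ⟧ x) (⟦ D p ⟧ x)
    where
    eq : ∀ p d → d * 1ℤ + p * 0ℤ ≡ 1ℤ * (1ℤ * d)
    eq = solve-∀
  D-^^ p (suc n) x = trans (cong (λ v → ⟦ D p ⟧ x * ⟦ p ^^ suc n ⟧ x + ⟦ p ⟧ x * v) (D-^^ p n x))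
    (eq (⟦ p ⟧ x) (⟦ D p ⟧ x) (⟦ p ^^ n ⟧ x) (+ suc n))
    where
    eq : ∀ p d y k → d * (p * y) + p * (k * (y * d)) ≡ (1ℤ + k) * (p * y * d)
    eq = solve-∀

  opaque
    Deg-D : ∀ {p n} → Deg p (suc n) → Deg (D p) n
    Deg-D {p} {n} (mkDeg p₀ c p₀<n c≢0 p≐) = mkDeg (D p₀) (c * + suc n) (D-<° p₀<n) (*-nonzero {c} c≢0 (λ ()))
      λ x → trans (D-cong {p} {p₀ ⊕ con c ⊗ X ^^ suc n} p≐ x) (trans
        (cong (λ v → ⟦ D p₀ ⟧ x + (0ℤ * ⟦ X ^^ suc n ⟧ x + c * v)) (D-^^ X n x)) (eq (⟦ D p₀ ⟧ x) x c (⟦ X ^^ n ⟧ x) (+ suc n)))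
      where
      eq : ∀ d x c y k → d + (0ℤ * (x * y) + c * (k * (y * 1ℤ))) ≡ d + c * k * y
      eq = solve-∀

  opaque
    Deg-0 : ∀ {p} → Deg p 0 → ∃[ c ] (c ≢ 0ℤ × p ≐ con c)
    Deg-0 (mkDeg p₀ c p₀<0 c≢0 p≐) = c , c≢0 , λ x → trans (p≐ x) (trans (cong (_+ c * 1ℤ) (<°0⇒≐0 {p₀} p₀<0 x)) (eq c))
      where
      eq : ∀ c → 0ℤ + c * 1ℤ ≡ c
      eq = solve-∀

  Deg-resp : ∀ {p q n} → p ≐ q → Deg q n → Deg p n
  Deg-resp p≐q (mkDeg q₀ c q₀<n c≢0 q≐) = mkDeg q₀ c q₀<n c≢0 λ x → trans (p≐q x) (q≐ x)

  -- Growth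

  ∣X^^∣ : ∀ n x → ∣ ⟦ X ^^ n ⟧ x ∣ ≡ ∣ x ∣ ℕ.^ n
  ∣X^^∣ zero    x = refl
  ∣X^^∣ (suc n) x = trans (ℤ.abs-* x _) (cong (∣ x ∣ ℕ.*_) (∣X^^∣ n x))

  opaque
    <°-upper : ∀ {p} n → p <° suc n → ∃[ C ] (∀ x → 1 ℕ.≤ ∣ x ∣ → ∣ ⟦ p ⟧ x ∣ ℕ.≤ C ℕ.* ∣ x ∣ ℕ.^ n)
    <°-upper {p} n p<n with <°-split {p} p<n
    <°-upper {p} zero p<1 | p₀ , a , p₀<0 , p≐ = ∣ a ∣ , λ x 1≤x → ℕ.≤-reflexive
      (trans (cong ∣_∣ (trans (p≐ x) (trans (cong (_+ a * 1ℤ) (<°0⇒≐0 {p₀} p₀<0 x)) (ℤ.+-identityˡ (a * 1ℤ))))) (ℤ.abs-* a 1ℤ))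
    <°-upper {p} (suc n) p<n | p₀ , a , p₀<n , p≐ with <°-upper {p₀} n p₀<n
    ... | C , bound = C ℕ.+ ∣ a ∣ , λ x 1≤x → begin
      ∣ ⟦ p ⟧ x ∣ ≡⟨ cong ∣_∣ (p≐ x) ⟩
      ∣ ⟦ p₀ ⟧ x + a * ⟦ X ^^ suc n ⟧ x ∣ ≤⟨ ℤ.∣i+j∣≤∣i∣+∣j∣ (⟦ p₀ ⟧ x) _ ⟩
      ∣ ⟦ p₀ ⟧ x ∣ ℕ.+ ∣ a * ⟦ X ^^ suc n ⟧ x ∣ ≡⟨ cong (∣ ⟦ p₀ ⟧ x ∣ ℕ.+_) (trans (ℤ.abs-* a _) (cong (∣ a ∣ ℕ.*_)
        (∣X^^∣ (suc n) x))) ⟩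
      ∣ ⟦ p₀ ⟧ x ∣ ℕ.+ ∣ a ∣ ℕ.* ∣ x ∣ ℕ.^ suc n ≤⟨ ℕ.+-monoˡ-≤ _ (bound x 1≤x) ⟩
      C ℕ.* ∣ x ∣ ℕ.^ n ℕ.+ ∣ a ∣ ℕ.* ∣ x ∣ ℕ.^ suc n ≤⟨ ℕ.+-monoˡ-≤ _ (ℕ.*-monoʳ-≤ C
        (ℕ.m≤n*m (∣ x ∣ ℕ.^ n) ∣ x ∣ {{ℕ.>-nonZero 1≤x}})) ⟩
      C ℕ.* ∣ x ∣ ℕ.^ suc n ℕ.+ ∣ a ∣ ℕ.* ∣ x ∣ ℕ.^ suc n ≡⟨ ℕ.*-distribʳ-+ (∣ x ∣ ℕ.^ suc n) C ∣ a ∣ ⟨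
      (C ℕ.+ ∣ a ∣) ℕ.* ∣ x ∣ ℕ.^ suc n ∎
      where open ℕ.≤-Reasoning

  nonzero⇒1≤ : ∀ {c} → c ≢ 0ℤ → 1 ℕ.≤ ∣ c ∣
  nonzero⇒1≤ {c} c≢0 = ℕ.n≢0⇒n>0 (λ c≡0 → c≢0 (ℤ.∣i∣≡0⇒i≡0 c≡0))

  opaque
    Deg-lower : ∀ {p} n → Deg p n → ∃[ x₀ ] (∀ x → x₀ ℕ.≤ ∣ x ∣ → ∣ x ∣ ℕ.^ n ℕ.≤ 2 ℕ.* ∣ ⟦ p ⟧ x ∣)
    Deg-lower {p} zero deg with Deg-0 {p} deg
    ... | c , c≢0 , p≐c = 0 , λ x _ → subst (λ v → 1 ℕ.≤ 2 ℕ.* ∣ v ∣) (sym (p≐c x)) (ℕ.≤-trans (nonzero⇒1≤ c≢0) (ℕ.m≤n*m ∣ c ∣ 2))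
    Deg-lower {p} (suc n) (mkDeg p₀ c p₀<n c≢0 p≐) with <°-upper {p₀} n p₀<n
    -- Once `∣x∣ > 2 C`, the lower terms take up at most half of `∣x∣ ^ (1 + n)`; this is the origin
    -- of the factor 2 in the conclusion.
    ... | C , bound = suc (2 ℕ.* C) , λ x x₀≤x → ℕ.+-cancelˡ-≤ (∣ x ∣ ℕ.^ suc n) _ _ (begin
      ∣ x ∣ ℕ.^ suc n ℕ.+ ∣ x ∣ ℕ.^ suc n ≡⟨ cong (∣ x ∣ ℕ.^ suc n ℕ.+_) (ℕ.+-identityʳ _) ⟨
      2 ℕ.* ∣ x ∣ ℕ.^ suc n ≤⟨ ℕ.*-monoʳ-≤ 2 (leading x) ⟩
      2 ℕ.* (∣ ⟦ p ⟧ x ∣ ℕ.+ ∣ ⟦ p₀ ⟧ x ∣) ≤⟨ ℕ.*-monoʳ-≤ 2 (ℕ.+-monoʳ-≤ ∣ ⟦ p ⟧ x ∣ (bound x (ℕ.≤-trans (s≤s z≤n) x₀≤x))) ⟩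
      2 ℕ.* (∣ ⟦ p ⟧ x ∣ ℕ.+ C ℕ.* ∣ x ∣ ℕ.^ n) ≡⟨ rearrange ∣ ⟦ p ⟧ x ∣ C (∣ x ∣ ℕ.^ n) ⟩
      2 ℕ.* C ℕ.* ∣ x ∣ ℕ.^ n ℕ.+ 2 ℕ.* ∣ ⟦ p ⟧ x ∣ ≤⟨ ℕ.+-monoˡ-≤ _ (ℕ.*-monoˡ-≤ (∣ x ∣ ℕ.^ n) (ℕ.≤-trans (ℕ.n≤1+n _) x₀≤x)) ⟩
      ∣ x ∣ ℕ.^ suc n ℕ.+ 2 ℕ.* ∣ ⟦ p ⟧ x ∣ ∎)
      where
      open ℕ.≤-Reasoning
      rearrange : ∀ a C y → 2 ℕ.* (a ℕ.+ C ℕ.* y) ≡ 2 ℕ.* C ℕ.* y ℕ.+ 2 ℕ.* a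
      rearrange = ℕSolver.solve-∀
      difference : ∀ a b → b ≡ (a + b) - a
      difference = solve-∀
      leading : ∀ x → ∣ x ∣ ℕ.^ suc n ℕ.≤ ∣ ⟦ p ⟧ x ∣ ℕ.+ ∣ ⟦ p₀ ⟧ x ∣
      leading x = begin
        ∣ x ∣ ℕ.^ suc n ≤⟨ ℕ.m≤n*m _ ∣ c ∣ {{ℕ.>-nonZero (nonzero⇒1≤ c≢0)}} ⟩
        ∣ c ∣ ℕ.* ∣ x ∣ ℕ.^ suc n ≡⟨ trans (ℤ.abs-* c _) (cong (∣ c ∣ ℕ.*_) (∣X^^∣ (suc n) x)) ⟨
        ∣ c * ⟦ X ^^ suc n ⟧ x ∣ ≡⟨ cong ∣_∣ (trans (difference (⟦ p₀ ⟧ x) _) (cong (_- ⟦ p₀ ⟧ x) (sym (p≐ x)))) ⟩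
        ∣ ⟦ p ⟧ x - ⟦ p₀ ⟧ x ∣ ≤⟨ ℤ.∣i-j∣≤∣i∣+∣j∣ (⟦ p ⟧ x) (⟦ p₀ ⟧ x) ⟩
        ∣ ⟦ p ⟧ x ∣ ℕ.+ ∣ ⟦ p₀ ⟧ x ∣ ∎

  opaque
    Deg⇒EventuallyNonzero : ∀ {p n} → Deg p n → EventuallyNonzero p
    Deg⇒EventuallyNonzero {p} {n} deg with Deg-lower {p} n deg
    ... | x₀ , lower = suc x₀ , λ x x₀<x px≡0 → ℕ.<⇒≱
      (ℕ.m^n>0 ∣ x ∣ {{ℕ.>-nonZero (ℕ.≤-trans (s≤s z≤n) x₀<x)}} n)
      (subst (λ v → ∣ x ∣ ℕ.^ n ℕ.≤ 2 ℕ.* ∣ v ∣) px≡0 (lower x (ℕ.<⇒≤ x₀<x)))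

  opaque
    EventuallyNonzero⇒Deg : ∀ {p n} → EventuallyNonzero p → p <° n → ∃[ m ] (m ℕ.< n × Deg p m)
    EventuallyNonzero⇒Deg (x₀ , nz) p<n = nonzero⇒Deg p<n (+ x₀) (nz (+ x₀) ℕ.≤-refl)

  opaque
    EventuallyNonzero⇒Deg′ : ∀ {p} → EventuallyNonzero p → ∃ (Deg p)
    EventuallyNonzero⇒Deg′ {p} nz with EventuallyNonzero⇒Deg {p} nz (<°-toList p)
    ... | m , _ , deg = m , deg

  EventuallyNonzero-⊗ : ∀ {p q} → EventuallyNonzero p → EventuallyNonzero q → EventuallyNonzero (p ⊗ q)
  EventuallyNonzero-⊗ (x₀ , p≢0) (x₁ , q≢0) = x₀ ℕ.⊔ x₁ , λ x x≥ →
    *-nonzero (p≢0 x (ℕ.m⊔n≤o⇒m≤o x₀ x₁ x≥)) (q≢0 x (ℕ.m⊔n≤o⇒n≤o x₀ x₁ x≥))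

  EventuallyNonzero-resp : ∀ {p q} → (∀ x → ⟦ p ⟧ x ≢ 0ℤ → ⟦ q ⟧ x ≢ 0ℤ) → EventuallyNonzero p → EventuallyNonzero q
  EventuallyNonzero-resp p⇒q (x₀ , p≢0) = x₀ , λ x x≥ → p⇒q x (p≢0 x x≥)

  opaque
    Deg-large : ∀ {p n} → Deg p (suc n) → ∀ b → ∃[ x₀ ] (∀ x → x₀ ℕ.≤ ∣ x ∣ → b ℕ.≤ ∣ ⟦ p ⟧ x ∣)
    Deg-large {p} {n} deg b with Deg-lower {p} (suc n) deg
    ... | x₀ , lower = suc (x₀ ℕ.+ 2 ℕ.* b) , λ x x≥ → ℕ.*-cancelˡ-≤ {b} {∣ ⟦ p ⟧ x ∣} 2 (begin
      2 ℕ.* b         ≤⟨ ℕ.≤-trans (ℕ.m≤n+m _ (suc x₀)) x≥ ⟩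
      ∣ x ∣           ≤⟨ ℕ.m≤m*n ∣ x ∣ (∣ x ∣ ℕ.^ n) {{ℕ.m^n≢0 ∣ x ∣ n {{ℕ.>-nonZero (ℕ.≤-trans (s≤s z≤n) x≥)}}}} ⟩
      ∣ x ∣ ℕ.^ suc n ≤⟨ lower x (ℕ.≤-trans (ℕ.≤-trans (ℕ.m≤m+n x₀ _) (ℕ.n≤1+n _)) x≥) ⟩
      2 ℕ.* ∣ ⟦ p ⟧ x ∣ ∎)
      where open ℕ.≤-Reasoning

  EventuallyNonzero-∘ : ∀ {p φ n} → EventuallyNonzero p → Deg φ (suc n) → EventuallyNonzero (p ∘ᴱ φ)
  EventuallyNonzero-∘ {p} {φ} (y₀ , p≢0) deg with Deg-large {φ} deg y₀
  ... | x₀ , large = x₀ , λ x x≥ → subst (_≢ 0ℤ) (sym (⟦∘ᴱ⟧ p φ x)) (p≢0 (⟦ φ ⟧ x) (large x x≥))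

  opaque
    EventuallyNonzero-D⇒Deg : ∀ {φ} → EventuallyNonzero (D φ) → ∃[ n ] Deg φ (suc n)
    EventuallyNonzero-D⇒Deg {φ} (x₀ , φ′≢0) with ≐0⊎Deg φ
    ... | inj₁ φ≐0 = ⊥-elim (φ′≢0 (+ x₀) ℕ.≤-refl (D-cong {φ} {con 0ℤ} φ≐0 (+ x₀)))
    ... | inj₂ (zero , deg) with Deg-0 {φ} deg
    ...   | c , _ , φ≐c = ⊥-elim (φ′≢0 (+ x₀) ℕ.≤-refl (D-cong {φ} {con c} φ≐c (+ x₀)))
    EventuallyNonzero-D⇒Deg {φ} (x₀ , φ′≢0) | inj₂ (suc n , deg) = n , deg

open Degrees

-- Divisibility over ℚ, squarefree parts and the Riemann-Hurwitz step

module Divisibility where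

  open import Data.Integer.Base using (+_; -_; _+_; _*_; _-_; ∣_∣)
  open import Data.Integer.Tactic.RingSolver using (solve-∀)

  -- Divisibility in ℚ[X] between polynomials with integer coefficients.
  infix 4 _∣ᴱ_
  record _∣ᴱ_ (p q : Expr) : Set where
    constructor mk∣
    field
      scale    : ℤ
      scale≢0  : scale ≢ 0ℤ
      quotient : Expr
      equation : ∀ x → scale * ⟦ q ⟧ x ≡ ⟦ p ⟧ x * ⟦ quotient ⟧ x

  record Coprime (p q : Expr) : Set where
    constructor mkCoprime
    field
      u v     : Expr
      value   : ℤ
      value≢0 : value ≢ 0ℤ
      bezout  : ∀ x → ⟦ u ⟧ x * ⟦ p ⟧ x + ⟦ v ⟧ x * ⟦ q ⟧ x ≡ value

  Squarefree : Expr → Set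
  Squarefree p = Coprime p (D p)

  eventually-≐ : ∀ p q x₀ → (∀ x → x₀ ℕ.≤ ∣ x ∣ → ⟦ p ⟧ x ≡ ⟦ q ⟧ x) → p ≐ q
  eventually-≐ p q x₀ p≡q x = ℤ.i-j≡0⇒i≡j (⟦ p ⟧ x) (⟦ q ⟧ x) (trans (minus (⟦ p ⟧ x) (⟦ q ⟧ x)) (difference≐0 x))
    where
    minus : ∀ a b → a - b ≡ a + (- 1ℤ) * b
    minus = solve-∀
    difference : Expr
    difference = p ⊕ con (- 1ℤ) ⊗ q
    difference≐0 : difference ≐ con 0ℤ
    difference≐0 x = trans (sym (eval-toList difference x)) (trans (sym (evalᴿ-ℤ (toList difference) x))
      (Evℤ.evalᴿ-vanish ℤ-embedding (toList difference) x (vanishes (toList difference) x₀ λ n x₀≤n →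
        trans (eval-toList difference (+ n)) (trans (sym (minus (⟦ p ⟧ (+ n)) (⟦ q ⟧ (+ n)))) (ℤ.i≡j⇒i-j≡0 (p≡q (+ n) x₀≤n))))))

  ∣-refl : ∀ {p} → p ∣ᴱ p
  ∣-refl {p} = mk∣ 1ℤ (λ ()) (con 1ℤ) λ x → ℤ.*-comm 1ℤ (⟦ p ⟧ x)

  ∣-trans : ∀ {p q r} → p ∣ᴱ q → q ∣ᴱ r → p ∣ᴱ r
  ∣-trans {p} {q} {r} (mk∣ k k≢0 s e) (mk∣ l l≢0 t f) = mk∣ (k * l) (*-nonzero {k} k≢0 l≢0) (s ⊗ t) λ x →
    trans (ℤ.*-assoc k l (⟦ r ⟧ x)) (trans (cong (k *_) (f x)) (trans (eq k (⟦ q ⟧ x) (⟦ t ⟧ x))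
      (trans (cong (_* ⟦ t ⟧ x) (e x)) (ℤ.*-assoc (⟦ p ⟧ x) (⟦ s ⟧ x) (⟦ t ⟧ x)))))
    where
    eq : ∀ k q t → k * (q * t) ≡ (k * q) * t
    eq = solve-∀

  ≐⇒∣ : ∀ {p q} → p ≐ q → p ∣ᴱ q
  ≐⇒∣ {p} {q} p≐q = mk∣ 1ℤ (λ ()) (con 1ℤ) λ x → trans (cong (1ℤ *_) (sym (p≐q x))) (ℤ.*-comm 1ℤ (⟦ p ⟧ x))

  scaled⇒∣ : ∀ {p q} k → k ≢ 0ℤ → (∀ x → k * ⟦ q ⟧ x ≡ ⟦ p ⟧ x) → p ∣ᴱ q
  scaled⇒∣ {p} k k≢0 e = mk∣ k k≢0 (con 1ℤ) λ x → trans (e x) (sym (ℤ.*-identityʳ (⟦ p ⟧ x)))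

  scaled⇒∣ʳ : ∀ {p q} k → (∀ x → k * ⟦ q ⟧ x ≡ ⟦ p ⟧ x) → q ∣ᴱ p
  scaled⇒∣ʳ {p} {q} k e = mk∣ 1ℤ (λ ()) (con k) λ x → trans (ℤ.*-identityˡ (⟦ p ⟧ x)) (trans (sym (e x)) (ℤ.*-comm k (⟦ q ⟧ x)))

  ∣-⊗ʳ : ∀ {p q} r → p ∣ᴱ q → p ∣ᴱ q ⊗ r
  ∣-⊗ʳ {p} {q} r (mk∣ k k≢0 s e) = mk∣ k k≢0 (s ⊗ r) λ x → trans (sym (ℤ.*-assoc k (⟦ q ⟧ x) (⟦ r ⟧ x)))
    (trans (cong (_* ⟦ r ⟧ x) (e x)) (ℤ.*-assoc (⟦ p ⟧ x) (⟦ s ⟧ x) (⟦ r ⟧ x)))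

  ⊗-comm-∣ : ∀ p q → p ⊗ q ∣ᴱ q ⊗ p
  ⊗-comm-∣ p q = ≐⇒∣ λ x → ℤ.*-comm (⟦ p ⟧ x) (⟦ q ⟧ x)

  ∣-⊗ˡ : ∀ {p q} r → p ∣ᴱ q → p ∣ᴱ r ⊗ q
  ∣-⊗ˡ {q = q} r p∣q = ∣-trans (∣-⊗ʳ r p∣q) (⊗-comm-∣ q r)

  p∣p⊗q : ∀ p q → p ∣ᴱ p ⊗ q
  p∣p⊗q p q = ∣-⊗ʳ q ∣-refl

  q∣p⊗q : ∀ p q → q ∣ᴱ p ⊗ q
  q∣p⊗q p q = ∣-⊗ˡ p ∣-refl

  1∣ : ∀ p → con 1ℤ ∣ᴱ p
  1∣ p = mk∣ 1ℤ (λ ()) p λ x → refl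

  ∣-⊕ : ∀ {p q r} → p ∣ᴱ q → p ∣ᴱ r → p ∣ᴱ q ⊕ r
  ∣-⊕ {p} {q} {r} (mk∣ k k≢0 s e) (mk∣ l l≢0 t f) = mk∣ (k * l) (*-nonzero {k} k≢0 l≢0) (con l ⊗ s ⊕ con k ⊗ t) λ x →
    trans (eq k l (⟦ q ⟧ x) (⟦ r ⟧ x)) (trans (cong₂ (λ u v → l * u + k * v) (e x) (f x)) (eq′ k l (⟦ p ⟧ x) (⟦ s ⟧ x) (⟦ t ⟧ x)))
    where
    eq : ∀ k l q r → k * l * (q + r) ≡ l * (k * q) + k * (l * r)
    eq = solve-∀
    eq′ : ∀ k l p s t → l * (p * s) + k * (p * t) ≡ p * (l * s + k * t)
    eq′ = solve-∀

  ⊗-mono-∣ : ∀ {p q r s} → p ∣ᴱ q → r ∣ᴱ s → p ⊗ r ∣ᴱ q ⊗ s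
  ⊗-mono-∣ {p} {q} {r} {s} (mk∣ k k≢0 t e) (mk∣ l l≢0 u f) = mk∣ (k * l) (*-nonzero {k} k≢0 l≢0) (t ⊗ u) λ x →
    trans (exchange k l (⟦ q ⟧ x) (⟦ s ⟧ x)) (trans (cong₂ _*_ (e x) (f x)) (exchange (⟦ p ⟧ x) (⟦ t ⟧ x) (⟦ r ⟧ x) (⟦ u ⟧ x)))
    where
    exchange : ∀ a b c d → a * b * (c * d) ≡ (a * c) * (b * d)
    exchange = solve-∀

  ^^-mono-∣ : ∀ {p q} n → p ∣ᴱ q → p ^^ n ∣ᴱ q ^^ n
  ^^-mono-∣ zero    p∣q = ∣-refl
  ^^-mono-∣ (suc n) p∣q = ⊗-mono-∣ p∣q (^^-mono-∣ n p∣q)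

  ∘-mono-∣ : ∀ {p q} φ → p ∣ᴱ q → p ∘ᴱ φ ∣ᴱ q ∘ᴱ φ
  ∘-mono-∣ {p} {q} φ (mk∣ k k≢0 r e) = mk∣ k k≢0 (r ∘ᴱ φ) λ x →
    trans (cong (k *_) (⟦∘ᴱ⟧ q φ x)) (trans (e (⟦ φ ⟧ x)) (sym (cong₂ _*_ (⟦∘ᴱ⟧ p φ x) (⟦∘ᴱ⟧ r φ x))))

  ^^-+ : ∀ p m n x → ⟦ p ^^ (m ℕ.+ n) ⟧ x ≡ ⟦ p ^^ m ⟧ x * ⟦ p ^^ n ⟧ x
  ^^-+ p zero    n x = sym (ℤ.*-identityˡ (⟦ p ^^ n ⟧ x))
  ^^-+ p (suc m) n x = trans (cong (⟦ p ⟧ x *_) (^^-+ p m n x)) (sym (ℤ.*-assoc (⟦ p ⟧ x) (⟦ p ^^ m ⟧ x) (⟦ p ^^ n ⟧ x)))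

  ^^-*-∣ : ∀ p m n → (p ^^ m) ^^ n ∣ᴱ p ^^ (n ℕ.* m)
  ^^-*-∣ p m zero    = ∣-refl
  ^^-*-∣ p m (suc n) = ∣-trans (⊗-mono-∣ {p ^^ m} ∣-refl (^^-*-∣ p m n)) (≐⇒∣ λ x → sym (^^-+ p m (n ℕ.* m) x))

  ∣-^^-trans : ∀ {p q r} m n → p ∣ᴱ q ^^ m → q ∣ᴱ r ^^ n → p ∣ᴱ r ^^ (m ℕ.* n)
  ∣-^^-trans {r = r} m n p∣q^m q∣r^n = ∣-trans p∣q^m (∣-trans (^^-mono-∣ m q∣r^n) (^^-*-∣ r n m))

  ∣-^¹ : ∀ {p q} → p ∣ᴱ q → p ∣ᴱ q ^^ 1
  ∣-^¹ p∣q = ∣-⊗ʳ (con 1ℤ) p∣q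

  opaque
    ∣-EventuallyNonzero : ∀ {p q} → p ∣ᴱ q → EventuallyNonzero q → EventuallyNonzero p
    ∣-EventuallyNonzero {p} {q} (mk∣ k k≢0 r e) = EventuallyNonzero-resp λ x qx≢0 px≡0 →
      *-nonzero k≢0 qx≢0 (trans (e x) (trans (cong (_* ⟦ r ⟧ x) px≡0) (ℤ.*-zeroˡ (⟦ r ⟧ x))))

  ^^-EventuallyNonzero : ∀ {p} n → EventuallyNonzero p → EventuallyNonzero (p ^^ n)
  ^^-EventuallyNonzero zero    p≢0 = 0 , λ x _ ()
  ^^-EventuallyNonzero (suc n) p≢0 = EventuallyNonzero-⊗ p≢0 (^^-EventuallyNonzero n p≢0)

  Coprime-sym : ∀ {p q} → Coprime p q → Coprime q p
  Coprime-sym {p} {q} (mkCoprime u v k k≢0 e) = mkCoprime v u k k≢0 λ x → trans (ℤ.+-comm (⟦ v ⟧ x * ⟦ q ⟧ x)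
    (⟦ u ⟧ x * ⟦ p ⟧ x)) (e x)

  Coprime-1 : ∀ p → Coprime p (con 1ℤ)
  Coprime-1 p = mkCoprime (con 0ℤ) (con 1ℤ) 1ℤ (λ ()) λ x → cong (_+ 1ℤ) (ℤ.*-zeroˡ (⟦ p ⟧ x))

  Coprime-⊗ : ∀ {p q r} → Coprime p q → Coprime p r → Coprime p (q ⊗ r)
  Coprime-⊗ {p} {q} {r} (mkCoprime u v k k≢0 e) (mkCoprime u′ v′ k′ k′≢0 e′) =
    mkCoprime (u ⊗ u′ ⊗ p ⊕ u ⊗ v′ ⊗ r ⊕ v ⊗ q ⊗ u′) (v ⊗ v′) (k * k′) (*-nonzero {k} k≢0 k′≢0) λ x →
      trans (expand (⟦ p ⟧ x) (⟦ q ⟧ x) (⟦ r ⟧ x) (⟦ u ⟧ x) (⟦ v ⟧ x) (⟦ u′ ⟧ x) (⟦ v′ ⟧ x)) (cong₂ _*_ (e x) (e′ x))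
    where
    expand : ∀ p q r u v s t → (u * s * p + u * t * r + v * q * s) * p + v * t * (q * r) ≡ (u * p + v * q) * (s * p + t * r)
    expand = solve-∀

  Coprime-^^ : ∀ {p q} n → Coprime p q → Coprime p (q ^^ n)
  Coprime-^^ {p} zero    c = Coprime-1 p
  Coprime-^^     (suc n) c = Coprime-⊗ c (Coprime-^^ n c)

  Coprime-∣ˡ : ∀ {p q r} → r ∣ᴱ p → Coprime p q → Coprime r q
  Coprime-∣ˡ {p} {q} {r} (mk∣ l l≢0 s f) (mkCoprime u v k k≢0 e) = mkCoprime (u ⊗ s) (con l ⊗ v) (l * k)
    (*-nonzero {l} l≢0 k≢0) λ x →
    trans (cong (λ t → t + l * ⟦ v ⟧ x * ⟦ q ⟧ x) (trans (swap (⟦ u ⟧ x) (⟦ s ⟧ x) (⟦ r ⟧ x)) (cong (⟦ u ⟧ x *_) (sym (f x)))))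
      (trans (factor l (⟦ u ⟧ x) (⟦ p ⟧ x) (⟦ v ⟧ x) (⟦ q ⟧ x)) (cong (l *_) (e x)))
    where
    swap : ∀ u s r → u * s * r ≡ u * (r * s)
    swap = solve-∀
    factor : ∀ l u p v q → u * (l * p) + l * v * q ≡ l * (u * p + v * q)
    factor = solve-∀

  Coprime-∣ʳ : ∀ {p q r} → r ∣ᴱ q → Coprime p q → Coprime p r
  Coprime-∣ʳ r∣q c = Coprime-sym (Coprime-∣ˡ r∣q (Coprime-sym c))

  gauss : ∀ {p q r} → Coprime p q → p ∣ᴱ q ⊗ r → p ∣ᴱ r
  gauss {p} {q} {r} (mkCoprime u v k k≢0 e) (mk∣ l l≢0 s f) = mk∣ (l * k) (*-nonzero {l} l≢0 k≢0) (con l ⊗ u ⊗ r ⊕ v ⊗ s) λ x →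
    trans (cong (λ t → l * t * ⟦ r ⟧ x) (sym (e x))) (trans (expand l (⟦ u ⟧ x) (⟦ p ⟧ x) (⟦ v ⟧ x) (⟦ q ⟧ x) (⟦ r ⟧ x))
      (trans (cong (λ t → l * ⟦ u ⟧ x * ⟦ r ⟧ x * ⟦ p ⟧ x + ⟦ v ⟧ x * t) (f x)) (factor l (⟦ u ⟧ x) (⟦ p ⟧ x)
          (⟦ v ⟧ x) (⟦ r ⟧ x) (⟦ s ⟧ x))))
    where
    expand : ∀ l u p v q r → l * (u * p + v * q) * r ≡ l * u * r * p + v * (l * (q * r))
    expand = solve-∀
    factor : ∀ l u p v r s → l * u * r * p + v * (p * s) ≡ p * (l * u * r + v * s)
    factor = solve-∀

  coprime-divisor : ∀ {p q} → Coprime p q → p ∣ᴱ q → p ∣ᴱ con 1ℤ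
  coprime-divisor {p} {q} c p∣q = gauss c (∣-⊗ʳ (con 1ℤ) p∣q)

  -- Euclid's algorithm

  opaque
    pseudo-division : ∀ {q m} → Deg q m → ∀ j {p} → p <° m ℕ.+ j →
                      ∃[ k ] ∃[ s ] ∃[ r ] (k ≢ 0ℤ × r <° m × (∀ x → k * ⟦ p ⟧ x ≡ ⟦ q ⟧ x * ⟦ s ⟧ x + ⟦ r ⟧ x))
    pseudo-division {q} {m} deg zero {p} p<m = 1ℤ , con 0ℤ , p , (λ ()) , subst (p <°_) (ℕ.+-identityʳ m) p<m ,
      λ x → trans (ℤ.*-identityˡ (⟦ p ⟧ x)) (sym (trans (cong (_+ ⟦ p ⟧ x) (ℤ.*-zeroʳ (⟦ q ⟧ x))) (ℤ.+-identityˡ (⟦ p ⟧ x))))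
    pseudo-division {q} {m} deg@(mkDeg q₀ c q₀<m c≢0 q≐) (suc j) {p} p<m+j with <°-split {n = m ℕ.+ j} (subst (p <°_) (ℕ.+-suc m j) p<m+j)
    ... | p₀ , a , p₀<m+j , p≐ with pseudo-division deg j {con c ⊗ p₀ ⊕ con (- a) ⊗ (X ^^ j ⊗ q₀)}
            (<°-⊕ (<°-scale c p₀<m+j) (<°-scale (- a) (subst (X ^^ j ⊗ q₀ <°_) (ℕ.+-comm j m) (<°-X^^⊗ j q₀<m))))
    ...   | k , s , r , k≢0 , r<m , e = k * c , s ⊕ con (k * a) ⊗ X ^^ j , r , *-nonzero {k} k≢0 c≢0 , r<m , λ x → (begin
      k * c * ⟦ p ⟧ x ≡⟨ cong (λ t → k * c * t) (trans (p≐ x) (cong (λ t → ⟦ p₀ ⟧ x + a * t) (^^-+ X m j x))) ⟩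
      k * c * (⟦ p₀ ⟧ x + a * (⟦ X ^^ m ⟧ x * ⟦ X ^^ j ⟧ x)) ≡⟨ rearrange k c a (⟦ p₀ ⟧ x) (⟦ q₀ ⟧ x) (⟦ X ^^ m ⟧ x) (⟦ X ^^ j ⟧ x) ⟩
      k * (c * ⟦ p₀ ⟧ x + (- a) * (⟦ X ^^ j ⟧ x * ⟦ q₀ ⟧ x)) + (⟦ q₀ ⟧ x + c * ⟦ X ^^ m ⟧ x) * (k * a * ⟦ X ^^ j ⟧ x)
        ≡⟨ cong₂ (λ t y → t + y * (k * a * ⟦ X ^^ j ⟧ x)) (e x) (sym (q≐ x)) ⟩
      (⟦ q ⟧ x * ⟦ s ⟧ x + ⟦ r ⟧ x) + ⟦ q ⟧ x * (k * a * ⟦ X ^^ j ⟧ x) ≡⟨ collect (⟦ q ⟧ x) (⟦ s ⟧ x) (⟦ r ⟧ x) (k * a * ⟦ X ^^ j ⟧ x) ⟩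
      ⟦ q ⟧ x * (⟦ s ⟧ x + k * a * ⟦ X ^^ j ⟧ x) + ⟦ r ⟧ x ∎)
      where
      open ≡-Reasoning
      rearrange : ∀ k c a p q y z → k * c * (p + a * (y * z)) ≡ k * (c * p + (- a) * (z * q)) + (q + c * y) * (k * a * z)
      rearrange = solve-∀
      collect : ∀ q s r t → (q * s + r) + q * t ≡ q * (s + t) + r
      collect = solve-∀

  record GCD (p q : Expr) : Set where
    constructor mkGCD
    field
      g       : Expr
      g∣p     : g ∣ᴱ p
      g∣q     : g ∣ᴱ q
      u v     : Expr
      k       : ℤ
      k≢0     : k ≢ 0ℤ
      bezout  : ∀ x → k * ⟦ g ⟧ x ≡ ⟦ u ⟧ x * ⟦ p ⟧ x + ⟦ v ⟧ x * ⟦ q ⟧ x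

  opaque
    gcd-zero : ∀ p {q} → q ≐ con 0ℤ → GCD p q
    gcd-zero p {q} q≐0 = mkGCD p ∣-refl (mk∣ 1ℤ (λ ()) (con 0ℤ) λ x → trans (cong (1ℤ *_) (q≐0 x)) (sym (ℤ.*-zeroʳ (⟦ p ⟧ x))))
      (con 1ℤ) (con 0ℤ) 1ℤ (λ ()) λ x → sym (trans (cong (λ t → 1ℤ * ⟦ p ⟧ x + t) (ℤ.*-zeroˡ (⟦ q ⟧ x)))
          (ℤ.+-identityʳ (1ℤ * ⟦ p ⟧ x)))

  opaque
    gcd-bounded : ∀ n p {q} → q <° n → GCD p q
    gcd-bounded zero    p {q} q<0 = gcd-zero p (<°0⇒≐0 q<0)
    gcd-bounded (suc n) p {q} q<n with <°⇒Deg (suc n) q<n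
    ... | inj₁ q≐0 = gcd-zero p q≐0
    ... | inj₂ (m , s≤s m≤n , deg) with pseudo-division deg (length (toList p)) {p} (<°-weaken (ℕ.m≤n+m _ m) (<°-toList p))
    ...   | l , s , r , l≢0 , r<m , e with gcd-bounded n q (<°-weaken m≤n r<m)
    ...     | mkGCD g g∣q g∣r u v k k≢0 b = mkGCD g (∣-trans (∣-⊕ (∣-⊗ʳ s g∣q) g∣r) (scaled⇒∣ l l≢0 e)) g∣q
      (con l ⊗ v) (u ⊕ con (- 1ℤ) ⊗ v ⊗ s) k k≢0 λ x → trans (b x) (trans
        (cong (λ t → ⟦ u ⟧ x * ⟦ q ⟧ x + ⟦ v ⟧ x * t) (trans (difference (⟦ q ⟧ x * ⟦ s ⟧ x) (⟦ r ⟧ x))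
            (cong (_- ⟦ q ⟧ x * ⟦ s ⟧ x) (sym (e x)))))
        (rearrange (⟦ u ⟧ x) (⟦ q ⟧ x) (⟦ v ⟧ x) l (⟦ p ⟧ x) (⟦ s ⟧ x)))
      where
      difference : ∀ a r → r ≡ (a + r) - a
      difference = solve-∀
      rearrange : ∀ u q v l p s → u * q + v * (l * p - q * s) ≡ l * v * p + (u + (- 1ℤ) * v * s) * q
      rearrange = solve-∀

  opaque
    gcdᴱ : ∀ p q → GCD p q
    gcdᴱ p q = gcd-bounded _ p (<°-toList q)

  record Factorisation (p q : Expr) : Set where
    constructor mkFactorisation
    field
      g p₁ q₁ : Expr
      k l     : ℤ
      k≢0     : k ≢ 0ℤ
      l≢0     : l ≢ 0ℤ
      p≐      : ∀ x → k * ⟦ p ⟧ x ≡ ⟦ g ⟧ x * ⟦ p₁ ⟧ x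
      q≐      : ∀ x → l * ⟦ q ⟧ x ≡ ⟦ g ⟧ x * ⟦ q₁ ⟧ x
      coprime : Coprime p₁ q₁

    p∣g⊗p₁ : p ∣ᴱ g ⊗ p₁
    p∣g⊗p₁ = scaled⇒∣ʳ k p≐
    g⊗p₁∣p : g ⊗ p₁ ∣ᴱ p
    g⊗p₁∣p = scaled⇒∣ k k≢0 p≐
    q∣g⊗q₁ : q ∣ᴱ g ⊗ q₁
    q∣g⊗q₁ = scaled⇒∣ʳ l q≐
    g⊗q₁∣q : g ⊗ q₁ ∣ᴱ q
    g⊗q₁∣q = scaled⇒∣ l l≢0 q≐
    g∣p : g ∣ᴱ p
    g∣p = mk∣ k k≢0 p₁ p≐
    g∣q : g ∣ᴱ q
    g∣q = mk∣ l l≢0 q₁ q≐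

  opaque
    factorise : ∀ p q → EventuallyNonzero p → Factorisation p q
    factorise p q p≢0 with gcdᴱ p q
    ... | mkGCD g g∣p@(mk∣ k k≢0 p₁ p≐) (mk∣ l l≢0 q₁ q≐) u v m m≢0 b with ∣-EventuallyNonzero g∣p p≢0
    ...   | x₀ , g≢0 = mkFactorisation g p₁ q₁ k l k≢0 l≢0 p≐ q≐ (mkCoprime (con l ⊗ u) (con k ⊗ v) (k * l * m) (*-nonzero {k * l} (*-nonzero {k} k≢0 l≢0) m≢0)
      -- Bézout's identity for `g` is divided by `g` where `g` does not vanish; polynomials that
      -- agree for all large arguments agree everywhere.
      (eventually-≐ (con l ⊗ u ⊗ p₁ ⊕ con k ⊗ v ⊗ q₁) (con (k * l * m)) x₀ λ x x≥ →
        *-cancelˡ (⟦ g ⟧ x) (l * ⟦ u ⟧ x * ⟦ p₁ ⟧ x + k * ⟦ v ⟧ x * ⟦ q₁ ⟧ x) (k * l * m) (g≢0 x x≥)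
          (trans (expand (⟦ g ⟧ x) l (⟦ u ⟧ x) (⟦ p₁ ⟧ x) k (⟦ v ⟧ x) (⟦ q₁ ⟧ x))
            (trans (cong₂ (λ s t → l * ⟦ u ⟧ x * s + k * ⟦ v ⟧ x * t) (sym (p≐ x)) (sym (q≐ x)))
              (trans (factor l (⟦ u ⟧ x) k (⟦ p ⟧ x) (⟦ v ⟧ x) (⟦ q ⟧ x)) (trans (cong (λ t → k * l * t) (sym (b x)))
                  (shuffle k l m (⟦ g ⟧ x))))))))
      where
      expand : ∀ g l u p k v q → g * (l * u * p + k * v * q) ≡ l * u * (g * p) + k * v * (g * q)
      expand = solve-∀
      factor : ∀ l u k p v q → l * u * (k * p) + k * v * (l * q) ≡ k * l * (u * p + v * q)
      factor = solve-∀
      shuffle : ∀ k l m g → k * l * (m * g) ≡ g * (k * l * m)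
      shuffle = solve-∀

  -- Squarefree polynomials

  opaque
    Squarefree⇒EventuallyNonzero : ∀ {s} → Squarefree s → EventuallyNonzero s
    Squarefree⇒EventuallyNonzero {s} (mkCoprime u v k k≢0 e) with ≐0⊎Deg s
    ... | inj₁ s≐0 = ⊥-elim (k≢0 (trans (sym (e 0ℤ)) (trans
      (cong₂ (λ a b → ⟦ u ⟧ 0ℤ * a + ⟦ v ⟧ 0ℤ * b) (s≐0 0ℤ) (D-cong {s} {con 0ℤ} s≐0 0ℤ)) (eq (⟦ u ⟧ 0ℤ) (⟦ v ⟧ 0ℤ)))))
      where
      eq : ∀ u v → u * 0ℤ + v * 0ℤ ≡ 0ℤ
      eq = solve-∀
    ... | inj₂ (_ , deg) = Deg⇒EventuallyNonzero deg

  D-scaled-product : ∀ {p g h} k → (∀ x → k * ⟦ p ⟧ x ≡ ⟦ g ⟧ x * ⟦ h ⟧ x) →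
                     ∀ x → k * ⟦ D p ⟧ x ≡ ⟦ D g ⟧ x * ⟦ h ⟧ x + ⟦ g ⟧ x * ⟦ D h ⟧ x
  D-scaled-product {p} {g} {h} k e x = trans (eq k (⟦ p ⟧ x) (⟦ D p ⟧ x)) (D-cong {con k ⊗ p} {g ⊗ h} e x)
    where
    eq : ∀ k p d → k * d ≡ 0ℤ * p + k * d
    eq = solve-∀

  -- By the product rule, `u s + v s′` becomes a combination of `g` and `h` once `s` is replaced by
  -- `g h`.
  squarefree-factors-coprime : ∀ {s g h} → Squarefree s → ∀ k → k ≢ 0ℤ → (∀ x → k * ⟦ s ⟧ x ≡ ⟦ g ⟧ x * ⟦ h ⟧ x) → Coprime g h
  squarefree-factors-coprime {s} {g} {h} (mkCoprime u v c c≢0 b) k k≢0 e =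
    mkCoprime (v ⊗ D h) (u ⊗ g ⊕ v ⊗ D g) (k * c) (*-nonzero {k} k≢0 c≢0) λ x →
      trans (collect (⟦ v ⟧ x) (⟦ D h ⟧ x) (⟦ g ⟧ x) (⟦ u ⟧ x) (⟦ D g ⟧ x) (⟦ h ⟧ x))
        (trans (cong₂ (λ a b → ⟦ u ⟧ x * a + ⟦ v ⟧ x * b) (sym (e x)) (sym (D-scaled-product {s} {g} {h} k e x)))
          (trans (factor k (⟦ u ⟧ x) (⟦ s ⟧ x) (⟦ v ⟧ x) (⟦ D s ⟧ x)) (cong (k *_) (b x))))
    where
    collect : ∀ v h′ g u g′ h → v * h′ * g + (u * g + v * g′) * h ≡ u * (g * h) + v * (g′ * h + g * h′)
    collect = solve-∀
    factor : ∀ k u s v d → u * (k * s) + v * (k * d) ≡ k * (u * s + v * d)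
    factor = solve-∀

  opaque
    -- Split off `g = gcd (s, p)`. The cofactor of `s` is coprime to `g`, as `s` is squarefree, and
    -- to the cofactor of `p`, hence to `pⁿ`; it also divides `pⁿ`, so it is constant.
    squarefree-∣-^^ : ∀ {s p} → Squarefree s → ∀ n → s ∣ᴱ p ^^ n → s ∣ᴱ p
    squarefree-∣-^^ {s} {p} sf n s∣pⁿ = ∣-trans p∣g⊗p₁ (∣-trans (⊗-mono-∣ {g} ∣-refl s₁∣1)
      (∣-trans (⊗-comm-∣ g (con 1ℤ)) (∣-trans (≐⇒∣ λ x → ℤ.*-identityˡ (⟦ g ⟧ x)) g∣q)))
      where
      open Factorisation (factorise s p (Squarefree⇒EventuallyNonzero sf))
      s₁∣1 : p₁ ∣ᴱ con 1ℤ
      s₁∣1 = coprime-divisor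
        (Coprime-^^ n (Coprime-∣ʳ q∣g⊗q₁ (Coprime-⊗ (Coprime-sym (squarefree-factors-coprime {s} {g} {p₁} sf k k≢0 p≐)) coprime)))
        (∣-trans (q∣p⊗q g p₁) (∣-trans g⊗p₁∣p s∣pⁿ))

  -- If p divides p′h, then p divides every p⁽ʲ⁾hʲ, the last of which is a constant multiple of a power of h.
  ∣-D-step : ∀ {p h a j} → p ∣ᴱ D p ⊗ h → p ∣ᴱ a ⊗ h ^^ j → p ∣ᴱ D a ⊗ h ^^ suc j
  ∣-D-step {p} {h} {a} {j} (mk∣ l l≢0 w f) (mk∣ k k≢0 m e) =
    mk∣ (l * k) (*-nonzero {l} l≢0 k≢0) (w ⊗ m ⊕ con l ⊗ D m ⊗ h ⊕ con (- l) ⊗ con (+ j) ⊗ m ⊗ D h) λ x →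
      cancel-power x (⟦ D a ⟧ x) (⟦ h ⟧ x) (⟦ p ⟧ x) (⟦ D p ⟧ x) (⟦ m ⟧ x) (⟦ D m ⟧ x) (⟦ w ⟧ x) (⟦ D h ⟧ x) (⟦ a ⟧ x) (⟦ h ^^ j ⟧ x)
        (⟦ D (h ^^ j) ⟧ x) (e x) (f x) (D-scaled-product {a ⊗ h ^^ j} {p} {m} k e x) (power x j)
    where
    open ≡-Reasoning
    power : ∀ x j → ⟦ h ⟧ x * ⟦ D (h ^^ j) ⟧ x ≡ + j * (⟦ h ^^ j ⟧ x * ⟦ D h ⟧ x)
    power x zero    = trans (ℤ.*-zeroʳ (⟦ h ⟧ x)) (sym (ℤ.*-zeroˡ (1ℤ * ⟦ D h ⟧ x)))
    power x (suc j) = trans (cong (⟦ h ⟧ x *_) (D-^^ h j x)) (eq (⟦ h ⟧ x) (+ suc j) (⟦ h ^^ j ⟧ x) (⟦ D h ⟧ x))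
      where
      eq : ∀ h k y d → h * (k * (y * d)) ≡ k * (h * y * d)
      eq = solve-∀
    cancel-power : ∀ x a′ h p p′ m m′ w h′ a y y′ → k * (a * y) ≡ p * m → l * (p′ * h) ≡ p * w →
      k * (a′ * y + a * y′) ≡ p′ * m + p * m′ →
                   h * y′ ≡ + j * (y * h′) → l * k * (a′ * (h * y)) ≡ p * (w * m + l * m′ * h + (- l) * + j * m * h′)
    cancel-power x a′ h p p′ m m′ w h′ a y y′ e f d z = begin
      l * k * (a′ * (h * y)) ≡⟨ e₁ l k a′ h y a y′ ⟩
      l * h * (k * (a′ * y + a * y′)) - l * k * a * (h * y′) ≡⟨ cong₂ (λ s t → l * h * s - l * k * a * t) d z ⟩
      l * h * (p′ * m + p * m′) - l * k * a * (+ j * (y * h′)) ≡⟨ e₂ l h p′ m p m′ k a (+ j) y h′ ⟩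
      (l * (p′ * h)) * m + l * h * p * m′ - l * + j * h′ * (k * (a * y)) ≡⟨ cong₂
          (λ s t → s * m + l * h * p * m′ - l * + j * h′ * t) f e ⟩
      (p * w) * m + l * h * p * m′ - l * + j * h′ * (p * m) ≡⟨ e₃ l h p m m′ w (+ j) h′ ⟩
      p * (w * m + l * m′ * h + (- l) * + j * m * h′) ∎
      where
      e₁ : ∀ l k a′ h y a y′ → l * k * (a′ * (h * y)) ≡ l * h * (k * (a′ * y + a * y′)) - l * k * a * (h * y′)
      e₁ = solve-∀
      e₂ : ∀ l h p′ m p m′ k a j y h′ →
        l * h * (p′ * m + p * m′) - l * k * a * (j * (y * h′)) ≡ (l * (p′ * h)) * m + l * h * p * m′ - l * j * h′ * (k * (a * y))
      e₂ = solve-∀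
      e₃ : ∀ l h p m m′ w j h′ → (p * w) * m + l * h * p * m′ - l * j * h′ * (p * m) ≡ p * (w * m + l * m′ * h + (- l) * j * m * h′)
      e₃ = solve-∀

  opaque
    ∣D⊗⇒∣^^-Deg : ∀ {p h} → p ∣ᴱ D p ⊗ h → ∀ n {a} j → Deg a n → p ∣ᴱ a ⊗ h ^^ j → p ∣ᴱ h ^^ (n ℕ.+ j)
    ∣D⊗⇒∣^^-Deg {p} {h} p∣p′h zero {a} j deg p∣ah^j with Deg-0 deg
    ... | c , c≢0 , a≐c = ∣-trans p∣ah^j (scaled⇒∣ c c≢0 λ x → cong (_* ⟦ h ^^ j ⟧ x) (sym (a≐c x)))
    ∣D⊗⇒∣^^-Deg {p} {h} p∣p′h (suc n) {a} j deg p∣ah^j = subst (λ i → p ∣ᴱ h ^^ i) (ℕ.+-suc n j)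
      (∣D⊗⇒∣^^-Deg p∣p′h n (suc j) (Deg-D deg) (∣-D-step {p} {h} {a} {j} p∣p′h p∣ah^j))

  opaque
    -- At each root of `p` the derivative vanishes to lower order than `p`, so `h` must vanish there
    -- too. This is that argument carried out without roots.
    ∣D⊗⇒∣^^ : ∀ {p h} → EventuallyNonzero p → p ∣ᴱ D p ⊗ h → ∃[ n ] p ∣ᴱ h ^^ n
    ∣D⊗⇒∣^^ {p} p≢0 p∣p′h with EventuallyNonzero⇒Deg′ p≢0
    ... | n , deg = n ℕ.+ 0 , ∣D⊗⇒∣^^-Deg p∣p′h n 0 deg (p∣p⊗q p (con 1ℤ))

  opaque
    Deg-⊗ : ∀ {p q m n} → Deg p m → Deg q n → Deg (p ⊗ q) (m ℕ.+ n)
    Deg-⊗ {p} {q} {m} {n} degp@(mkDeg p₀ c p₀<m c≢0 p≐) (mkDeg q₀ d q₀<n d≢0 q≐) =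
      mkDeg (p ⊗ q₀ ⊕ X ^^ n ⊗ (con d ⊗ p₀)) (c * d) rest (*-nonzero {c} c≢0 d≢0) λ x → (begin
        ⟦ p ⟧ x * ⟦ q ⟧ x ≡⟨ cong (⟦ p ⟧ x *_) (q≐ x) ⟩
        ⟦ p ⟧ x * (⟦ q₀ ⟧ x + d * ⟦ X ^^ n ⟧ x) ≡⟨ distrib (⟦ p ⟧ x) (⟦ q₀ ⟧ x) d (⟦ X ^^ n ⟧ x) ⟩
        ⟦ p ⟧ x * ⟦ q₀ ⟧ x + ⟦ p ⟧ x * d * ⟦ X ^^ n ⟧ x ≡⟨ cong (λ t → ⟦ p ⟧ x * ⟦ q₀ ⟧ x + t * d * ⟦ X ^^ n ⟧ x) (p≐ x) ⟩
        ⟦ p ⟧ x * ⟦ q₀ ⟧ x + (⟦ p₀ ⟧ x + c * ⟦ X ^^ m ⟧ x) * d * ⟦ X ^^ n ⟧ x ≡⟨ rearrange (⟦ p ⟧ x * ⟦ q₀ ⟧ x) (⟦ p₀ ⟧ x) c d (⟦ X ^^ m ⟧ x) (⟦ X ^^ n ⟧ x) ⟩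
        (⟦ p ⟧ x * ⟦ q₀ ⟧ x + ⟦ X ^^ n ⟧ x * (d * ⟦ p₀ ⟧ x)) + c * d * (⟦ X ^^ m ⟧ x * ⟦ X ^^ n ⟧ x) ≡⟨ cong
            (λ t → (⟦ p ⟧ x * ⟦ q₀ ⟧ x + ⟦ X ^^ n ⟧ x * (d * ⟦ p₀ ⟧ x)) + c * d * t) (sym (^^-+ X m n x)) ⟩
        (⟦ p ⟧ x * ⟦ q₀ ⟧ x + ⟦ X ^^ n ⟧ x * (d * ⟦ p₀ ⟧ x)) + c * d * ⟦ X ^^ (m ℕ.+ n) ⟧ x ∎)
      where
      open ≡-Reasoning
      distrib : ∀ p q d y → p * (q + d * y) ≡ p * q + p * d * y
      distrib = solve-∀
      rearrange : ∀ t p c d y z → t + (p + c * y) * d * z ≡ (t + z * (d * p)) + c * d * (y * z)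
      rearrange = solve-∀
      p⊗q₀ : p ⊗ q₀ <° m ℕ.+ n
      p⊗q₀ = <°-resp {q = p₀ ⊗ q₀ ⊕ X ^^ m ⊗ (con c ⊗ q₀)} (λ x → trans (cong (_* ⟦ q₀ ⟧ x) (p≐ x)) (eq (⟦ p₀ ⟧ x) c
        (⟦ X ^^ m ⟧ x) (⟦ q₀ ⟧ x)))
        (<°-⊕ (<°-⊗ p₀<m q₀<n) (<°-X^^⊗ m (<°-scale c q₀<n)))
        where
        eq : ∀ p c y q → (p + c * y) * q ≡ p * q + y * (c * q)
        eq = solve-∀
      rest : p ⊗ q₀ ⊕ X ^^ n ⊗ (con d ⊗ p₀) <° m ℕ.+ n
      rest = <°-⊕ p⊗q₀ (subst (X ^^ n ⊗ (con d ⊗ p₀) <°_) (ℕ.+-comm n m) (<°-X^^⊗ n (<°-scale d p₀<m)))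

  Deg-scale : ∀ {k p n} → k ≢ 0ℤ → Deg p n → Deg (con k ⊗ p) n
  Deg-scale {k} {p} {n} k≢0 (mkDeg p₀ c p₀<n c≢0 eq) = mkDeg (con k ⊗ p₀) (k * c) (<°-scale k p₀<n) (*-nonzero {k} k≢0 c≢0)
    λ x → trans (cong (k *_) (eq x)) (distrib k (⟦ p₀ ⟧ x) c (⟦ X ^^ n ⟧ x))
    where
    distrib : ∀ k p c y → k * (p + c * y) ≡ k * p + k * c * y
    distrib = solve-∀

  Deg-unique : ∀ {p m n} → Deg p m → Deg p n → m ≡ n
  Deg-unique = λ d e → ℕ.≤-antisym (≤ d e) (≤ e d)
    where
    ≤ : ∀ {p m n} → Deg p m → Deg p n → m ℕ.≤ n
    ≤ {p} {zero}          d e = z≤n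
    ≤ {p} {suc m} {suc n} d e = s≤s (≤ (Deg-D d) (Deg-D e))
    ≤ {p} {suc m} {zero}  d e with Deg-0 e
    ... | c , _ , p≐c with Deg⇒EventuallyNonzero (Deg-D d)
    ...   | x₀ , p′≢0 = ⊥-elim (p′≢0 (+ x₀) ℕ.≤-refl (D-cong {p} {con c} p≐c (+ x₀)))

  module _ {p : Expr} (p≢0 : EventuallyNonzero p) (F : Factorisation p (D p)) where
    open Factorisation F

    -- Up to constants, `p q₁ = g p₁ q₁ = p′ p₁`. By `∣D⊗⇒∣^^` the cofactor `p₁` of the gcd then has
    -- all the roots of `p`.
    p∣p′p₁ : p ∣ᴱ D p ⊗ p₁
    p∣p′p₁ = ∣-trans (p∣p⊗q p q₁) (∣-trans (⊗-mono-∣ p∣g⊗p₁ (∣-refl {q₁}))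
      (∣-trans (≐⇒∣ λ x → swap (⟦ g ⟧ x) (⟦ p₁ ⟧ x) (⟦ q₁ ⟧ x)) (⊗-mono-∣ g⊗q₁∣q (∣-refl {p₁}))))
      where
      swap : ∀ g p q → g * p * q ≡ g * q * p
      swap = solve-∀

    p₁∣p : p₁ ∣ᴱ p
    p₁∣p = ∣-trans (q∣p⊗q g p₁) g⊗p₁∣p

    constant-gcd⇒Squarefree : Deg g 0 → Squarefree p
    constant-gcd⇒Squarefree deg = Coprime-∣ˡ (∣-trans p∣g⊗p₁ (unit p₁)) (Coprime-∣ʳ (∣-trans q∣g⊗q₁ (unit q₁)) coprime)
      where
      unit : ∀ h → g ⊗ h ∣ᴱ h
      unit h = let c , c≢0 , g≐c = Deg-0 deg in scaled⇒∣ c c≢0 λ x → cong (_* ⟦ h ⟧ x) (sym (g≐c x))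

    cofactor-Deg : ∀ {i n} → Deg g (suc i) → p <° suc n → p₁ <° n
    cofactor-Deg {i} {n} degg p<n =
      let d , d<1+n , degp   = EventuallyNonzero⇒Deg p≢0 p<n
          j , degp₁          = EventuallyNonzero⇒Deg′ (∣-EventuallyNonzero p₁∣p p≢0)
          degrees : suc i ℕ.+ j ≡ d
          degrees = Deg-unique (Deg-⊗ degg degp₁) (Deg-resp (λ x → sym (p≐ x)) (Deg-scale k≢0 degp))
      in <°-weaken (ℕ.≤-trans (s≤s (ℕ.m≤n+m j i)) (ℕ.≤-trans (ℕ.≤-reflexive degrees) (ℕ.s≤s⁻¹ d<1+n))) (Deg-<° degp₁)

  opaque
    squarefree-part-bounded : ∀ n {p} → p <° n → EventuallyNonzero p → ∃[ r ] (Squarefree r × r ∣ᴱ p × ∃[ m ] p ∣ᴱ r ^^ m)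
    squarefree-part-bounded zero    p<0 (x₀ , p≢0) = ⊥-elim (p≢0 (+ x₀) ℕ.≤-refl (<°0⇒≐0 p<0 (+ x₀)))
    squarefree-part-bounded (suc n) {p} p<n p≢0 = split (factorise p (D p) p≢0)
      where
      split : Factorisation p (D p) → ∃[ r ] (Squarefree r × r ∣ᴱ p × ∃[ m ] p ∣ᴱ r ^^ m)
      split F = go (EventuallyNonzero⇒Deg′ (∣-EventuallyNonzero (Factorisation.g∣p F) p≢0))
        where
        go : ∃ (Deg (Factorisation.g F)) → ∃[ r ] (Squarefree r × r ∣ᴱ p × ∃[ m ] p ∣ᴱ r ^^ m)
        go (zero , deg)  = p , constant-gcd⇒Squarefree p≢0 F deg , ∣-refl , 1 , ∣-^¹ ∣-refl
        -- `p₁` has smaller degree and the same roots as `p`, so the recursion ends at a polynomial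
        -- whose gcd with its derivative is constant.
        go (suc i , deg) =
          let r , sf , r∣p₁ , m , p₁∣r^m = squarefree-part-bounded n (cofactor-Deg p≢0 F deg p<n) (∣-EventuallyNonzero (p₁∣p p≢0 F) p≢0)
              N , p∣p₁^N                 = ∣D⊗⇒∣^^ p≢0 (p∣p′p₁ p≢0 F)
          in r , sf , ∣-trans r∣p₁ (p₁∣p p≢0 F) , N ℕ.* m , ∣-^^-trans N m p∣p₁^N p₁∣r^m

    squarefree-part : ∀ p → EventuallyNonzero p → ∃[ r ] (Squarefree r × r ∣ᴱ p × ∃[ m ] p ∣ᴱ r ^^ m)
    squarefree-part p = squarefree-part-bounded _ (<°-toList p)

  -- The Riemann–Hurwitz step: if T vanishes at the images under φ of the roots of s and of φ′, then it does so with enough multiplicity.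
  module _ {T φ s : Expr} (Tφ≢0 : EventuallyNonzero (T ∘ᴱ φ)) (φ′≢0 : EventuallyNonzero (D φ)) where

    private
      P = T ∘ᴱ φ

    D-∘ᴱ-∣ : ∀ {g} → g ∣ᴱ D φ → g ∣ᴱ D P
    D-∘ᴱ-∣ g∣φ′ = ∣-trans (∣-⊗ˡ (D T ∘ᴱ φ) g∣φ′)
      (≐⇒∣ λ x → trans (cong (_* ⟦ D φ ⟧ x) (⟦∘ᴱ⟧ (D T) φ x)) (sym (D-∘ᴱ T φ x)))

    module _ (F : Factorisation (D φ) P) where
      open Factorisation F

      -- k P′ = g′ q₁ + g q₁′ and g divides P′.
      g∣g′q₁ : g ∣ᴱ D g ⊗ q₁
      g∣g′q₁ = ∣-trans (∣-⊕ {q = con l ⊗ D P} (∣-⊗ˡ (con l) (D-∘ᴱ-∣ g∣p)) (∣-⊗ˡ (con (- 1ℤ)) (p∣p⊗q g (D q₁))))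
        (≐⇒∣ λ x → trans (cong (_+ (- 1ℤ) * (⟦ g ⟧ x * ⟦ D q₁ ⟧ x)) (D-scaled-product {P} {g} {q₁} l q≐ x))
          (eq (⟦ D g ⟧ x * ⟦ q₁ ⟧ x) (⟦ g ⟧ x * ⟦ D q₁ ⟧ x)))
        where
        eq : ∀ a b → a + b + (- 1ℤ) * b ≡ a
        eq = solve-∀

      -- `P` divides `g q₁`, which divides a power of `q₁` because `g` does. So `φ′`, and with it
      -- `p₁`, divides a power of `q₁`, to which `p₁` is coprime.
      p₁∣1 : ∀ n → D φ ∣ᴱ P ^^ n → p₁ ∣ᴱ con 1ℤ
      p₁∣1 n φ′∣Pⁿ = let N , g∣q₁^N = ∣D⊗⇒∣^^ (∣-EventuallyNonzero g∣p φ′≢0) g∣g′q₁ in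
        coprime-divisor (Coprime-^^ (n ℕ.* (N ℕ.+ 1)) coprime)
          (∣-trans (q∣p⊗q g p₁) (∣-trans g⊗p₁∣p (∣-^^-trans n (N ℕ.+ 1) φ′∣Pⁿ
            (∣-trans q∣g⊗q₁ (∣-trans (⊗-mono-∣ g∣q₁^N (∣-^¹ (∣-refl {q₁}))) (≐⇒∣ λ x → sym (^^-+ q₁ N 1 x)))))))

      D∣∘ᴱ-factored : ∀ n → D φ ∣ᴱ P ^^ n → D φ ∣ᴱ P
      D∣∘ᴱ-factored n φ′∣Pⁿ = ∣-trans p∣g⊗p₁ (∣-trans (⊗-mono-∣ (∣-refl {g}) (p₁∣1 n φ′∣Pⁿ))
        (∣-trans (⊗-comm-∣ g (con 1ℤ)) (∣-trans (≐⇒∣ λ x → ℤ.*-identityˡ (⟦ g ⟧ x)) g∣q)))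

    opaque
      D∣∘ᴱ : ∀ n → D φ ∣ᴱ P ^^ n → D φ ∣ᴱ P
      D∣∘ᴱ = D∣∘ᴱ-factored (factorise (D φ) P φ′≢0)

    opaque
      riemann-hurwitz : Squarefree s → ∀ m n → s ∣ᴱ P ^^ m → D φ ∣ᴱ P ^^ n → D φ ⊗ s ∣ᴱ P
      riemann-hurwitz sf m n s∣Pᵐ φ′∣Pⁿ = from (D∣∘ᴱ n φ′∣Pⁿ)
        where
        from : D φ ∣ᴱ P → D φ ⊗ s ∣ᴱ P
        from (mk∣ k k≢0 U e) = ∣-trans (⊗-mono-∣ (∣-refl {D φ}) s∣U) (scaled⇒∣ k k≢0 e)
          where
          -- By the chain rule `P′ U = T′(φ) φ′ U`, and `φ′ U` is a multiple of `P`. Hence `U`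
          -- vanishes at every root of `P`, in particular at the roots of `s`, and a squarefree `s`
          -- divides it.
          P∣P′U : P ∣ᴱ D P ⊗ U
          P∣P′U = ∣-trans (∣-⊗ˡ (D T ∘ᴱ φ) (scaled⇒∣ʳ {D φ ⊗ U} {P} k e))
            (≐⇒∣ λ x → trans (sym (ℤ.*-assoc (⟦ D T ∘ᴱ φ ⟧ x) (⟦ D φ ⟧ x) (⟦ U ⟧ x)))
              (cong (_* ⟦ U ⟧ x) (trans (cong (_* ⟦ D φ ⟧ x) (⟦∘ᴱ⟧ (D T) φ x)) (sym (D-∘ᴱ T φ x)))))
          s∣U : s ∣ᴱ U
          s∣U = let N , P∣Uᴺ = ∣D⊗⇒∣^^ Tφ≢0 P∣P′U in squarefree-∣-^^ sf (m ℕ.* N) (∣-^^-trans m N s∣Pᵐ P∣Uᴺ)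

open Divisibility

-- Newton's iteration in ℚ(i)

module NewtonIteration where

  open import Data.Rational.Base using (_+_; _*_; _-_; -_; _≤_; _<_; ∣_∣; 1/_)
  open import Tactic.RingSolver using (solve-∀)
  open import Data.Integer.Tactic.RingSolver using () renaming (ring to ℤ-ring)
  open GaussianRationals
  open Directions
  open ApproximateRoots

  module Ev𝔾 = Evaluation 𝔾-commutativeRing

  ι𝔾 : ℤ → 𝔾
  ι𝔾 a = real (ι a)

  𝔾-embedding : Ev𝔾.Embedding
  𝔾-embedding = record { ι = ι𝔾 ; ι-+ = λ a b → 𝔾-≡ (ι-+ a b) refl ; ι-* = λ a b → trans (cong real (ι-* a b))
    (sym (real-· (ι a) (ι b))) ; ι-0 = refl ; ι-1 = refl }

  ⟦_⟧ᴳ : Expr → 𝔾 → 𝔾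
  ⟦_⟧ᴳ = Ev𝔾.⟦_⟧ᴿ 𝔾-embedding

  -- Agreement on ℤ forces all coefficients of the difference to vanish, so identities proved over
  -- ℤ, such as Bézout's, hold at every point of ℚ(i).
  ≐⇒≡ᴳ : ∀ p q → p ≐ q → ∀ z → ⟦ p ⟧ᴳ z ≡ ⟦ q ⟧ᴳ z
  ≐⇒≡ᴳ p q p≐q z = trans (eq (⟦ p ⟧ᴳ z) (⟦ q ⟧ᴳ z)) (trans (cong (_∔ ⟦ q ⟧ᴳ z) vanish) (eq′ (⟦ q ⟧ᴳ z)))
    where
    difference = p ⊕ con (ℤ.- 1ℤ) ⊗ q
    minus : ∀ a → a ℤ.+ ℤ.- 1ℤ ℤ.* a ≡ 0ℤ
    minus = solve-∀ ℤ-ring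
    vanish : ⟦ difference ⟧ᴳ z ≡ 0𝔾
    vanish = trans (sym (Ev𝔾.evalᴿ-toList 𝔾-embedding difference z)) (Ev𝔾.evalᴿ-vanish 𝔾-embedding (toList difference) z
      (vanishes (toList difference) 0 λ n _ → trans (eval-toList difference (ℤ.+ n))
          (trans (cong (ℤ._+ ℤ.- 1ℤ ℤ.* ⟦ q ⟧ (ℤ.+ n)) (p≐q (ℤ.+ n))) (minus (⟦ q ⟧ (ℤ.+ n))))))
    eq : ∀ a b → a ≡ a ∔ ι𝔾 (ℤ.- 1ℤ) · b ∔ b
    eq a b = 𝔾-≡ (re-eq (re a) (re b) (im b)) (re-eq′ (im a) (im b) (re b))
      where
      re-eq : ∀ a b c → a ≡ a + (ι (ℤ.- 1ℤ) * b - 0ℚ * c) + b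
      re-eq = solve-∀ ℚ-ring
      re-eq′ : ∀ a b c → a ≡ a + (ι (ℤ.- 1ℤ) * b + 0ℚ * c) + b
      re-eq′ = solve-∀ ℚ-ring
    eq′ : ∀ a → 0𝔾 ∔ a ≡ a
    eq′ = solve-∀ 𝔾-ring

  -- The second-order Taylor remainder divided by `w²`. The recursion on the expression makes it
  -- explicit, so that it can be bounded on discs.
  remainder : Expr → 𝔾 → 𝔾 → 𝔾
  remainder (con a) z w = 0𝔾
  remainder X       z w = 0𝔾
  remainder (p ⊕ q) z w = remainder p z w ∔ remainder q z w
  remainder (p ⊗ q) z w = ⟦ p ⟧ᴳ z · remainder q z w ∔ ⟦ D p ⟧ᴳ z · ⟦ D q ⟧ᴳ z ∔ remainder p z w · ⟦ q ⟧ᴳ z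
                          ∔ w · (⟦ D p ⟧ᴳ z · remainder q z w ∔ remainder p z w · ⟦ D q ⟧ᴳ z) ∔ (w · w) · (remainder p z w · remainder q z w)

  taylor₂ : ∀ p z w → ⟦ p ⟧ᴳ (z ∔ w) ≡ ⟦ p ⟧ᴳ z ∔ w · ⟦ D p ⟧ᴳ z ∔ (w · w) · remainder p z w
  taylor₂ (con a) z w = eq (ι𝔾 a) w
    where
    eq : ∀ a w → a ≡ a ∔ w · 0𝔾 ∔ (w · w) · 0𝔾
    eq = solve-∀ 𝔾-ring
  taylor₂ X z w = eq z w
    where
    eq : ∀ z w → z ∔ w ≡ z ∔ w · 1𝔾 ∔ (w · w) · 0𝔾
    eq = solve-∀ 𝔾-ring
  taylor₂ (p ⊕ q) z w = trans (cong₂ _∔_ (taylor₂ p z w) (taylor₂ q z w)) (eq (⟦ p ⟧ᴳ z) (⟦ q ⟧ᴳ z) (⟦ D p ⟧ᴳ z)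
    (⟦ D q ⟧ᴳ z) w (remainder p z w) (remainder q z w))
    where
    eq : ∀ a b c d w r s → (a ∔ w · c ∔ (w · w) · r) ∔ (b ∔ w · d ∔ (w · w) · s) ≡ (a ∔ b) ∔ w · (c ∔ d) ∔ (w · w) · (r ∔ s)
    eq = solve-∀ 𝔾-ring
  taylor₂ (p ⊗ q) z w = trans (cong₂ _·_ (taylor₂ p z w) (taylor₂ q z w)) (eq (⟦ p ⟧ᴳ z) (⟦ q ⟧ᴳ z) (⟦ D p ⟧ᴳ z)
    (⟦ D q ⟧ᴳ z) w (remainder p z w) (remainder q z w))
    where
    eq : ∀ a b c d w r s → (a ∔ w · c ∔ (w · w) · r) · (b ∔ w · d ∔ (w · w) · s) ≡
         (a · b) ∔ w · (c · b ∔ a · d) ∔ (w · w) · (a · s ∔ c · d ∔ r · b ∔ w · (c · s ∔ r · d) ∔ (w · w) · (r · s))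
    eq = solve-∀ 𝔾-ring

  ∔-≤ : ∀ {z w a b} → ‖ z ‖ ≤ a → ‖ w ‖ ≤ b → ‖ z ∔ w ‖ ≤ a + b
  ∔-≤ {z} {w} z≤a w≤b = ℚ.≤-trans (‖∔‖ z w) (ℚ.+-mono-≤ z≤a w≤b)

  ·-≤ : ∀ {z w a b} → ‖ z ‖ ≤ a → ‖ w ‖ ≤ b → ‖ z · w ‖ ≤ a * b
  ·-≤ {z} {w} z≤a w≤b = ℚ.≤-trans (‖·‖ z w) (*-mono (0≤‖‖ z) (ℚ.≤-trans (0≤‖‖ w) w≤b) z≤a w≤b)

  ⟦⟧ᴳ-bounded : ∀ B p → ∃[ C ] (∀ z → ‖ z ‖ ≤ B → ‖ ⟦ p ⟧ᴳ z ‖ ≤ C)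
  ⟦⟧ᴳ-bounded B (con a) = ‖ ι𝔾 a ‖ , λ _ _ → ℚ.≤-refl
  ⟦⟧ᴳ-bounded B X       = B , λ z z≤B → z≤B
  ⟦⟧ᴳ-bounded B (p ⊕ q) = let C , p≤ = ⟦⟧ᴳ-bounded B p ; E , q≤ = ⟦⟧ᴳ-bounded B q in C + E , λ z z≤B → ∔-≤ {⟦ p ⟧ᴳ z} (p≤ z z≤B) (q≤ z z≤B)
  ⟦⟧ᴳ-bounded B (p ⊗ q) = let C , p≤ = ⟦⟧ᴳ-bounded B p ; E , q≤ = ⟦⟧ᴳ-bounded B q in C * E , λ z z≤B → ·-≤ {⟦ p ⟧ᴳ z} (p≤ z z≤B) (q≤ z z≤B)

  remainder-bounded : ∀ B p → ∃[ C ] (∀ z w → ‖ z ‖ ≤ B → ‖ w ‖ ≤ 1ℚ → ‖ remainder p z w ‖ ≤ C)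
  remainder-bounded B (con a) = 0ℚ , λ _ _ _ _ → ℚ.≤-refl
  remainder-bounded B X       = 0ℚ , λ _ _ _ _ → ℚ.≤-refl
  remainder-bounded B (p ⊕ q) = let C , p≤ = remainder-bounded B p ; E , q≤ = remainder-bounded B q in C + E , λ z w z≤B w≤1 →
    ∔-≤ {remainder p z w} (p≤ z w z≤B w≤1) (q≤ z w z≤B w≤1)
  remainder-bounded B (p ⊗ q) =
    let P , p≤ = ⟦⟧ᴳ-bounded B p ; Q , q≤ = ⟦⟧ᴳ-bounded B q ; P′ , p′≤ = ⟦⟧ᴳ-bounded B (D p) ; Q′ , q′≤ = ⟦⟧ᴳ-bounded B (D q)
        R , r≤ = remainder-bounded B p ; S , s≤ = remainder-bounded B q
    in P * S + P′ * Q′ + R * Q + 1ℚ * (P′ * S + R * Q′) + (1ℚ * 1ℚ) * (R * S) , λ z w z≤B w≤1 →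
      product-bound (⟦ p ⟧ᴳ z) (⟦ q ⟧ᴳ z) (⟦ D p ⟧ᴳ z) (⟦ D q ⟧ᴳ z) (remainder p z w) (remainder q z w) w (p≤ z z≤B) (q≤ z z≤B) (p′≤ z z≤B) (q′≤ z z≤B) (r≤ z w z≤B w≤1) (s≤ z w z≤B w≤1) w≤1
    where
    product-bound : ∀ p q p′ q′ r s w {P Q P′ Q′ R S} → ‖ p ‖ ≤ P → ‖ q ‖ ≤ Q → ‖ p′ ‖ ≤ P′ → ‖ q′ ‖ ≤ Q′ → ‖ r ‖ ≤ R →
      ‖ s ‖ ≤ S → ‖ w ‖ ≤ 1ℚ →
      ‖ p · s ∔ p′ · q′ ∔ r · q ∔ w · (p′ · s ∔ r · q′) ∔ (w · w) · (r · s) ‖ ≤ P * S + P′ * Q′ + R * Q + 1ℚ * (P′ * S + R * Q′) + (1ℚ * 1ℚ) * (R * S)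
    product-bound p q p′ q′ r s w p≤ q≤ p′≤ q′≤ r≤ s≤ w≤ =
      ∔-≤ {p · s ∔ p′ · q′ ∔ r · q ∔ w · (p′ · s ∔ r · q′)} (∔-≤ {p · s ∔ p′ · q′ ∔ r · q} (∔-≤ {p · s ∔ p′ · q′}
        (∔-≤ {p · s} (·-≤ {p} p≤ s≤) (·-≤ {p′} p′≤ q′≤)) (·-≤ {r} r≤ q≤))
        (·-≤ {w} w≤ (∔-≤ {p′ · s} (·-≤ {p′} p′≤ s≤) (·-≤ {r} r≤ q′≤)))) (·-≤ {w · w} (·-≤ {w} w≤ w≤) (·-≤ {r} r≤ s≤))

  -- Starting from ½ rather than 1 gives `ε n * ε n ≤ ε (suc n)`: the quadratic convergence is
  -- recorded as plain halving.
  ε : ℕ → ℚ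
  ε n = ½ ^ℚ suc n

  0<ε : ∀ n → 0ℚ < ε n
  0<ε n = 0<^ (ℚ.positive⁻¹ ½) (suc n)

  2ε : ∀ n → 2ℚ * ε (suc n) ≡ ε n
  2ε n = eq (ε n)
    where
    eq : ∀ a → (1ℚ + 1ℚ) * (½ * a) ≡ a
    eq = solve-∀ ℚ-ring

  ε² : ∀ n → ε n * ε n ≤ ε (suc n)
  ε² n = *-monoˡ (ε n) (ℚ.<⇒≤ (0<ε n)) (ℚ.≤-trans (^ℚ-antitone (ℚ.positive⁻¹ ½) ½≤1 {1} {suc n} (s≤s z≤n))
    (ℚ.≤-reflexive (ℚ.*-identityʳ ½)))
    where
    ½≤1 : ½ ≤ 1ℚ
    ½≤1 = ≤-by ½ (ℚ.<⇒≤ (ℚ.positive⁻¹ ½)) refl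

  -- A linear rate is enough to bring `c * ε n` below any positive bound by the Archimedean
  -- property.
  ε-linear : ∀ n → num (suc n) * ε n ≤ 1ℚ
  ε-linear zero    = ≤-by ½ (ℚ.<⇒≤ (ℚ.positive⁻¹ ½)) refl
  ε-linear (suc n) = ℚ.≤-trans (ℚ.≤-reflexive (trans (cong (_* ε (suc n)) (num-suc (suc n))) (eq (num (suc n)) (ε n))))
    (ℚ.≤-trans (ℚ.+-mono-≤ (*-monoʳ {ε n} {1ℚ} ½ (ℚ.<⇒≤ (ℚ.positive⁻¹ ½)) (ℚ.≤-trans (≤-by {ε n} {num (suc n) * ε n}
        (num n * ε n) (0≤* (0≤num n) (ℚ.<⇒≤ (0<ε n))) (trans (eq′ (num n) (ε n)) (cong (_* ε n) (sym (num-suc n)))))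
        (ε-linear n)))
      (*-monoʳ ½ (ℚ.<⇒≤ (ℚ.positive⁻¹ ½)) (ε-linear n))) (ℚ.≤-reflexive refl))
    where
    eq : ∀ m e → (1ℚ + m) * (½ * e) ≡ ½ * e + ½ * (m * e)
    eq = solve-∀ ℚ-ring
    eq′ : ∀ n e → e + n * e ≡ (1ℚ + n) * e
    eq′ = solve-∀ ℚ-ring

  num-mono : ∀ {m n} → m ℕ.≤ n → num m ≤ num n
  num-mono {m} {n} m≤n = ≤-by (num (n ℕ.∸ m)) (0≤num (n ℕ.∸ m)) (trans (sym (ι-+ (ℤ.+ m) (ℤ.+ (n ℕ.∸ m))))
    (cong num (ℕ.m+[n∸m]≡n m≤n)))

  ε-vanishes : ∀ c η → 0ℚ < η → ∃[ k ] (∀ n → k ℕ.≤ n → c * ε n < η)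
  ε-vanishes c η 0<η =
    let r , 0<r , inv = reciprocal η 0<η
        k , k≥        = archimedean (c * r)
    in k , λ n k≤n → bound n r inv (ℚ.≤-trans k≥ (num-mono k≤n))
    where
    bound : ∀ n r → η * r ≡ 1ℚ → c * r ≤ num n → c * ε n < η
    bound n r inv cr≤n = ℚ.<-≤-trans (ℚ.*-monoˡ-<-pos (ε n) {{ℚ.positive (0<ε n)}} c<) (ℚ.≤-trans (ℚ.≤-reflexive
      (ℚ.*-assoc η (num (suc n)) (ε n)))
      (ℚ.≤-trans (*-monoʳ η (ℚ.<⇒≤ 0<η) (ε-linear n)) (ℚ.≤-reflexive (ℚ.*-identityʳ η))))
      where
      eq : ∀ c r η → η * (c * r) ≡ c * (η * r)
      eq = solve-∀ ℚ-ring
      eq′ : ∀ η n → η * n + η ≡ η * (1ℚ + n)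
      eq′ = solve-∀ ℚ-ring
      c< : c < η * num (suc n)
      c< = ℚ.≤-<-trans (ℚ.≤-trans (ℚ.≤-reflexive (sym (trans (eq c r η) (trans (cong (c *_) inv)
        (ℚ.*-identityʳ c))))) (*-monoʳ η (ℚ.<⇒≤ 0<η) cr≤n))
        (ℚ.<-≤-trans (subst (_< η * num n + η) (ℚ.+-identityʳ (η * num n)) (ℚ.+-monoʳ-< (η * num n) 0<η))
            (ℚ.≤-reflexive (trans (eq′ η (num n)) (cong (η *_) (sym (num-suc n))))))

  inverse-≤1 : ∀ {k} → k ≢ 0ℤ → ∃[ κ ] (ι k * κ ≡ 1ℚ × ∣ κ ∣ ≤ 1ℚ)
  inverse-≤1 {k} k≢0 = κ , ℚ.*-inverseʳ (ι k) , ℚ.≤-trans (ℚ.≤-reflexive (sym (ℚ.*-identityˡ ∣ κ ∣)))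
    (ℚ.≤-trans (*-monoˡ ∣ κ ∣ (ℚ.0≤∣p∣ κ) (1≤∣ι∣ k≢0)) (ℚ.≤-reflexive (trans (sym (ℚ.∣p*q∣≡∣p∣*∣q∣ (ι k) κ))
        (cong ∣_∣ (ℚ.*-inverseʳ (ι k))))))
    where
    instance
      ιk≢0 : ℚ.NonZero (ι k)
      ιk≢0 = ℚ.≢-nonZero λ ιk≡0 → k≢0 (ι-injective {k} {0ℤ} ιk≡0)
    κ = 1/ ι k

  -- With u R + v R′ = k, the step −v R / k replaces R by a multiple of R².
  module Newton (R u v : Expr) {k : ℤ} (bezout : ∀ x → ⟦ u ⟧ x ℤ.* ⟦ R ⟧ x ℤ.+ ⟦ v ⟧ x ℤ.* ⟦ D R ⟧ x ≡ k)
                {κ : ℚ} (kκ≡1 : ι k * κ ≡ 1ℚ) (κ≤1 : ∣ κ ∣ ≤ 1ℚ)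
                {B U V S : ℚ} (u≤ : ∀ z → ‖ z ‖ ≤ B → ‖ ⟦ u ⟧ᴳ z ‖ ≤ U) (v≤ : ∀ z → ‖ z ‖ ≤ B → ‖ ⟦ v ⟧ᴳ z ‖ ≤ V)
                (s≤ : ∀ z w → ‖ z ‖ ≤ B → ‖ w ‖ ≤ 1ℚ → ‖ remainder R z w ‖ ≤ S) where

    step : 𝔾 → 𝔾
    step z = neg (real κ · (⟦ v ⟧ᴳ z · ⟦ R ⟧ᴳ z))

    κ∙-≤ : ∀ z → ‖ real κ · z ‖ ≤ ‖ z ‖
    κ∙-≤ z = ℚ.≤-trans (ℚ.≤-reflexive (‖real·‖ κ z)) (ℚ.≤-trans (*-monoˡ ‖ z ‖ (0≤‖‖ z) κ≤1) (ℚ.≤-reflexive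
      (ℚ.*-identityˡ ‖ z ‖)))

    -- One constant for three purposes: `V ≤ C` bounds the step, `U + V² S ≤ C` bounds the factor in
    -- front of `R²`, and `1 ≤ C` returns from `C ‖R‖` to `‖R‖`. The scaled residual `C ‖R‖` is then
    -- at most squared by each step.
    C : ℚ
    C = 1ℚ + (U + V + V * V * S)

    next-value : ∀ z → ⟦ R ⟧ᴳ (z ∔ step z) ≡ (⟦ R ⟧ᴳ z · ⟦ R ⟧ᴳ z) · (real κ · ⟦ u ⟧ᴳ z ∔ real κ · (real κ · ((⟦ v ⟧ᴳ z · ⟦ v ⟧ᴳ z) · remainder R z (step z))))
    next-value z = trans (taylor₂ R z (step z)) (trans (eq (⟦ R ⟧ᴳ z) (⟦ D R ⟧ᴳ z) (⟦ u ⟧ᴳ z) (⟦ v ⟧ᴳ z) (real κ)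
      (remainder R z (step z)))
      -- Bézout's identity turns `u R + v R′` into `k`, and `κ k = 1` cancels the term linear in
      -- `R`.
      (trans (cong (λ t → ⟦ R ⟧ᴳ z · (1𝔾 ∔ neg (real κ · t)) ∔ rest) (≐⇒≡ᴳ (u ⊗ R ⊕ v ⊗ D R) (con k) bezout z))
        (trans (cong (λ t → ⟦ R ⟧ᴳ z · (1𝔾 ∔ neg t) ∔ rest) (trans (real-· κ (ι k))
            (cong real (trans (ℚ.*-comm κ (ι k)) kκ≡1)))) (drop (⟦ R ⟧ᴳ z) rest))))
      where
      rest = (⟦ R ⟧ᴳ z · ⟦ R ⟧ᴳ z) · (real κ · ⟦ u ⟧ᴳ z ∔ real κ · (real κ · ((⟦ v ⟧ᴳ z · ⟦ v ⟧ᴳ z) · remainder R z (step z))))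
      eq : ∀ r r′ u v k s → r ∔ neg (k · (v · r)) · r′ ∔ (neg (k · (v · r)) · neg (k · (v · r))) · s ≡
           r · (1𝔾 ∔ neg (k · (u · r ∔ v · r′))) ∔ (r · r) · (k · u ∔ k · (k · ((v · v) · s)))
      eq = solve-∀ 𝔾-ring
      drop : ∀ r t → r · (1𝔾 ∔ neg 1𝔾) ∔ t ≡ t
      drop = solve-∀ 𝔾-ring

    -- The margin `2 ε n` in `within` is the total length allowed to all remaining steps, the sum of
    -- the `ε i` for `i ≥ n`; thus the iterates never leave the disc on which the bounds hold.
    record Approximation (n : ℕ) : Set where
      constructor mkApproximation
      field
        z       : 𝔾
        value≤  : C * ‖ ⟦ R ⟧ᴳ z ‖ ≤ ε n
        within  : ‖ z ‖ + 2ℚ * ε n ≤ B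

    module _ (0≤U : 0ℚ ≤ U) (0≤V : 0ℚ ≤ V) (0≤S : 0ℚ ≤ S) where

      0≤VVS : 0ℚ ≤ V * V * S
      0≤VVS = 0≤* (0≤* 0≤V 0≤V) 0≤S

      0≤C : 0ℚ ≤ C
      0≤C = 0≤+ (0≤num 1) (0≤+ (0≤+ 0≤U 0≤V) 0≤VVS)

      1≤C : 1ℚ ≤ C
      1≤C = ≤-by (U + V + V * V * S) (0≤+ (0≤+ 0≤U 0≤V) 0≤VVS) refl

      module _ {n : ℕ} (a : Approximation n) where
        open Approximation a

        z≤B : ‖ z ‖ ≤ B
        z≤B = ℚ.≤-trans (≤-by (2ℚ * ε n) (0≤* (0≤num 2) (ℚ.<⇒≤ (0<ε n))) refl) within

        step≤ : ‖ step z ‖ ≤ ε n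
        step≤ = ℚ.≤-trans (ℚ.≤-reflexive (‖neg‖ (real κ · (⟦ v ⟧ᴳ z · ⟦ R ⟧ᴳ z))))
          (ℚ.≤-trans (κ∙-≤ (⟦ v ⟧ᴳ z · ⟦ R ⟧ᴳ z)) (ℚ.≤-trans (‖·‖ (⟦ v ⟧ᴳ z) (⟦ R ⟧ᴳ z))
          (ℚ.≤-trans (*-monoˡ ‖ ⟦ R ⟧ᴳ z ‖ (0≤‖‖ (⟦ R ⟧ᴳ z)) (ℚ.≤-trans (v≤ z z≤B) V≤C)) value≤)))
          where
          V≤C : V ≤ C
          V≤C = ≤-by (1ℚ + (U + V * V * S)) (0≤+ (0≤num 1) (0≤+ 0≤U 0≤VVS)) (eq V 1ℚ U (V * V * S))
            where
            eq : ∀ v a u s → v + (a + (u + s)) ≡ a + (u + v + s)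
            eq = solve-∀ ℚ-ring

        ε≤1 : ε n ≤ 1ℚ
        ε≤1 = ^ℚ-≤1 (ℚ.positive⁻¹ ½) (≤-by ½ (ℚ.<⇒≤ (ℚ.positive⁻¹ ½)) refl) (suc n)

        quadratic : ‖ ⟦ R ⟧ᴳ (z ∔ step z) ‖ ≤ ‖ ⟦ R ⟧ᴳ z ‖ * ‖ ⟦ R ⟧ᴳ z ‖ * C
        quadratic = ℚ.≤-trans (ℚ.≤-reflexive (cong ‖_‖ (next-value z))) (ℚ.≤-trans (·-≤ {⟦ R ⟧ᴳ z · ⟦ R ⟧ᴳ z}
          (‖·‖ (⟦ R ⟧ᴳ z) (⟦ R ⟧ᴳ z))
          (ℚ.≤-trans (∔-≤ {real κ · ⟦ u ⟧ᴳ z} (ℚ.≤-trans (κ∙-≤ (⟦ u ⟧ᴳ z)) (u≤ z z≤B))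
            (ℚ.≤-trans (κ∙-≤ (real κ · ((⟦ v ⟧ᴳ z · ⟦ v ⟧ᴳ z) · remainder R z (step z))))
                (ℚ.≤-trans (κ∙-≤ ((⟦ v ⟧ᴳ z · ⟦ v ⟧ᴳ z) · remainder R z (step z)))
              (·-≤ {⟦ v ⟧ᴳ z · ⟦ v ⟧ᴳ z} (·-≤ {⟦ v ⟧ᴳ z} (v≤ z z≤B) (v≤ z z≤B)) (s≤ z (step z) z≤B (ℚ.≤-trans step≤ ε≤1))))))
            (≤-by (1ℚ + V) (0≤+ (0≤num 1) 0≤V) (eq V 1ℚ U (V * V * S)))))
          ℚ.≤-refl)
          where
          eq : ∀ v a u s → u + s + (a + v) ≡ a + (u + v + s)
          eq = solve-∀ ℚ-ring

        next : Approximation (suc n)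
        next = mkApproximation (z ∔ step z)
          (ℚ.≤-trans (*-monoʳ C 0≤C quadratic) (ℚ.≤-trans (ℚ.≤-reflexive (eq C ‖ ⟦ R ⟧ᴳ z ‖))
            (ℚ.≤-trans (*-mono (0≤* 0≤C (0≤‖‖ (⟦ R ⟧ᴳ z))) (ℚ.<⇒≤ (0<ε n)) value≤ value≤) (ε² n))))
          (ℚ.≤-trans (ℚ.+-mono-≤ (∔-≤ {z} {step z} ℚ.≤-refl step≤) (ℚ.≤-reflexive (2ε n))) (ℚ.≤-trans (ℚ.≤-reflexive
              (eq′ ‖ z ‖ (ε n))) within))
          where
          eq : ∀ c r → c * (r * r * c) ≡ (c * r) * (c * r)
          eq = solve-∀ ℚ-ring
          eq′ : ∀ z e → z + e + e ≡ z + (1ℚ + 1ℚ) * e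
          eq′ = solve-∀ ℚ-ring

      module _ (a₀ : Approximation 0) where

        iterates : ∀ n → Approximation n
        iterates zero    = a₀
        iterates (suc n) = next (iterates n)

        zs : ℕ → 𝔾
        zs n = Approximation.z (iterates n)

        zs-value : ∀ n → ‖ ⟦ R ⟧ᴳ (zs n) ‖ ≤ ε n
        zs-value n = ℚ.≤-trans (ℚ.≤-trans (ℚ.≤-reflexive (sym (ℚ.*-identityˡ ‖ ⟦ R ⟧ᴳ (zs n) ‖))) (*-monoˡ ‖ ⟦ R ⟧ᴳ
          (zs n) ‖ (0≤‖‖ (⟦ R ⟧ᴳ (zs n))) 1≤C)) (Approximation.value≤ (iterates n))

        -- The margin still available at index `n + k` is kept on the left, which lets the induction
        -- on `k` absorb one more step.
        zs-close : ∀ n k → ‖ zs (n ℕ.+ k) ⊖ zs n ‖ + 2ℚ * ε (n ℕ.+ k) ≤ 2ℚ * ε n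
        zs-close n zero    = subst (λ m → ‖ zs m ⊖ zs n ‖ + 2ℚ * ε m ≤ 2ℚ * ε n) (sym (ℕ.+-identityʳ n))
          (ℚ.≤-reflexive (trans (cong (λ t → ‖ t ‖ + 2ℚ * ε n) (cancel (zs n))) (ℚ.+-identityˡ (2ℚ * ε n))))
          where
          cancel : ∀ z → z ∔ neg z ≡ 0𝔾
          cancel = solve-∀ 𝔾-ring
        zs-close n (suc k) = subst (λ m → ‖ zs m ⊖ zs n ‖ + 2ℚ * ε m ≤ 2ℚ * ε n) (sym (ℕ.+-suc n k))
          (ℚ.≤-trans (ℚ.+-mono-≤ (ℚ.≤-trans (ℚ.≤-reflexive (cong ‖_‖ (eq (zs m) (step (zs m)) (zs n))))
              (∔-≤ {step (zs m)} (step≤ (iterates m)) ℚ.≤-refl)) (ℚ.≤-reflexive (2ε m)))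
            (ℚ.≤-trans (ℚ.≤-reflexive (eq′ (ε m) ‖ zs m ⊖ zs n ‖)) (zs-close n k)))
          where
          m = n ℕ.+ k
          eq : ∀ a s b → (a ∔ s) ∔ neg b ≡ s ∔ (a ∔ neg b)
          eq = solve-∀ 𝔾-ring
          eq′ : ∀ e d → e + d + e ≡ d + (1ℚ + 1ℚ) * e
          eq′ = solve-∀ ℚ-ring

  record ApproximateRoot (R : Expr) : Set where
    constructor mkApproximateRoot
    field
      zs     : ℕ → 𝔾
      B      : ℚ
      zs≤B   : ∀ n → ‖ zs n ‖ ≤ B
      close  : ∀ m n → n ℕ.≤ m → ‖ zs m ⊖ zs n ‖ ≤ 2ℚ * ε n
      value  : ∀ n → ‖ ⟦ R ⟧ᴳ (zs n) ‖ ≤ ε n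

  leading-list : ∀ (n : ℕ) (l : List ℤ) (c : ℤ) → List ℤ
  leading-list zero    l       c = c ∷ []
  leading-list (suc n) []      c = 0ℤ ∷ leading-list n [] c
  leading-list (suc n) (a ∷ l) c = a ∷ leading-list n l c

  eval-leading-list : ∀ n l c → length l ℕ.≤ n → ∀ x → ℤ[X].eval (leading-list n l c) x ≡ ℤ[X].eval l x ℤ.+ c ℤ.* ⟦ X ^^ n ⟧ x
  eval-leading-list zero    []      c len x = eq c x
    where
    eq : ∀ c x → c ℤ.+ x ℤ.* 0ℤ ≡ 0ℤ ℤ.+ c ℤ.* 1ℤ
    eq = solve-∀ ℤ-ring
  eval-leading-list (suc n) []      c len x = trans (cong (λ t → 0ℤ ℤ.+ x ℤ.* t) (eval-leading-list n [] c z≤n x))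
    (eq x c (⟦ X ^^ n ⟧ x))
    where
    eq : ∀ x c y → 0ℤ ℤ.+ x ℤ.* (0ℤ ℤ.+ c ℤ.* y) ≡ 0ℤ ℤ.+ c ℤ.* (x ℤ.* y)
    eq = solve-∀ ℤ-ring
  eval-leading-list (suc n) (a ∷ l) c (s≤s len) x = trans (cong (λ t → a ℤ.+ x ℤ.* t)
    (eval-leading-list n l c len x)) (eq a x (ℤ[X].eval l x) c (⟦ X ^^ n ⟧ x))
    where
    eq : ∀ a x l c y → a ℤ.+ x ℤ.* (l ℤ.+ c ℤ.* y) ≡ a ℤ.+ x ℤ.* l ℤ.+ c ℤ.* (x ℤ.* y)
    eq = solve-∀ ℤ-ring

  leading-list-Lead : ∀ n l {c} → c ≢ 0ℤ → Lead (List.map ι𝔾 (leading-list n l c)) n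
  leading-list-Lead zero    l       {c} c≢0 = last (ℚ.≤-trans (1≤∣ι∣ c≢0) (ℚ.≤-reflexive (sym (‖real‖ (ι c)))))
  leading-list-Lead (suc n) []      c≢0 = ι𝔾 0ℤ ∷ leading-list-Lead n [] c≢0
  leading-list-Lead (suc n) (a ∷ l) c≢0 = ι𝔾 a ∷ leading-list-Lead n l c≢0

  eval𝔾-map : ∀ l z → eval𝔾 (List.map ι𝔾 l) z ≡ ⟦ fromList l ⟧ᴳ z
  eval𝔾-map []      z = refl
  eval𝔾-map (a ∷ l) z = cong (λ t → ι𝔾 a ∔ z · t) (eval𝔾-map l z)

  opaque
    small-values : ∀ {R n} → Deg R (suc n) → ∃[ Z ] (0ℚ ≤ Z × (∀ δ → 0ℚ < δ → ∃[ z ] (‖ z ‖ ≤ Z × ‖ ⟦ R ⟧ᴳ z ‖ ≤ δ)))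
    small-values {R} {n} (mkDeg p₀ c (mk<° l len l≐) c≢0 R≐) =
      let Z , 0≤Z , root = approximate-root (leading-list-Lead (suc n) l c≢0)
      in Z , 0≤Z , λ δ 0<δ → let z , z≤Z , value = root δ 0<δ in z , z≤Z , subst (λ t → ‖ t ‖ ≤ δ) (trans (eval𝔾-map (leading-list (suc n) l c) z) (sym (≐⇒≡ᴳ R (fromList (leading-list (suc n) l c)) R≐list z))) value
      where
      R≐list : R ≐ fromList (leading-list (suc n) l c)
      R≐list x = trans (R≐ x) (trans (cong (ℤ._+ c ℤ.* ⟦ X ^^ suc n ⟧ x) (l≐ x))
        (trans (sym (eval-leading-list (suc n) l c len x)) (sym (⟦fromList⟧ (leading-list (suc n) l c) x))))

  opaque
    squarefree-root : ∀ {R n} → Squarefree R → Deg R (suc n) → ApproximateRoot R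
    squarefree-root {R} {n} (mkCoprime u v k k≢0 bezout) deg =
      let Z , 0≤Z , small = small-values deg
          κ , kκ≡1 , κ≤1  = inverse-≤1 k≢0
          B               = Z + 2ℚ * ε 0
          z≤⇒≤B : ∀ {z} → ‖ z ‖ ≤ Z → ‖ z ‖ ≤ B
          z≤⇒≤B z≤Z = ℚ.≤-trans z≤Z (≤-by (2ℚ * ε 0) (0≤num 1) refl)
          U , u≤          = ⟦⟧ᴳ-bounded B u
          V , v≤          = ⟦⟧ᴳ-bounded B v
          S , s≤          = remainder-bounded B R
          0≤U             = ℚ.≤-trans (0≤‖‖ (⟦ u ⟧ᴳ 0𝔾)) (u≤ 0𝔾 (z≤⇒≤B {0𝔾} 0≤Z))
          0≤V             = ℚ.≤-trans (0≤‖‖ (⟦ v ⟧ᴳ 0𝔾)) (v≤ 0𝔾 (z≤⇒≤B {0𝔾} 0≤Z))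
          0≤S             = ℚ.≤-trans (0≤‖‖ (remainder R 0𝔾 0𝔾)) (s≤ 0𝔾 0𝔾 (z≤⇒≤B {0𝔾} 0≤Z) (0≤num 1))
          C               = Newton.C R u v bezout kκ≡1 κ≤1 u≤ v≤ s≤
          0≤C             = Newton.0≤C R u v bezout kκ≡1 κ≤1 u≤ v≤ s≤ 0≤U 0≤V 0≤S
          δ , 0<δ , _ , Cδ≤ = scale-below C (ε 0) 0≤C (0<ε 0)
          z₀ , z₀≤Z , Rz₀≤  = small δ 0<δ
          a₀              = Newton.mkApproximation z₀ (ℚ.≤-trans (*-monoʳ C 0≤C Rz₀≤) Cδ≤) (ℚ.+-monoˡ-≤ (2ℚ * ε 0) z₀≤Z)
      in from {R} {u} {v} bezout kκ≡1 κ≤1 u≤ v≤ s≤ 0≤U 0≤V 0≤S a₀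
      where
      from : ∀ {R u v k} (bezout : ∀ x →
        ⟦ u ⟧ x ℤ.* ⟦ R ⟧ x ℤ.+ ⟦ v ⟧ x ℤ.* ⟦ D R ⟧ x ≡ k) {κ} (kκ≡1 : ι k * κ ≡ 1ℚ) (κ≤1 : ∣ κ ∣ ≤ 1ℚ) {B U V S}
             (u≤ : ∀ z → ‖ z ‖ ≤ B → ‖ ⟦ u ⟧ᴳ z ‖ ≤ U) (v≤ : ∀ z → ‖ z ‖ ≤ B → ‖ ⟦ v ⟧ᴳ z ‖ ≤ V) (s≤ : ∀ z w →
                 ‖ z ‖ ≤ B → ‖ w ‖ ≤ 1ℚ → ‖ remainder R z w ‖ ≤ S) →
             0ℚ ≤ U → 0ℚ ≤ V → 0ℚ ≤ S → Newton.Approximation R u v bezout kκ≡1 κ≤1 u≤ v≤ s≤ 0 → ApproximateRoot R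
      from {R} {u} {v} bezout kκ≡1 κ≤1 {B} u≤ v≤ s≤ 0≤U 0≤V 0≤S a₀ = mkApproximateRoot (M.zs 0≤U 0≤V 0≤S a₀) B
        (λ n → M.z≤B 0≤U 0≤V 0≤S (M.iterates 0≤U 0≤V 0≤S a₀ n))
        (λ m n n≤m → subst (λ i → ‖ M.zs 0≤U 0≤V 0≤S a₀ i ⊖ M.zs 0≤U 0≤V 0≤S a₀ n ‖ ≤ 2ℚ * ε n) (ℕ.m+[n∸m]≡n n≤m)
          (ℚ.≤-trans (≤-by (2ℚ * ε (n ℕ.+ (m ℕ.∸ n))) (0≤* (0≤num 2) (ℚ.<⇒≤ (0<ε (n ℕ.+ (m ℕ.∸ n))))) refl)
              (M.zs-close 0≤U 0≤V 0≤S a₀ n (m ℕ.∸ n))))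
        (M.zs-value 0≤U 0≤V 0≤S a₀)
        where module M = Newton R u v bezout kκ≡1 κ≤1 u≤ v≤ s≤

-- From approximate roots to repeated complex roots

module ComplexRoots where

  open import Data.Rational.Base using (_+_; _*_; _-_; -_; _≤_; _<_; ∣_∣)
  open import Tactic.RingSolver using (solve-∀)
  open GaussianRationals
  open Directions
  open ApproximateRoots
  open NewtonIteration

  module 𝔾[X] = Polynomial (CommutativeRing.rawRing 𝔾-commutativeRing)
  module ℂ-ops = RawRing ℂ-rawRing

  -- The operations of ℂ act termwise on the sequences, so each approximation is a ring homomorphism definitionally.
  approx : ℕ → ℂ → 𝔾
  approx n z = ℝ.seq (ℂ.re z) n +ⁱ ℝ.seq (ℂ.im z) n

  ≈-from-approx : ∀ {x y c} → (∀ n → ‖ approx n x ⊖ approx n y ‖ ≤ c * ε n) → x ℂ-ops.≈ y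
  ≈-from-approx {x} {y} {c} close = (λ η 0<η → component (λ n → ∣re∣≤‖‖ (approx n x ⊖ approx n y)) η 0<η) ,
    (λ η 0<η → component (λ n → ∣im∣≤‖‖ (approx n x ⊖ approx n y)) η 0<η)
    where
    component : ∀ {d : ℕ → ℚ} → (∀ n → d n ≤ ‖ approx n x ⊖ approx n y ‖) → ∀ η → 0ℚ < η → ∃[ k ] (∀ n → k ℕ.≤ n → d n < η)
    component d≤ η 0<η = let k , small = ε-vanishes c η 0<η in k , λ n k≤n → ℚ.≤-<-trans (ℚ.≤-trans (d≤ n) (close n)) (small n k≤n)

  limit : ∀ {R} → ApproximateRoot R → ℂ
  limit root = component re (λ z w → ∣re∣≤‖‖ (z ⊖ w)) +i component im (λ z w → ∣im∣≤‖‖ (z ⊖ w))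
    where
    open ApproximateRoot root
    swap : ∀ z w → ‖ z ⊖ w ‖ ≡ ‖ w ⊖ z ‖
    swap z w = trans (cong ‖_‖ (eq z w)) (‖neg‖ (w ⊖ z))
      where
      eq : ∀ z w → z ∔ neg w ≡ neg (w ∔ neg z)
      eq = solve-∀ 𝔾-ring
    component : (f : 𝔾 → ℚ) → (∀ z w → ∣ f z - f w ∣ ≤ ‖ z ⊖ w ‖) → ℝ
    component f f≤ = record { seq = λ n → f (zs n) ; cauchy = λ η 0<η → let k , small = ε-vanishes 2ℚ η 0<η in k , λ m n k≤m k≤n →
      ℚ.≤-<-trans (f≤ (zs m) (zs n)) ([ (λ m≤n → ℚ.≤-<-trans (ℚ.≤-trans (ℚ.≤-reflexive (swap (zs m) (zs n)))
        (close n m m≤n)) (small m k≤m))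
                                     , (λ n≤m → ℚ.≤-<-trans (close m n n≤m) (small n k≤n)) ]′ (ℕ.≤-total m n)) }

  -- (p(X) − p(α)) / (X − α)
  module Quotient {c ℓ} (R : RawRing c ℓ) where
    open Polynomial R

    quotient : Poly → RawRing.Carrier R → Poly
    quotient []      α = []
    quotient (a ∷ p) α = eval p α ∷ quotient p α

  module ℂ-quotient = Quotient ℂ-rawRing
  module 𝔾-quotient = Quotient (CommutativeRing.rawRing 𝔾-commutativeRing)

  module _ (n : ℕ) where

    approxᴾ : List ℂ → List 𝔾
    approxᴾ = List.map (approx n)

    approx-eval : ∀ p α → approx n (ℂ[X].eval p α) ≡ 𝔾[X].eval (approxᴾ p) (approx n α)
    approx-eval []      α = refl
    approx-eval (a ∷ p) α = cong (λ t → approx n a ∔ approx n α · t) (approx-eval p α)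

    approx-quotient : ∀ p α → approxᴾ (ℂ-quotient.quotient p α) ≡ 𝔾-quotient.quotient (approxᴾ p) (approx n α)
    approx-quotient []      α = refl
    approx-quotient (a ∷ p) α = cong₂ _∷_ (approx-eval p α) (approx-quotient p α)

    approx-coeff : ∀ p k → approx n (ℂ[X].coeff p k) ≡ 𝔾[X].coeff (approxᴾ p) k
    approx-coeff []      k       = refl
    approx-coeff (a ∷ p) zero    = refl
    approx-coeff (a ∷ p) (suc k) = approx-coeff p k

    approx-+ᴾ : ∀ p q → approxᴾ (p ℂ[X].+ᴾ q) ≡ approxᴾ p 𝔾[X].+ᴾ approxᴾ q
    approx-+ᴾ []      q       = refl
    approx-+ᴾ (a ∷ p) []      = refl
    approx-+ᴾ (a ∷ p) (b ∷ q) = cong ((approx n a ∔ approx n b) ∷_) (approx-+ᴾ p q)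

    approx-scale : ∀ a p → approxᴾ (List.map (a ℂ-ops.*_) p) ≡ List.map (approx n a ·_) (approxᴾ p)
    approx-scale a []      = refl
    approx-scale a (b ∷ p) = cong ((approx n a · approx n b) ∷_) (approx-scale a p)

    approx-*ᴾ : ∀ p q → approxᴾ (p ℂ[X].*ᴾ q) ≡ approxᴾ p 𝔾[X].*ᴾ approxᴾ q
    approx-*ᴾ []      q = refl
    approx-*ᴾ (a ∷ p) q = trans (approx-+ᴾ (List.map (a ℂ-ops.*_) q) _) (cong₂ 𝔾[X]._+ᴾ_ (approx-scale a q)
      (cong (0𝔾 ∷_) (approx-*ᴾ p q)))

  coeff-+ᴾ : ∀ p q k → 𝔾[X].coeff (p 𝔾[X].+ᴾ q) k ≡ 𝔾[X].coeff p k ∔ 𝔾[X].coeff q k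
  coeff-+ᴾ []      q       k       = eq (𝔾[X].coeff q k)
    where
    eq : ∀ a → a ≡ 0𝔾 ∔ a
    eq = solve-∀ 𝔾-ring
  coeff-+ᴾ (a ∷ p) []      k       = eq (𝔾[X].coeff (a ∷ p) k)
    where
    eq : ∀ a → a ≡ a ∔ 0𝔾
    eq = solve-∀ 𝔾-ring
  coeff-+ᴾ (a ∷ p) (b ∷ q) zero    = refl
  coeff-+ᴾ (a ∷ p) (b ∷ q) (suc k) = coeff-+ᴾ p q k

  coeff-scale : ∀ a p k → 𝔾[X].coeff (List.map (a ·_) p) k ≡ a · 𝔾[X].coeff p k
  coeff-scale a []      k       = eq a
    where
    eq : ∀ a → 0𝔾 ≡ a · 0𝔾
    eq = solve-∀ 𝔾-ring
  coeff-scale a (b ∷ p) zero    = refl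
  coeff-scale a (b ∷ p) (suc k) = coeff-scale a p k

  module _ (l₀ l₁ l₂ : 𝔾) where

    -- A coefficient of the product with a quadratic polynomial, from three consecutive coefficients
    -- of the other factor in increasing degree.
    coeff-*ᴾ : 𝔾 → 𝔾 → 𝔾 → 𝔾
    coeff-*ᴾ a b c = c · l₀ ∔ b · l₁ ∔ a · l₂

    private
      L : List 𝔾
      L = l₀ ∷ l₁ ∷ l₂ ∷ []

    coeff-*ᴾ-cons : ∀ a q k → 𝔾[X].coeff ((a ∷ q) 𝔾[X].*ᴾ L) (suc k) ≡ a · 𝔾[X].coeff L (suc k) ∔ 𝔾[X].coeff (q 𝔾[X].*ᴾ L) k
    coeff-*ᴾ-cons a q k = trans (coeff-+ᴾ (List.map (a ·_) L) (0𝔾 ∷ (q 𝔾[X].*ᴾ L)) (suc k))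
      (cong (_∔ 𝔾[X].coeff (q 𝔾[X].*ᴾ L) k) (coeff-scale a L (suc k)))

    coeff-*ᴾ-0 : ∀ q → 𝔾[X].coeff (q 𝔾[X].*ᴾ L) 0 ≡ coeff-*ᴾ 0𝔾 0𝔾 (𝔾[X].coeff q 0)
    coeff-*ᴾ-0 []      = eq l₀ l₁ l₂
      where
      eq : ∀ x y z → 0𝔾 ≡ 0𝔾 · x ∔ 0𝔾 · y ∔ 0𝔾 · z
      eq = solve-∀ 𝔾-ring
    coeff-*ᴾ-0 (a ∷ q) = eq a l₀ l₁ l₂
      where
      eq : ∀ a x y z → a · x ∔ 0𝔾 ≡ a · x ∔ 0𝔾 · y ∔ 0𝔾 · z
      eq = solve-∀ 𝔾-ring

    coeff-*ᴾ-1 : ∀ q → 𝔾[X].coeff (q 𝔾[X].*ᴾ L) 1 ≡ coeff-*ᴾ 0𝔾 (𝔾[X].coeff q 0) (𝔾[X].coeff q 1)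
    coeff-*ᴾ-1 []      = eq l₀ l₁ l₂
      where
      eq : ∀ x y z → 0𝔾 ≡ 0𝔾 · x ∔ 0𝔾 · y ∔ 0𝔾 · z
      eq = solve-∀ 𝔾-ring
    coeff-*ᴾ-1 (a ∷ q) = trans (coeff-*ᴾ-cons a q 0) (trans (cong (a · l₁ ∔_) (coeff-*ᴾ-0 q)) (eq a (𝔾[X].coeff q 0) l₀ l₁ l₂))
      where
      eq : ∀ a b x y z → a · y ∔ (b · x ∔ 0𝔾 · y ∔ 0𝔾 · z) ≡ b · x ∔ a · y ∔ 0𝔾 · z
      eq = solve-∀ 𝔾-ring

    coeff-*ᴾ-2+ : ∀ q k → 𝔾[X].coeff (q 𝔾[X].*ᴾ L) (suc (suc k)) ≡ coeff-*ᴾ (𝔾[X].coeff q k) (𝔾[X].coeff q (suc k)) (𝔾[X].coeff q (suc (suc k)))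
    coeff-*ᴾ-2+ []      k       = eq l₀ l₁ l₂
      where
      eq : ∀ x y z → 0𝔾 ≡ 0𝔾 · x ∔ 0𝔾 · y ∔ 0𝔾 · z
      eq = solve-∀ 𝔾-ring
    coeff-*ᴾ-2+ (a ∷ q) zero    = trans (coeff-*ᴾ-cons a q 1) (trans (cong (a · l₂ ∔_) (coeff-*ᴾ-1 q))
      (eq a (𝔾[X].coeff q 0) (𝔾[X].coeff q 1) l₀ l₁ l₂))
      where
      eq : ∀ a b c x y z → a · z ∔ (c · x ∔ b · y ∔ 0𝔾 · z) ≡ c · x ∔ b · y ∔ a · z
      eq = solve-∀ 𝔾-ring
    coeff-*ᴾ-2+ (a ∷ q) (suc k) = trans (coeff-*ᴾ-cons a q (suc (suc k))) (trans (cong (a · 0𝔾 ∔_) (coeff-*ᴾ-2+ q k))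
      (eq a (coeff-*ᴾ (𝔾[X].coeff q k) (𝔾[X].coeff q (suc k)) (𝔾[X].coeff q (suc (suc k))))))
      where
      eq : ∀ a t → a · 0𝔾 ∔ t ≡ t
      eq = solve-∀ 𝔾-ring

  module _ (l : List 𝔾) (α : 𝔾) where
    open 𝔾-quotient using (quotient)

    quotient-0 : 𝔾[X].coeff l 0 ≡ neg α · 𝔾[X].coeff (quotient l α) 0 ∔ 𝔾[X].eval l α
    quotient-0 = go l
      where
      eq : ∀ a → 0𝔾 ≡ neg a · 0𝔾 ∔ 0𝔾
      eq = solve-∀ 𝔾-ring
      eq′ : ∀ a b e → b ≡ neg a · e ∔ (b ∔ a · e)
      eq′ = solve-∀ 𝔾-ring
      go : ∀ l → 𝔾[X].coeff l 0 ≡ neg α · 𝔾[X].coeff (quotient l α) 0 ∔ 𝔾[X].eval l α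
      go []      = eq α
      go (b ∷ l) = eq′ α b (𝔾[X].eval l α)

  quotient-suc : ∀ l α k → 𝔾[X].coeff l (suc k) ≡ 𝔾[X].coeff (𝔾-quotient.quotient l α) k ∔ neg α · 𝔾[X].coeff (𝔾-quotient.quotient l α) (suc k)
  quotient-suc []      α k       = eq α
    where
    eq : ∀ a → 0𝔾 ≡ 0𝔾 ∔ neg a · 0𝔾
    eq = solve-∀ 𝔾-ring
  quotient-suc (a ∷ l) α zero    = trans (quotient-0 l α) (eq (neg α · 𝔾[X].coeff (𝔾-quotient.quotient l α) 0) (𝔾[X].eval l α))
    where
    eq : ∀ a b → a ∔ b ≡ b ∔ a
    eq = solve-∀ 𝔾-ring
  quotient-suc (a ∷ l) α (suc k) = quotient-suc l α k

  -- l differs from q₂ (X − α)² by its Taylor polynomial l(α) + l′(α)(X − α) in the constant and linear coefficients.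
  taylor-coefficients : ∀ (l : List 𝔾) α → let q₁ = 𝔾-quotient.quotient l α ; q₂ = 𝔾-quotient.quotient q₁ α in ∀ k →
    ‖ 𝔾[X].coeff (q₂ 𝔾[X].*ᴾ ((𝔾[X].X- α) 𝔾[X].^ 2)) k ⊖ 𝔾[X].coeff l k ‖ ≤ ‖ 𝔾[X].eval l α ‖ + (‖ α ‖ + 1ℚ) * ‖ 𝔾[X].eval q₁ α ‖
  taylor-coefficients l α = bound
    where
    q₁ = 𝔾-quotient.quotient l α
    q₂ = 𝔾-quotient.quotient q₁ α
    E = 𝔾[X].eval l α
    E′ = 𝔾[X].eval q₁ α
    c = 𝔾[X].coeff q₂
    l₀ l₁ l₂ : 𝔾
    l₀ = neg α · (neg α · 1𝔾 ∔ 0𝔾) ∔ 0𝔾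
    l₁ = neg α · 1𝔾 ∔ (1𝔾 · (neg α · 1𝔾 ∔ 0𝔾) ∔ 0𝔾)
    l₂ = 1𝔾 · 1𝔾
    square : (𝔾[X].X- α) 𝔾[X].^ 2 ≡ l₀ ∷ l₁ ∷ l₂ ∷ []
    square = refl
    difference : ℕ → 𝔾
    difference k = 𝔾[X].coeff (q₂ 𝔾[X].*ᴾ (l₀ ∷ l₁ ∷ l₂ ∷ [])) k ⊖ 𝔾[X].coeff l k
    difference-0 : difference 0 ≡ α · E′ ⊖ E
    difference-0 = trans (cong₂ _⊖_ (coeff-*ᴾ-0 l₀ l₁ l₂ q₂) (trans (quotient-0 l α) (cong (λ t → neg α · t ∔ E)
      (quotient-0 q₁ α)))) (eq α (c 0) E E′)
      where
      eq : ∀ α c E E′ → (c · (neg α · (neg α · 1𝔾 ∔ 0𝔾) ∔ 0𝔾) ∔ 0𝔾 · (neg α · 1𝔾 ∔ (1𝔾 · (neg α · 1𝔾 ∔ 0𝔾) ∔ 0𝔾)) ∔ 0𝔾 · (1𝔾 · 1𝔾)) ∔ neg (neg α · (neg α · c ∔ E′) ∔ E) ≡ α · E′ ∔ neg E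
      eq = solve-∀ 𝔾-ring
    difference-1 : difference 1 ≡ neg E′
    difference-1 = trans (cong₂ _⊖_ (coeff-*ᴾ-1 l₀ l₁ l₂ q₂) (trans (quotient-suc l α 0)
      (cong₂ (λ s t → s ∔ neg α · t) (quotient-0 q₁ α) (quotient-suc q₁ α 0)))) (eq α (c 0) (c 1) E′)
      where
      eq : ∀ α b c E′ → (c · (neg α · (neg α · 1𝔾 ∔ 0𝔾) ∔ 0𝔾) ∔ b · (neg α · 1𝔾 ∔ (1𝔾 · (neg α · 1𝔾 ∔ 0𝔾) ∔ 0𝔾)) ∔ 0𝔾 · (1𝔾 · 1𝔾)) ∔ neg ((neg α · b ∔ E′) ∔ neg α · (b ∔ neg α · c)) ≡ neg E′
      eq = solve-∀ 𝔾-ring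
    difference-2+ : ∀ k → difference (suc (suc k)) ≡ 0𝔾
    difference-2+ k = trans (cong₂ _⊖_ (coeff-*ᴾ-2+ l₀ l₁ l₂ q₂ k) (trans (quotient-suc l α (suc k))
      (cong₂ (λ s t → s ∔ neg α · t) (quotient-suc q₁ α k) (quotient-suc q₁ α (suc k)))))
      (eq α (c k) (c (suc k)) (c (suc (suc k))))
      where
      eq : ∀ α a b c → (c · (neg α · (neg α · 1𝔾 ∔ 0𝔾) ∔ 0𝔾) ∔ b · (neg α · 1𝔾 ∔ (1𝔾 · (neg α · 1𝔾 ∔ 0𝔾) ∔ 0𝔾)) ∔ a · (1𝔾 · 1𝔾)) ∔ neg ((a ∔ neg α · b) ∔ neg α · (b ∔ neg α · c)) ≡ 0𝔾
      eq = solve-∀ 𝔾-ring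
    bound : ∀ k → ‖ difference k ‖ ≤ ‖ E ‖ + (‖ α ‖ + 1ℚ) * ‖ E′ ‖
    bound zero          = ℚ.≤-trans (ℚ.≤-reflexive (cong ‖_‖ difference-0)) (ℚ.≤-trans (‖⊖‖ (α · E′) E)
      (ℚ.≤-trans (ℚ.+-monoˡ-≤ ‖ E ‖ (‖·‖ α E′))
      (≤-by ‖ E′ ‖ (0≤‖‖ E′) (eq (‖ α ‖) (‖ E ‖) (‖ E′ ‖)))))
      where
      eq : ∀ a e e′ → a * e′ + e + e′ ≡ e + (a + 1ℚ) * e′
      eq = solve-∀ ℚ-ring
    bound (suc zero)    = ℚ.≤-trans (ℚ.≤-reflexive (trans (cong ‖_‖ difference-1) (‖neg‖ E′)))
      (≤-by (‖ E ‖ + ‖ α ‖ * ‖ E′ ‖) (0≤+ (0≤‖‖ E) (0≤* (0≤‖‖ α) (0≤‖‖ E′))) (eq (‖ α ‖) (‖ E ‖) (‖ E′ ‖)))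
      where
      eq : ∀ a e e′ → e′ + (e + a * e′) ≡ e + (a + 1ℚ) * e′
      eq = solve-∀ ℚ-ring
    bound (suc (suc k)) = ℚ.≤-trans (ℚ.≤-reflexive (cong ‖_‖ (difference-2+ k))) (0≤+ (0≤‖‖ E)
      (0≤* (0≤+ (0≤‖‖ α) (0≤num 1)) (0≤‖‖ E′)))

  eval-ι𝔾 : ∀ f z → 𝔾[X].eval (List.map ι𝔾 f) z ≡ ⟦ fromList f ⟧ᴳ z
  eval-ι𝔾 []      z = refl
  eval-ι𝔾 (a ∷ f) z = cong (λ t → ι𝔾 a ∔ z · t) (eval-ι𝔾 f z)

  -- Synthetic division and the product rule for `a + X p` give the same recursion: the new value is
  -- `p(z)` plus `z` times the old one.
  eval-quotient : ∀ f z → 𝔾[X].eval (𝔾-quotient.quotient (List.map ι𝔾 f) z) z ≡ ⟦ D (fromList f) ⟧ᴳ z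
  eval-quotient []      z = refl
  eval-quotient (a ∷ f) z = trans (cong₂ (λ s t → s ∔ z · t) (eval-ι𝔾 f z) (eval-quotient f z))
    (eq (⟦ fromList f ⟧ᴳ z) z (⟦ D (fromList f) ⟧ᴳ z))
    where
    eq : ∀ p z d → p ∔ z · d ≡ 0𝔾 ∔ (1𝔾 · p ∔ z · d)
    eq = solve-∀ 𝔾-ring

  approx-fromℤ : ∀ n f → approxᴾ n (List.map fromℤ f) ≡ List.map ι𝔾 f
  approx-fromℤ n []      = refl
  approx-fromℤ n (a ∷ f) = cong (ι𝔾 a ∷_) (approx-fromℤ n f)

  opaque
    ∣ᴱ-value : ∀ {R p} (root : ApproximateRoot R) → R ∣ᴱ p → ∃[ C ] (0ℚ ≤ C × (∀ n →
      ‖ ⟦ p ⟧ᴳ (ApproximateRoot.zs root n) ‖ ≤ C * ε n))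
    ∣ᴱ-value {R} {p} root (mk∣ k k≢0 s e) =
      let C , s≤ = ⟦⟧ᴳ-bounded B s
      in C , ℚ.≤-trans (0≤‖‖ (⟦ s ⟧ᴳ (zs 0))) (s≤ (zs 0) (zs≤B 0)) , λ n →
           ℚ.≤-trans (ℚ.≤-trans (ℚ.≤-reflexive (sym (ℚ.*-identityˡ ‖ ⟦ p ⟧ᴳ (zs n) ‖))) (ℚ.≤-trans (*-monoˡ ‖ ⟦ p ⟧ᴳ
             (zs n) ‖ (0≤‖‖ (⟦ p ⟧ᴳ (zs n))) (1≤∣ι∣ k≢0)) (ℚ.≤-reflexive (sym (‖real·‖ (ι k) (⟦ p ⟧ᴳ (zs n)))))))
             (ℚ.≤-trans (ℚ.≤-reflexive (cong ‖_‖ (≐⇒≡ᴳ (con k ⊗ p) (R ⊗ s) e (zs n))))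
                 (ℚ.≤-trans (·-≤ {⟦ R ⟧ᴳ (zs n)} (value n) (s≤ (zs n) (zs≤B n))) (ℚ.≤-reflexive (ℚ.*-comm (ε n) C))))
      where open ApproximateRoot root

  module _ (f : List ℤ) (α : ℂ) where

    private
      F : List ℂ
      F = List.map fromℤ f
      q₂ : List ℂ
      q₂ = ℂ-quotient.quotient (ℂ-quotient.quotient F α) α
      square : List ℂ
      square = (ℂ[X].X- α) ℂ[X].^ 2
      q₂ᴳ : ℕ → List 𝔾
      q₂ᴳ n = 𝔾-quotient.quotient (𝔾-quotient.quotient (List.map ι𝔾 f) (approx n α)) (approx n α)

    approx-dividend : ∀ n k → approx n (ℂ[X].coeff F k) ≡ 𝔾[X].coeff (List.map ι𝔾 f) k
    approx-dividend n k = trans (approx-coeff n F k) (cong (λ l → 𝔾[X].coeff l k) (approx-fromℤ n f))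

    approx-q₂ : ∀ n → approxᴾ n q₂ ≡ q₂ᴳ n
    approx-q₂ n = trans (approx-quotient n (ℂ-quotient.quotient F α) α) (cong (λ l → 𝔾-quotient.quotient l (approx n α))
      (trans (approx-quotient n F α) (cong (λ l → 𝔾-quotient.quotient l (approx n α)) (approx-fromℤ n f))))

    approx-product : ∀ n k → approx n (ℂ[X].coeff (q₂ ℂ[X].*ᴾ square) k) ≡ 𝔾[X].coeff (q₂ᴳ n 𝔾[X].*ᴾ ((𝔾[X].X- approx n α) 𝔾[X].^ 2)) k
    approx-product n k = trans (approx-coeff n (q₂ ℂ[X].*ᴾ square) k) (cong (λ l → 𝔾[X].coeff l k)
      (trans (approx-*ᴾ n q₂ square) (cong (λ l → l 𝔾[X].*ᴾ ((𝔾[X].X- approx n α) 𝔾[X].^ 2)) (approx-q₂ n))))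

    -- The division by `(X − α)²` is performed on the approximations of `α`, where each coefficient
    -- is off by at most what `f` and `f′` contribute there. Equality in ℂ only asks these errors to
    -- tend to 0.
    small-values⇒repeated-root : ∀ {c} →
      (∀ n → ‖ ⟦ fromList f ⟧ᴳ (approx n α) ‖ + (‖ approx n α ‖ + 1ℚ) * ‖ ⟦ D (fromList f) ⟧ᴳ (approx n α) ‖ ≤ c * ε n) →
                                 ℂ[X].RepeatedRoot F α
    small-values⇒repeated-root {c} small = q₂ RawMagma., λ k → ≈-from-approx {ℂ[X].coeff
      (q₂ ℂ[X].*ᴾ square) k} {ℂ[X].coeff F k} {c} λ n → difference≤ n k
      where
      difference≤ : ∀ n k → ‖ approx n (ℂ[X].coeff (q₂ ℂ[X].*ᴾ square) k) ⊖ approx n (ℂ[X].coeff F k) ‖ ≤ c * ε n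
      difference≤ n k = ℚ.≤-trans (ℚ.≤-reflexive (cong ‖_‖ (cong₂ _⊖_ (approx-product n k) (approx-dividend n k))))
        (ℚ.≤-trans (taylor-coefficients (List.map ι𝔾 f) (approx n α) k)
          (ℚ.≤-trans (ℚ.≤-reflexive (cong₂ (λ s t → ‖ s ‖ + (‖ approx n α ‖ + 1ℚ) * ‖ t ‖) (eval-ι𝔾 f (approx n α))
              (eval-quotient f (approx n α)))) (small n)))

  repeated-root : ∀ {R} f (root : ApproximateRoot R) → R ∣ᴱ fromList f → R ∣ᴱ D (fromList f) →
    ∃[ α ] ℂ[X].RepeatedRoot (List.map fromℤ f) α
  repeated-root f root R∣f R∣f′ =
    let C , 0≤C , f≤   = ∣ᴱ-value root R∣f
        C′ , 0≤C′ , f′≤ = ∣ᴱ-value root R∣f′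
    in limit root , small-values⇒repeated-root f (limit root) {C + (B + 1ℚ) * C′} λ n → ℚ.≤-trans
         (ℚ.+-mono-≤ (f≤ n) (*-mono (0≤+ (0≤‖‖ (zs n)) (0≤num 1)) (0≤* 0≤C′ (ℚ.<⇒≤ (0<ε n))) (ℚ.+-monoˡ-≤ 1ℚ (zs≤B n)) (f′≤ n)))
         (ℚ.≤-reflexive (eq C (B + 1ℚ) C′ (ε n)))
    where
    open ApproximateRoot root
    eq : ∀ c b c′ e → c * e + b * (c′ * e) ≡ (c + b * c′) * e
    eq = solve-∀ ℚ-ring

  nonconstant-∣-constant : ∀ {p n c} → Deg p (suc n) → c ≢ 0ℤ → ¬ p ∣ᴱ con c
  nonconstant-∣-constant {p} {n} {c} deg c≢0 (mk∣ k k≢0 r e) =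
    let x₀ , large = Deg-large deg (suc ℤ.∣ k ℤ.* c ∣)
        x          = ℤ.+ x₀
        r≢0 : ⟦ r ⟧ x ≢ 0ℤ
        r≢0 = nonzeroʳ {⟦ p ⟧ x} {⟦ r ⟧ x} λ pr≡0 → *-nonzero {k} k≢0 c≢0 (trans (e x) pr≡0)
    in ℕ.<⇒≱ (large x ℕ.≤-refl) (ℕ.≤-trans (ℕ.m≤m*n (ℤ.∣ ⟦ p ⟧ x ∣) (ℤ.∣ ⟦ r ⟧ x ∣) {{ℕ.>-nonZero (nonzero⇒1≤ r≢0)}})
         (ℕ.≤-reflexive (trans (sym (ℤ.abs-* (⟦ p ⟧ x) (⟦ r ⟧ x))) (cong ℤ.∣_∣ (sym (e x))))))

  constant-^^ : ∀ {p c} → c ≢ 0ℤ → p ≐ con c → ∀ n → ∃[ d ] (d ≢ 0ℤ × p ^^ n ≐ con d)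
  constant-^^ c≢0 p≐c zero    = 1ℤ , (λ ()) , λ x → refl
  constant-^^ {c = c} c≢0 p≐c (suc n) = let d , d≢0 , pⁿ≐d = constant-^^ c≢0 p≐c n in c ℤ.* d , *-nonzero {c} c≢0 d≢0 , λ x → cong₂ ℤ._*_ (p≐c x) (pⁿ≐d x)

  separable⇒squarefree : ∀ f {d} → Separable f → Deg (fromList f) d → Squarefree (fromList f)
  separable⇒squarefree f {d} separable deg = from (factorise (fromList f) (D (fromList f)) f≢0)
    where
    f≢0 : EventuallyNonzero (fromList f)
    f≢0 = Deg⇒EventuallyNonzero deg
    from : Factorisation (fromList f) (D (fromList f)) → Squarefree (fromList f)
    from F = by-degree (EventuallyNonzero⇒Deg′ g≢0)
      where
      open Factorisation F
      g≢0 : EventuallyNonzero g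
      g≢0 = ∣-EventuallyNonzero g∣p f≢0
      by-degree : ∃ (Deg g) → Squarefree (fromList f)
      by-degree (zero , degg)  = constant-gcd⇒Squarefree f≢0 F degg
      by-degree (suc i , degg) = by-part (squarefree-part g g≢0)
        where
        by-part : ∃[ R ] (Squarefree R × R ∣ᴱ g × ∃[ m ] g ∣ᴱ R ^^ m) → Squarefree (fromList f)
        by-part (R , sf , R∣g , m , g∣Rᵐ) = root (EventuallyNonzero⇒Deg′ (∣-EventuallyNonzero R∣g g≢0))
          where
          root : ∃ (Deg R) → Squarefree (fromList f)
          -- With a constant `R`, the nonconstant `g` would divide the constant `Rᵐ`.
          root (zero , degR)  = let c , c≢0 , R≐c = Deg-0 degR
                                    e , e≢0 , Rᵐ≐e = constant-^^ {R} c≢0 R≐c m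
                                in ⊥-elim (nonconstant-∣-constant degg e≢0 (∣-trans g∣Rᵐ (≐⇒∣ Rᵐ≐e)))
          root (suc j , degR) = let α , repeated = repeated-root f (squarefree-root sf degR) (∣-trans R∣g g∣p) (∣-trans R∣g g∣q)
                                in ⊥-elim (separable α repeated)

open ComplexRoots using (separable⇒squarefree)

-- Belyi's theorem for polynomials

module BelyiMaps where

  open import Data.Integer.Base using (+_; -_; _+_; _*_; _-_; ∣_∣)
  open import Data.Integer.Tactic.RingSolver using (solve-∀)
  open import Data.List.Sort ℤ.≤-decTotalOrder using (sort; sort-↭; sort-↗)

  Deg-⊕-lower : ∀ {p q n} → Deg p n → q <° n → Deg (p ⊕ q) n
  Deg-⊕-lower {p} {q} {n} (mkDeg p₀ c p₀<n c≢0 p≐) q<n = mkDeg (p₀ ⊕ q) c (<°-⊕ p₀<n q<n) c≢0 λ x →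
    trans (cong (_+ ⟦ q ⟧ x) (p≐ x)) (swap (⟦ p₀ ⟧ x) (c * ⟦ X ^^ n ⟧ x) (⟦ q ⟧ x))
    where
    swap : ∀ a b c → a + b + c ≡ a + c + b
    swap = solve-∀

  Deg-X^^ : ∀ n → Deg (X ^^ n) n
  Deg-X^^ n = mkDeg (con 0ℤ) 1ℤ (<°-zero n) (λ ()) λ x → sym (trans (ℤ.+-identityˡ (1ℤ * ⟦ X ^^ n ⟧ x))
    (ℤ.*-identityˡ (⟦ X ^^ n ⟧ x)))

  module _ (Q : Expr) where

    -- `r` represents `M(Q)` modulo `Q′`. The degree of `M` is recorded because it certifies that
    -- `M` stays nonzero during the elimination.
    record Relation (n i : ℕ) : Set where
      constructor mkRelation
      field
        M s r    : Expr
        deg      : Deg M i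
        small    : r <° n
        equation : ∀ x → ⟦ M ⟧ (⟦ Q ⟧ x) ≡ ⟦ D Q ⟧ x * ⟦ s ⟧ x + ⟦ r ⟧ x

    -- Relations of pairwise distinct degrees in [lo, hi); distinctness survives Gaussian elimination of the remainders.
    data Relations (n hi : ℕ) : ℕ → ℕ → Set where
      []   : ∀ {lo} → Relations n hi lo 0
      cons : ∀ {lo len i} → lo ℕ.≤ i → i ℕ.< hi → Relation n i → Relations n hi (suc i) len → Relations n hi lo (suc len)

    weaken-lo : ∀ {n hi lo lo′ len} → lo ℕ.≤ lo′ → Relations n hi lo′ len → Relations n hi lo len
    weaken-lo lo≤lo′ []                  = []
    weaken-lo lo≤lo′ (cons lo′≤i i<hi e es) = cons (ℕ.≤-trans lo≤lo′ lo′≤i) i<hi e es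

    module _ {n i : ℕ} (e : Relation (suc n) i) {r₀ a} (r₀<n : r₀ <° n) (r≐ : Relation.r e ≐ r₀ ⊕ con a ⊗ X ^^ n) (a≢0 : a ≢ 0ℤ) where

      -- The subtracted multiple of `e` has degree `i < j` in the `M` component, so the degree of
      -- `M` is unchanged.
      reduce : ∀ {j} → i ℕ.< j → Relation (suc n) j → Relation n j
      reduce {j} i<j f =
        let r₀′ , b , r₀′<n , r′≐ = <°-split (Relation.small f)
        in mkRelation (con a ⊗ F.M ⊕ con (- b) ⊗ E.M) (con a ⊗ F.s ⊕ con (- b) ⊗ E.s) (con a ⊗ r₀′ ⊕ con (- b) ⊗ r₀)
          (Deg-⊕-lower (Deg-scale a≢0 F.deg) (<°-scale (- b) (<°-weaken i<j (Deg-<° E.deg))))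
          (<°-⊕ (<°-scale a r₀′<n) (<°-scale (- b) r₀<n))
          λ x → trans (cong₂ (λ u v → a * u + (- b) * v)
              (trans (F.equation x) (cong (λ t → ⟦ D Q ⟧ x * ⟦ F.s ⟧ x + t) (r′≐ x)))
              (trans (E.equation x) (cong (λ t → ⟦ D Q ⟧ x * ⟦ E.s ⟧ x + t) (r≐ x))))
            (eq a b (⟦ D Q ⟧ x) (⟦ F.s ⟧ x) (⟦ r₀′ ⟧ x) (⟦ X ^^ n ⟧ x) (⟦ E.s ⟧ x) (⟦ r₀ ⟧ x))
        where
        module E = Relation e
        module F = Relation f
        eq : ∀ a b d s r y t q → a * (d * s + (r + b * y)) + (- b) * (d * t + (q + a * y)) ≡ d * (a * s + (- b) * t) + (a * r + (- b) * q)
        eq = solve-∀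

      reduce-all : ∀ {hi lo len} → i ℕ.< lo → Relations (suc n) hi lo len → Relations n hi lo len
      reduce-all i<lo []                     = []
      reduce-all i<lo (cons lo≤j j<hi f fs) = cons lo≤j j<hi (reduce (ℕ.<-≤-trans i<lo lo≤j) f) (reduce-all
        (ℕ.m<n⇒m<1+n (ℕ.<-≤-trans i<lo lo≤j)) fs)

    lower : ∀ {n i r₀ a} (e : Relation (suc n) i) → r₀ <° n → Relation.r e ≐ r₀ ⊕ con a ⊗ X ^^ n → a ≡ 0ℤ → Relation n i
    lower {n} {r₀ = r₀} (mkRelation M s r deg _ eq) r₀<n r≐ a≡0 =
      mkRelation M s r deg (<°-resp (λ x → trans (r≐ x) (drop-zero-term {r₀} {n = n} a≡0 x)) r₀<n) eq

    eliminate : ∀ {n hi lo len} → Relations (suc n) hi lo (suc len) → Relations n hi lo len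
    eliminate         (cons lo≤i i<hi e [])            = []
    eliminate {n} {hi} {lo} (cons {i = i} lo≤i i<hi e es@(cons _ _ _ _)) = pivot (<°-split (Relation.small e))
      where
      pivot : (∃[ r₀ ] ∃[ a ] (r₀ <° n × Relation.r e ≐ r₀ ⊕ con a ⊗ X ^^ n)) → Relations n hi lo _
      pivot (r₀ , a , r₀<n , r≐) with a ℤ.≟ 0ℤ
      ... | yes a≡0 = cons lo≤i i<hi (lower e r₀<n r≐ a≡0) (eliminate es)
      -- The pivot `e` is spent on clearing the terms of degree `n` in all the other relations; it
      -- is the one entry lost per round.
      ... | no  a≢0 = weaken-lo (ℕ.≤-trans lo≤i (ℕ.n≤1+n i)) (reduce-all e r₀<n r≐ a≢0 ℕ.≤-refl es)

    eliminate-all : ∀ n {hi lo} → Relations n hi lo (suc n) → Relations 0 hi lo 1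
    eliminate-all zero    es = es
    eliminate-all (suc n) es = eliminate-all n (eliminate es)

    power-relations : ∀ {m} → Deg (D Q) m → ∀ len {lo hi} → lo ℕ.+ len ℕ.≤ hi → Relations m hi lo len
    power-relations deg zero         h = []
    power-relations {m} deg (suc len) {lo} {hi} h =
      let k , s , r , k≢0 , r<m , e = pseudo-division deg (length (toList (Q ^^ lo))) {Q ^^ lo} (<°-weaken (ℕ.m≤n+m _ m) (<°-toList (Q ^^ lo)))
      in cons ℕ.≤-refl (ℕ.≤-trans (ℕ.≤-reflexive (ℕ.+-comm 1 lo)) (ℕ.≤-trans (ℕ.+-monoʳ-≤ lo (s≤s z≤n)) h))
           (mkRelation (con k ⊗ X ^^ lo) s r (Deg-scale k≢0 (Deg-X^^ lo)) r<m λ x → trans (cong (k *_)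
               (X^^∘ lo (⟦ Q ⟧ x) x refl)) (e x))
           (power-relations deg len (subst (ℕ._≤ hi) (ℕ.+-suc lo len) h))
      where
      X^^∘ : ∀ n y x → y ≡ ⟦ Q ⟧ x → ⟦ X ^^ n ⟧ y ≡ ⟦ Q ^^ n ⟧ x
      X^^∘ zero    y x eq = refl
      X^^∘ (suc n) y x eq = cong₂ _*_ eq (X^^∘ n y x eq)

    opaque
      -- `M` vanishes at the critical values of `Q`. It plays the part of a resultant, but arises by
      -- linear algebra: modulo `Q′`, of degree `m`, the `1 + m` powers `1, Q, …, Qᵐ` are dependent.
      -- Its degree is thus at most `m`, below that of `Q`.
      critical-values : ∀ {m} → Deg Q (suc m) → ∃[ M ] (EventuallyNonzero M × M <° suc m × D Q ∣ᴱ M ∘ᴱ Q)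
      critical-values {m} deg = found (eliminate-all m (power-relations (Deg-D deg) (suc m) {0} ℕ.≤-refl))
        where
        found : Relations 0 (suc m) 0 1 → ∃[ M ] (EventuallyNonzero M × M <° suc m × D Q ∣ᴱ M ∘ᴱ Q)
        found (cons _ i≤m (mkRelation M s r degM r<0 eq) []) = M , Deg⇒EventuallyNonzero degM , <°-weaken i≤m (Deg-<° degM) ,
          mk∣ 1ℤ (λ ()) s λ x → trans (ℤ.*-identityˡ (⟦ M ∘ᴱ Q ⟧ x)) (trans (⟦∘ᴱ⟧ M Q x) (trans (eq x)
            (trans (cong (λ t → ⟦ D Q ⟧ x * ⟦ s ⟧ x + t) (<°0⇒≐0 r<0 x)) (ℤ.+-identityʳ (⟦ D Q ⟧ x * ⟦ s ⟧ x)))))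

  X-_ : ℤ → Expr
  X- a = X ⊕ con (- a)

  roots : List ℤ → Expr
  roots []      = con 1ℤ
  roots (a ∷ l) = (X- a) ⊗ roots l

  -- φ sends the roots of W, and its own critical points, into {0, μ}.
  record Belyi (W : Expr) : Set where
    constructor mkBelyi
    field
      φ      : Expr
      μ      : ℤ
      μ≢0    : μ ≢ 0ℤ
      φ′≢0   : EventuallyNonzero (D φ)
      covers : ∀ {s} → Squarefree s → ∀ n → s ∣ᴱ W ^^ n → D φ ⊗ s ∣ᴱ φ ⊗ (φ ⊕ con (- μ))

  Belyi-∣^^ : ∀ {V W} n → V ∣ᴱ W ^^ n → Belyi W → Belyi V
  Belyi-∣^^ n V∣Wⁿ (mkBelyi φ μ μ≢0 φ′≢0 covers) = mkBelyi φ μ μ≢0 φ′≢0 λ sf m s∣Vᵐ → covers sf (m ℕ.* n)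
    (∣-^^-trans m n s∣Vᵐ V∣Wⁿ)

  Belyi-∣ : ∀ {V W} → V ∣ᴱ W → Belyi W → Belyi V
  Belyi-∣ V∣W = Belyi-∣^^ 1 (∣-^¹ V∣W)

  ^^-∘ᴱ : ∀ T n φ x → ⟦ (T ^^ n) ∘ᴱ φ ⟧ x ≡ ⟦ (T ∘ᴱ φ) ^^ n ⟧ x
  ^^-∘ᴱ T zero    φ x = refl
  ^^-∘ᴱ T (suc n) φ x = cong (⟦ T ∘ᴱ φ ⟧ x *_) (^^-∘ᴱ T n φ x)

  -- `W` holds the critical values of `φ` and the images of the roots of `V`. For its squarefree
  -- part `T`, the map `ψ` gives `ψ′ T ∣ ψ (ψ − μ)`. After substitution of `φ`, the Riemann-Hurwitz
  -- step puts `φ′ s` in place of `T ∘ φ`, and the chain rule assembles the derivative of `ψ ∘ φ`.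
  Belyi-∘ : ∀ {V W φ} → EventuallyNonzero W → EventuallyNonzero (D φ) → D φ ∣ᴱ W ∘ᴱ φ → V ∣ᴱ W ∘ᴱ φ → Belyi W → Belyi V
  Belyi-∘ {V} {W} {φ} W≢0 φ′≢0 φ′∣Wφ V∣Wφ (mkBelyi ψ μ μ≢0 ψ′≢0 covers) = go (squarefree-part W W≢0)
    (EventuallyNonzero-D⇒Deg φ′≢0)
    where
    go : ∃[ T ] (Squarefree T × T ∣ᴱ W × ∃[ m ] W ∣ᴱ T ^^ m) → ∃[ n ] Deg φ (suc n) → Belyi V
    go (T , sfT , T∣W , m , W∣Tᵐ) (_ , deg) = mkBelyi (ψ ∘ᴱ φ) μ μ≢0
      (EventuallyNonzero-resp (λ x nz → subst (_≢ 0ℤ) (trans (cong (_* ⟦ D φ ⟧ x) (⟦∘ᴱ⟧ (D ψ) φ x)) (sym (D-∘ᴱ ψ φ x))) nz)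
        (EventuallyNonzero-⊗ (EventuallyNonzero-∘ ψ′≢0 deg) φ′≢0))
      λ {s} sf n s∣Vⁿ → ∣-trans (≐⇒∣ λ x → chain s x) (∣-trans
        (⊗-mono-∣ (∣-refl {D ψ ∘ᴱ φ}) (riemann-hurwitz {T} {φ} {s} (EventuallyNonzero-∘
            (Squarefree⇒EventuallyNonzero sfT) deg) φ′≢0 sf (n ℕ.* m) m
          (∣-^^-trans n m s∣Vⁿ (∣-trans V∣Wφ Wφ∣Tφᵐ)) (∣-trans φ′∣Wφ Wφ∣Tφᵐ)))
        (∘-mono-∣ {D ψ ⊗ T} {ψ ⊗ (ψ ⊕ con (- μ))} φ (covers sfT 1 (∣-^¹ T∣W))))
      where
      Wφ∣Tφᵐ : W ∘ᴱ φ ∣ᴱ (T ∘ᴱ φ) ^^ m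
      Wφ∣Tφᵐ = ∣-trans (∘-mono-∣ φ W∣Tᵐ) (≐⇒∣ (^^-∘ᴱ T m φ))
      chain : ∀ s x → ⟦ D (ψ ∘ᴱ φ) ⟧ x * ⟦ s ⟧ x ≡ ⟦ D ψ ∘ᴱ φ ⟧ x * (⟦ D φ ⟧ x * ⟦ s ⟧ x)
      chain s x = trans (cong (_* ⟦ s ⟧ x) (trans (D-∘ᴱ ψ φ x) (cong (_* ⟦ D φ ⟧ x) (sym (⟦∘ᴱ⟧ (D ψ) φ x)))))
        (ℤ.*-assoc (⟦ D ψ ∘ᴱ φ ⟧ x) (⟦ D φ ⟧ x) (⟦ s ⟧ x))

  factor-theorem : ∀ a p → X- a ∣ᴱ p ⊕ con (- ⟦ p ⟧ a)
  factor-theorem a p = let q , e = quotient p in mk∣ 1ℤ (λ ()) q λ x → trans (ℤ.*-identityˡ _) (e x)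
    where
    quotient : ∀ p → ∃[ q ] (∀ x → ⟦ p ⟧ x + - ⟦ p ⟧ a ≡ (x + - a) * ⟦ q ⟧ x)
    quotient (con c) = con 0ℤ , λ x → eq x a c
      where
      eq : ∀ x a c → c + - c ≡ (x + - a) * 0ℤ
      eq = solve-∀
    quotient X = con 1ℤ , λ x → sym (ℤ.*-identityʳ (x + - a))
    quotient (p ⊕ q) = let s , e = quotient p ; t , f = quotient q in s ⊕ t , λ x →
      trans (eq (⟦ p ⟧ x) (⟦ q ⟧ x) (⟦ p ⟧ a) (⟦ q ⟧ a)) (trans (cong₂ _+_ (e x) (f x))
        (sym (ℤ.*-distribˡ-+ (x + - a) (⟦ s ⟧ x) (⟦ t ⟧ x))))
      where
      eq : ∀ p q r s → p + q + - (r + s) ≡ (p + - r) + (q + - s)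
      eq = solve-∀
    quotient (p ⊗ q) = let s , e = quotient p ; t , f = quotient q in s ⊗ q ⊕ con (⟦ p ⟧ a) ⊗ t , λ x →
      trans (eq (⟦ p ⟧ x) (⟦ q ⟧ x) (⟦ p ⟧ a) (⟦ q ⟧ a)) (trans (cong₂ (λ u v → u * ⟦ q ⟧ x + ⟦ p ⟧ a * v) (e x)
        (f x)) (eq′ (x + - a) (⟦ s ⟧ x) (⟦ q ⟧ x) (⟦ p ⟧ a) (⟦ t ⟧ x)))
      where
      eq : ∀ p q r s → p * q + - (r * s) ≡ (p + - r) * q + r * (q + - s)
      eq = solve-∀
      eq′ : ∀ y s q r t → y * s * q + r * (y * t) ≡ y * (s * q + r * t)
      eq′ = solve-∀

  roots-∣ : ∀ φ l → roots l ∣ᴱ roots (List.map ⟦ φ ⟧ l) ∘ᴱ φ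
  roots-∣ φ []      = ∣-refl
  roots-∣ φ (a ∷ l) = ⊗-mono-∣ (factor-theorem a φ) (roots-∣ φ l)

  roots-↭ : ∀ {l l′} → l ↭ l′ → roots l ∣ᴱ roots l′
  roots-↭ Perm.refl          = ∣-refl
  roots-↭ (Perm.prep a p)    = ⊗-mono-∣ (∣-refl {X- a}) (roots-↭ p)
  roots-↭ (Perm.swap {xs} {ys} a b p) = ∣-trans (≐⇒∣ λ x → eq (x + - a) (x + - b) (⟦ roots xs ⟧ x))
    (⊗-mono-∣ (∣-refl {X- b}) (⊗-mono-∣ (∣-refl {X- a}) (roots-↭ p)))
    where
    eq : ∀ a b c → a * (b * c) ≡ b * (a * c)
    eq = solve-∀
  roots-↭ (Perm.trans p q)   = ∣-trans (roots-↭ p) (roots-↭ q)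

  roots-EventuallyNonzero : ∀ l → EventuallyNonzero (roots l)
  roots-EventuallyNonzero []      = 0 , λ x _ ()
  roots-EventuallyNonzero (a ∷ l) = EventuallyNonzero-⊗ (suc ∣ a ∣ , λ x a<x x-a≡0 → ℕ.<-irrefl
    (cong ∣_∣ (sym (ℤ.i-j≡0⇒i≡j x a x-a≡0))) a<x) (roots-EventuallyNonzero l)

  roots-duplicate : ∀ a W → (X- a) ⊗ ((X- a) ⊗ W) ∣ᴱ ((X- a) ⊗ W) ^^ 2
  roots-duplicate a W = ∣-trans (⊗-mono-∣ (p∣p⊗q (X- a) W) (∣-refl {(X- a) ⊗ W})) (≐⇒∣ λ x → eq ((x + - a) * ⟦ W ⟧ x))
    where
    eq : ∀ t → t * t ≡ t * (t * 1ℤ)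
    eq = solve-∀

  Belyi-two-points : ∀ {a b} → a ≢ b → Belyi (roots (a ∷ b ∷ []))
  Belyi-two-points {a} {b} a≢b = mkBelyi (X- a) (b - a) (λ b-a≡0 → a≢b (sym (ℤ.i-j≡0⇒i≡j b a b-a≡0))) (0 , λ x _ ())
    λ {s} sf n s∣Wⁿ → ∣-trans (≐⇒∣ λ x → ℤ.*-identityˡ (⟦ s ⟧ x)) (∣-trans (squarefree-∣-^^ sf n s∣Wⁿ) (≐⇒∣ λ x → eq x a b))
    where
    eq : ∀ x a b → (x + - a) * ((x + - b) * 1ℤ) ≡ (x + - a) * ((x + - a) + - (b - a))
    eq = solve-∀

  Belyi-one-point : ∀ a → Belyi (roots (a ∷ []))
  Belyi-one-point a = Belyi-∣ (∣-trans (p∣p⊗q (roots (a ∷ [])) (X- (a + 1ℤ))) (≐⇒∣ λ x → eq x a))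
    (Belyi-two-points λ a≡a+1 → 1≢0 (trans (cancel a) (trans (cong (λ t → t - a) (sym a≡a+1)) (ℤ.i≡j⇒i-j≡0 {a} refl))))
    where
    eq : ∀ x a → (x + - a) * 1ℤ * (x + - (a + 1ℤ)) ≡ (x + - a) * ((x + - (a + 1ℤ)) * 1ℤ)
    eq = solve-∀
    cancel : ∀ a → 1ℤ ≡ (a + 1ℤ) - a
    cancel = solve-∀
    1≢0 : 1ℤ ≢ 0ℤ
    1≢0 ()

  -- The only critical points of (X − a)^(1+α) (X − c)^(1+β) besides a and c is b, which divides [a, c] in the ratio 1+α : 1+β.
  module ThreePoints (a : ℤ) (α β : ℕ) (rest : List ℤ) where
    b c : ℤ
    b = a + + suc α
    c = b + + suc β

    φ : Expr
    φ = (X- a) ^^ suc α ⊗ (X- c) ^^ suc β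

    -- Both `a` and `c` go to 0, so there is one point fewer than in `a ∷ b ∷ c ∷ rest`, although
    -- the critical value at `b` is included.
    images : List ℤ
    images = 0ℤ ∷ ⟦ φ ⟧ b ∷ List.map ⟦ φ ⟧ rest

    D-φ : ∀ x → ⟦ D φ ⟧ x ≡ (+ suc α + + suc β) * ((⟦ (X- a) ^^ α ⟧ x * ⟦ (X- c) ^^ β ⟧ x) * ⟦ X- b ⟧ x)
    D-φ x = trans (cong₂ (λ s t → s * ⟦ (X- c) ^^ suc β ⟧ x + ⟦ (X- a) ^^ suc α ⟧ x * t) (D-^^ (X- a) α x) (D-^^ (X- c) β x))
      (eq x a (+ suc α) (+ suc β) (⟦ (X- a) ^^ α ⟧ x) (⟦ (X- c) ^^ β ⟧ x))
      where
      eq : ∀ x a α β y z → α * (y * (1ℤ + 0ℤ)) * ((x + - (a + α + β)) * z) + ((x + - a) * y) * (β * (z * (1ℤ + 0ℤ))) ≡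
                           (α + β) * ((y * z) * (x + - (a + α)))
      eq = solve-∀

    φ∘ : φ ∣ᴱ (X- 0ℤ) ∘ᴱ φ
    φ∘ = ≐⇒∣ λ x → sym (ℤ.+-identityʳ (⟦ φ ⟧ x))

    b∣ : X- b ∣ᴱ (X- ⟦ φ ⟧ b) ∘ᴱ φ
    b∣ = factor-theorem b φ

    φ′∣ : D φ ∣ᴱ roots images ∘ᴱ φ
    φ′∣ = ∣-trans (scaled⇒∣ {q = (X- a) ^^ α ⊗ (X- c) ^^ β ⊗ (X- b)} (+ suc α + + suc β) (λ ()) λ x → sym (D-φ x))
      (∣-trans (⊗-mono-∣ (∣-trans (⊗-mono-∣ (q∣p⊗q (X- a) ((X- a) ^^ α)) (q∣p⊗q (X- c) ((X- c) ^^ β))) φ∘)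
          (∣-⊗ʳ (roots (List.map ⟦ φ ⟧ rest) ∘ᴱ φ) b∣))
        ∣-refl)

    roots∣ : roots (a ∷ b ∷ c ∷ rest) ∣ᴱ roots images ∘ᴱ φ
    roots∣ = ∣-trans (≐⇒∣ λ x → eq (⟦ X- a ⟧ x) (⟦ X- b ⟧ x) (⟦ X- c ⟧ x) (⟦ roots rest ⟧ x))
      (⊗-mono-∣ (∣-trans (⊗-mono-∣ (p∣p⊗q (X- a) ((X- a) ^^ α)) (p∣p⊗q (X- c) ((X- c) ^^ β))) φ∘) (⊗-mono-∣ b∣ (roots-∣ φ rest)))
      where
      eq : ∀ a b c r → a * (b * (c * r)) ≡ (a * c) * (b * r)
      eq = solve-∀

    φ′≢0 : EventuallyNonzero (D φ)
    φ′≢0 = EventuallyNonzero-resp (λ x nz → subst (_≢ 0ℤ) (sym (D-φ x)) (*-nonzero {+ suc α + + suc β} (λ ()) nz))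
      (EventuallyNonzero-⊗ (EventuallyNonzero-⊗ (^^-EventuallyNonzero α (linear a)) (^^-EventuallyNonzero β (linear c))) (linear b))
      where
      linear : ∀ a → EventuallyNonzero (X- a)
      linear a = ∣-EventuallyNonzero (p∣p⊗q (X- a) (con 1ℤ)) (roots-EventuallyNonzero (a ∷ []))

    step : Belyi (roots images) → Belyi (roots (a ∷ b ∷ c ∷ rest))
    step = Belyi-∘ (roots-EventuallyNonzero images) φ′≢0 φ′∣ roots∣

  <⇒+suc : ∀ {a b} → a ℤ.≤ b → a ≢ b → ∃[ n ] b ≡ a + + suc n
  <⇒+suc {a} {b} a≤b a≢b = from-difference (b - a) (ℤ.i≤j⇒0≤j-i a≤b) (difference a b)
    where
    difference : ∀ a b → b ≡ a + (b - a)
    difference = solve-∀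
    from-difference : ∀ d → 0ℤ ℤ.≤ d → b ≡ a + d → ∃[ n ] b ≡ a + + suc n
    from-difference (+ zero)  _ b≡a = ⊥-elim (a≢b (sym (trans b≡a (ℤ.+-identityʳ a))))
    from-difference (+ suc n) _ eq  = n , eq

  opaque
    -- Induction on the number of points: repetitions are merged, and among distinct points the
    -- three smallest are handled by `ThreePoints`. Sorting makes the gaps `b − a` and `c − b`
    -- positive, as exponents must be; the images are unsorted, hence the mutual recursion.
    Belyi-roots : ∀ n l → length l ℕ.≤ n → Belyi (roots l)
    Belyi-sorted : ∀ n l → Linked ℤ._≤_ l → length l ℕ.≤ n → Belyi (roots l)

    Belyi-roots n l len = Belyi-∣ (roots-↭ (Perm.↭-sym (sort-↭ l))) (Belyi-sorted n (sort l) (sort-↗ l) (subst (ℕ._≤ n) (sym (Perm.↭-length (sort-↭ l))) len))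

    Belyi-sorted n [] sorted len = Belyi-∣ (1∣ (roots (0ℤ ∷ []))) (Belyi-one-point 0ℤ)
    Belyi-sorted n (a ∷ []) sorted len = Belyi-one-point a
    Belyi-sorted n (a ∷ b ∷ []) sorted len with a ℤ.≟ b
    ... | yes refl = Belyi-∣^^ 2 (roots-duplicate a (con 1ℤ)) (Belyi-one-point a)
    ... | no a≢b   = Belyi-two-points a≢b
    Belyi-sorted (suc n) (a ∷ b ∷ c ∷ rest) (a≤b ∷ b≤c ∷ sorted) (s≤s len) with a ℤ.≟ b | b ℤ.≟ c
    ... | yes refl | _        = Belyi-∣^^ 2 (roots-duplicate a (roots (c ∷ rest))) (Belyi-roots n (a ∷ c ∷ rest) len)
    ... | no _     | yes refl = Belyi-∣^^ 2 (∣-trans (⊗-mono-∣ (∣-refl {X- a}) (roots-duplicate b (roots rest)))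
        (square-factor a b (roots rest))) (Belyi-roots n (a ∷ b ∷ rest) len)
      where
      square-factor : ∀ a b W → (X- a) ⊗ ((X- b) ⊗ W) ^^ 2 ∣ᴱ ((X- a) ⊗ ((X- b) ⊗ W)) ^^ 2
      square-factor a b W = ∣-trans (p∣p⊗q _ (X- a)) (≐⇒∣ λ x → eq (⟦ X- a ⟧ x) (⟦ (X- b) ⊗ W ⟧ x))
        where
        eq : ∀ a t → a * (t * (t * 1ℤ)) * a ≡ a * t * (a * t * 1ℤ)
        eq = solve-∀
    ... | no a≢b   | no b≢c   with <⇒+suc a≤b a≢b | <⇒+suc b≤c b≢c
    ...   | α , refl | β , refl = ThreePoints.step a α β rest (Belyi-roots n (ThreePoints.images a α β rest)
        (subst (λ k → suc (suc k) ℕ.≤ n) (sym (List.length-map _ rest)) len))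

  opaque
    -- `Q` itself serves as the map: its roots go to 0, the integers in `l` go to integers, and its
    -- critical points go to roots of an `M` of smaller degree. When no algebraic points are left,
    -- only a longer list of integers remains.
    Belyi-roots⊗ : ∀ n l Q → Q <° suc n → EventuallyNonzero Q → Belyi (roots l ⊗ Q)
    Belyi-roots⊗ n l Q Q<n Q≢0 = go n (EventuallyNonzero⇒Deg Q≢0 Q<n)
      where
      go : ∀ n → ∃[ m ] (m ℕ.< suc n × Deg Q m) → Belyi (roots l ⊗ Q)
      go n (zero , _ , deg) = let c , c≢0 , Q≐c = Deg-0 deg in
        Belyi-∣ (scaled⇒∣ c c≢0 λ x → trans (ℤ.*-comm c (⟦ roots l ⟧ x)) (cong (⟦ roots l ⟧ x *_) (sym (Q≐c x))))
          (Belyi-roots _ l ℕ.≤-refl)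
      go (suc n) (suc m , s≤s (s≤s m≤n) , deg) =
        let M , M≢0 , M<m , Q′∣MQ = critical-values Q deg
            images = 0ℤ ∷ List.map ⟦ Q ⟧ l
        in Belyi-∘ {W = roots images ⊗ M} {φ = Q} (EventuallyNonzero-⊗ (roots-EventuallyNonzero images) M≢0)
            (Deg⇒EventuallyNonzero (Deg-D deg))
             (∣-⊗ˡ (roots images ∘ᴱ Q) Q′∣MQ)
             (∣-trans (⊗-comm-∣ (roots l) Q) (∣-⊗ʳ (M ∘ᴱ Q) (⊗-mono-∣ {Q} {X ∘ᴱ Q ⊕ con (- 0ℤ)} (≐⇒∣ λ x → sym
                 (ℤ.+-identityʳ (⟦ Q ⟧ x))) (roots-∣ Q l))))
             (Belyi-roots⊗ n images M (<°-weaken (s≤s m≤n) M<m) M≢0)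

open BelyiMaps

-- The ABC conjecture at powerful values, and finiteness

module PowerfulValues where

  open import Data.Integer.Base using (+_; -_; _+_; _*_; _-_; ∣_∣)
  open import Data.Integer.Tactic.RingSolver using (solve-∀)
  open import Data.Nat.Divisibility using (_∣_; divides; _∣?_)
  open import Data.Nat.GCD using (gcd; gcd[m,n]∣m; gcd[m,n]∣n; gcd-greatest)
  open import Data.Nat.ListAction using (product)
  open import Data.Rational.Base using (*<*)

  -- The radical

  distinct-primes-∣ : ∀ {m l} → Unique l → All (λ p → Prime p × p ∣ m) l → product l ∣ m
  distinct-primes-∣ {m} {[]}    []             []                      = ℕ∣.1∣ m
  distinct-primes-∣ {m} {p ∷ l} (p∉l ∷ unique) ((prime-p , p∣m) ∷ primes) with distinct-primes-∣ unique primes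
  ... | divides k m≡kl with euclidsLemma k (product l) prime-p (subst (p ∣_) m≡kl p∣m)
  ...   | inj₁ p∣k = subst (p ℕ.* product l ∣_) (sym m≡kl) (ℕ∣.*-monoˡ-∣ (product l) p∣k)
  ...   | inj₂ p∣l = ⊥-elim (All.lookup p∉l (factorisationHasAllPrimeFactors prime-p p∣l (All.map proj₁ primes)) refl)

  radical-≤ : ∀ n {m} → 0 ℕ.< m → (∀ p → Prime p → p ∣ n → p ∣ m) → radical n ℕ.≤ m
  radical-≤ n {m} 0<m n⇒m = ℕ∣.∣⇒≤ {{ℕ.>-nonZero 0<m}}
    (distinct-primes-∣ (filter⁺ P? (upTo⁺ (suc n))) (All.map (λ (prime-p , p∣n) → prime-p , n⇒m _ prime-p p∣n)
        (all-filter P? (upTo (suc n)))))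
    where
    P? = λ p → prime? p ×-dec (p ∣? n)

  prime∣^ : ∀ {p} → Prime p → ∀ b n → p ∣ b ℕ.^ n → p ∣ b
  prime∣^ prime-p b zero    p∣1 = ℕ∣.∣-trans p∣1 (ℕ∣.1∣ b)
  prime∣^ prime-p b (suc n) p∣b with euclidsLemma b (b ℕ.^ n) prime-p p∣b
  ... | inj₁ p∣b  = p∣b
  ... | inj₂ p∣bⁿ = prime∣^ prime-p b n p∣bⁿ

  -- The ABC conjecture with ε = 1 / (1 + e)

  inverse : ℕ → ℚ
  inverse e = mkℚ (+ 1) e (1-coprimeTo (suc e))

  *-distrib-^ : ∀ a b n → (a ℕ.* b) ℕ.^ n ≡ a ℕ.^ n ℕ.* b ℕ.^ n
  *-distrib-^ a b zero    = refl
  *-distrib-^ a b (suc n) = trans (cong (a ℕ.* b ℕ.*_) (*-distrib-^ a b n)) (exchange a b (a ℕ.^ n) (b ℕ.^ n))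
    where
    exchange : ∀ a b c d → a ℕ.* b ℕ.* (c ℕ.* d) ≡ a ℕ.* c ℕ.* (b ℕ.* d)
    exchange = ℕSolver.solve-∀

  -- The conjecture concerns positive integers. As `∣ μ ∣ < ∣ A ∣`, the signs in `A = (A − μ) + μ`
  -- leave only the question whether `∣ A ∣` or `∣ A − μ ∣` is the sum.
  ∣-∣-cases : ∀ A μ → ∣ μ ∣ ℕ.< ∣ A ∣ → ∣ A - μ ∣ ℕ.+ ∣ μ ∣ ≡ ∣ A ∣ ⊎ ∣ A ∣ ℕ.+ ∣ μ ∣ ≡ ∣ A - μ ∣
  ∣-∣-cases (+ a) (+ zero)  μ<A = inj₂ (trans (ℕ.+-identityʳ a) (cong ∣_∣ (sym (ℤ.+-identityʳ (+ a)))))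
  ∣-∣-cases (+ a) (+ suc m) μ<A = inj₁ (trans (cong (ℕ._+ suc m) (trans (ℤ.∣m⊖n∣≡∣n⊖m∣ a (suc m))
    (ℤ.∣⊖∣-≤ (ℕ.<⇒≤ μ<A)))) (ℕ.m∸n+n≡m (ℕ.<⇒≤ μ<A)))
  ∣-∣-cases (+ a) -[1+ m ]  μ<A = inj₂ refl
  ∣-∣-cases -[1+ a ] (+ zero)  μ<A = inj₂ (ℕ.+-identityʳ (suc a))
  ∣-∣-cases -[1+ a ] (+ suc m) μ<A = inj₂ (cong suc (ℕ.+-suc a m))
  ∣-∣-cases -[1+ a ] -[1+ m ]  μ<A = inj₁ (trans (cong (ℕ._+ suc m) (ℤ.∣⊖∣-≤ (ℕ.<⇒≤ μ<A))) (ℕ.m∸n+n≡m (ℕ.<⇒≤ μ<A)))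

  module _ (abc : ABCConjecture) (e : ℕ) where

    -- Coprimality is reached by dividing by `gcd u v`. This costs at most a factor `v`, harmless
    -- because `v` will be the fixed `∣ μ ∣`, and the prime divisors of the smaller triple are among
    -- those of the original one.
    abc-bound : ∃[ C ] (∀ u v w m → 0 ℕ.< u → 0 ℕ.< v → 0 ℕ.< w → 0 ℕ.< m → u ℕ.+ v ≡ w →
                (∀ p → Prime p → p ∣ u ℕ.* v ℕ.* w → p ∣ m) → w ℕ.^ suc e ℕ.≤ (v ℕ.* C) ℕ.^ suc e ℕ.* m ℕ.^ (suc e ℕ.+ 1))
    abc-bound = let C , bound = abc (inverse e) (*<* (ℤ.+<+ (s≤s z≤n))) in C , λ u v w m 0<u 0<v 0<w 0<m u+v≡w primes →
      go C bound u v w m 0<u 0<v 0<w 0<m u+v≡w primes (gcd[m,n]∣m u v) (gcd[m,n]∣n u v)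
      where
      go : ∀ C → (∀ a b c → 0 ℕ.< a → 0 ℕ.< b → 0 ℕ.< c → gcd a (gcd b c) ≡ 1 → a ℕ.+ b ≡ c →
                  c ℕ.^ suc e ℕ.≤ C ℕ.^ suc e ℕ.* radical (a ℕ.* b ℕ.* c) ℕ.^ (suc e ℕ.+ 1)) →
           ∀ u v w m → 0 ℕ.< u → 0 ℕ.< v → 0 ℕ.< w → 0 ℕ.< m → u ℕ.+ v ≡ w → (∀ p → Prime p → p ∣ u ℕ.* v ℕ.* w → p ∣ m) →
           gcd u v ∣ u → gcd u v ∣ v → w ℕ.^ suc e ℕ.≤ (v ℕ.* C) ℕ.^ suc e ℕ.* m ℕ.^ (suc e ℕ.+ 1)
      go C bound u v w m 0<u 0<v 0<w 0<m u+v≡w primes (divides u′ u≡) (divides v′ v≡) = begin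
        w ℕ.^ suc e ≤⟨ ℕ.^-monoˡ-≤ (suc e) w≤vw′ ⟩
        (v ℕ.* w′) ℕ.^ suc e ≡⟨ *-distrib-^ v w′ (suc e) ⟩
        v ℕ.^ suc e ℕ.* w′ ℕ.^ suc e ≤⟨ ℕ.*-monoʳ-≤ (v ℕ.^ suc e) (bound u′ v′ w′ 0<u′ 0<v′ 0<w′ coprime refl) ⟩
        v ℕ.^ suc e ℕ.* (C ℕ.^ suc e ℕ.* N ℕ.^ (suc e ℕ.+ 1)) ≡⟨ ℕ.*-assoc (v ℕ.^ suc e) (C ℕ.^ suc e) _ ⟨
        v ℕ.^ suc e ℕ.* C ℕ.^ suc e ℕ.* N ℕ.^ (suc e ℕ.+ 1) ≡⟨ cong (ℕ._* N ℕ.^ (suc e ℕ.+ 1)) (*-distrib-^ v C (suc e)) ⟨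
        (v ℕ.* C) ℕ.^ suc e ℕ.* N ℕ.^ (suc e ℕ.+ 1) ≤⟨ ℕ.*-monoʳ-≤ ((v ℕ.* C) ℕ.^ suc e) (ℕ.^-monoˡ-≤ (suc e ℕ.+ 1) N≤m) ⟩
        (v ℕ.* C) ℕ.^ suc e ℕ.* m ℕ.^ (suc e ℕ.+ 1) ∎
        where
        open ℕ.≤-Reasoning
        g = gcd u v
        w′ = u′ ℕ.+ v′
        N = radical (u′ ℕ.* v′ ℕ.* w′)
        positive-factors : ∀ {n} a b → 0 ℕ.< n → n ≡ a ℕ.* b → 0 ℕ.< a × 0 ℕ.< b
        positive-factors zero    b       0<n n≡ = ⊥-elim (ℕ.<⇒≢ 0<n (sym n≡))
        positive-factors (suc a) zero    0<n n≡ = ⊥-elim (ℕ.<⇒≢ 0<n (sym (trans n≡ (ℕ.*-zeroʳ a))))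
        positive-factors (suc a) (suc b) 0<n n≡ = s≤s z≤n , s≤s z≤n
        0<u′ = proj₁ (positive-factors u′ g 0<u u≡)
        0<g  = proj₂ (positive-factors u′ g 0<u u≡)
        0<v′ = proj₁ (positive-factors v′ g 0<v v≡)
        0<w′ = ℕ.<-≤-trans 0<u′ (ℕ.m≤m+n u′ v′)
        w≡ : w ≡ g ℕ.* w′
        w≡ = trans (sym u+v≡w) (trans (cong₂ ℕ._+_ u≡ v≡) (eq u′ v′ g))
          where
          eq : ∀ a b g → a ℕ.* g ℕ.+ b ℕ.* g ≡ g ℕ.* (a ℕ.+ b)
          eq = ℕSolver.solve-∀
        w≤vw′ : w ℕ.≤ v ℕ.* w′
        w≤vw′ = ℕ.≤-trans (ℕ.≤-reflexive w≡) (ℕ.*-monoˡ-≤ w′ (ℕ∣.∣⇒≤ {{ℕ.>-nonZero 0<v}} (gcd[m,n]∣n u v)))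
        coprime : gcd u′ (gcd v′ w′) ≡ 1
        coprime = ℕ∣.∣1⇒≡1 (ℕ∣.*-cancelʳ-∣ g {{ℕ.>-nonZero 0<g}} (subst (d ℕ.* g ∣_) (sym (ℕ.+-identityʳ g)) (gcd-greatest
          (subst (d ℕ.* g ∣_) (sym u≡) (ℕ∣.*-monoˡ-∣ g (gcd[m,n]∣m u′ _)))
          (subst (d ℕ.* g ∣_) (sym v≡) (ℕ∣.*-monoˡ-∣ g (ℕ∣.∣-trans (gcd[m,n]∣n u′ _) (gcd[m,n]∣m v′ w′)))))))
          where
          d = gcd u′ (gcd v′ w′)
        ∣multiple : u′ ℕ.* v′ ℕ.* w′ ∣ u ℕ.* v ℕ.* w
        ∣multiple = divides (g ℕ.* g ℕ.* g) (trans (cong₂ ℕ._*_ (cong₂ ℕ._*_ u≡ v≡) w≡) (eq u′ v′ w′ g))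
          where
          eq : ∀ a b c g → a ℕ.* g ℕ.* (b ℕ.* g) ℕ.* (g ℕ.* c) ≡ g ℕ.* g ℕ.* g ℕ.* (a ℕ.* b ℕ.* c)
          eq = ℕSolver.solve-∀
        N≤m : N ℕ.≤ m
        N≤m = radical-≤ (u′ ℕ.* v′ ℕ.* w′) 0<m λ p prime-p p∣ → primes p prime-p (ℕ∣.∣-trans p∣ ∣multiple)

    abc-boundℤ : ∀ μ → μ ≢ 0ℤ → ∃[ C ] (∀ A m → ∣ μ ∣ ℕ.< ∣ A ∣ → 0 ℕ.< m →
                 (∀ p → Prime p → p ∣ ∣ A ∣ ℕ.* ∣ A - μ ∣ ℕ.* ∣ μ ∣ → p ∣ m) → ∣ A ∣ ℕ.^ suc e ℕ.≤ C ℕ.* m ℕ.^ (suc e ℕ.+ 1))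
    abc-boundℤ μ μ≢0 = let C , bound = abc-bound in (∣ μ ∣ ℕ.* C) ℕ.^ suc e , λ A m μ<A 0<m primes → go C bound A m μ<A 0<m primes (∣-∣-cases A μ μ<A)
      where
      go : ∀ C → (∀ u v w m → 0 ℕ.< u → 0 ℕ.< v → 0 ℕ.< w → 0 ℕ.< m → u ℕ.+ v ≡ w →
           (∀ p → Prime p → p ∣ u ℕ.* v ℕ.* w → p ∣ m) → w ℕ.^ suc e ℕ.≤ (v ℕ.* C) ℕ.^ suc e ℕ.* m ℕ.^ (suc e ℕ.+ 1)) →
           ∀ A m → ∣ μ ∣ ℕ.< ∣ A ∣ → 0 ℕ.< m →
           (∀ p → Prime p → p ∣ ∣ A ∣ ℕ.* ∣ A - μ ∣ ℕ.* ∣ μ ∣ → p ∣ m) →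
           ∣ A - μ ∣ ℕ.+ ∣ μ ∣ ≡ ∣ A ∣ ⊎ ∣ A ∣ ℕ.+ ∣ μ ∣ ≡ ∣ A - μ ∣ → ∣ A ∣ ℕ.^ suc e ℕ.≤
             (∣ μ ∣ ℕ.* C) ℕ.^ suc e ℕ.* m ℕ.^ (suc e ℕ.+ 1)
      go C bound A m μ<A 0<m primes = [ smaller , larger ]′
        where
        0<μ = nonzero⇒1≤ μ≢0
        0<A = ℕ.≤-<-trans z≤n μ<A
        0<A-μ = nonzero⇒1≤ λ A-μ≡0 → ℕ.<-irrefl (cong ∣_∣ (sym (ℤ.i-j≡0⇒i≡j A μ A-μ≡0))) μ<A
        smaller : ∣ A - μ ∣ ℕ.+ ∣ μ ∣ ≡ ∣ A ∣ → ∣ A ∣ ℕ.^ suc e ℕ.≤ (∣ μ ∣ ℕ.* C) ℕ.^ suc e ℕ.* m ℕ.^ (suc e ℕ.+ 1)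
        smaller eq = bound (∣ A - μ ∣) (∣ μ ∣) (∣ A ∣) m 0<A-μ 0<μ 0<A 0<m eq λ p prime-p p∣ → primes p prime-p
          (subst (p ∣_) (shuffle (∣ A - μ ∣) (∣ μ ∣) (∣ A ∣)) p∣)
          where
          shuffle : ∀ a b c → a ℕ.* b ℕ.* c ≡ c ℕ.* a ℕ.* b
          shuffle = ℕSolver.solve-∀
        larger : ∣ A ∣ ℕ.+ ∣ μ ∣ ≡ ∣ A - μ ∣ → ∣ A ∣ ℕ.^ suc e ℕ.≤ (∣ μ ∣ ℕ.* C) ℕ.^ suc e ℕ.* m ℕ.^ (suc e ℕ.+ 1)
        larger eq = ℕ.≤-trans (ℕ.^-monoˡ-≤ (suc e) (subst (∣ A ∣ ℕ.≤_) eq (ℕ.m≤m+n (∣ A ∣) (∣ μ ∣))))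
          (bound (∣ A ∣) (∣ μ ∣) (∣ A - μ ∣) m 0<A 0<μ 0<A-μ 0<m eq λ p prime-p p∣ → primes p prime-p (subst (p ∣_)
              (shuffle (∣ A ∣) (∣ μ ∣) (∣ A - μ ∣)) p∣))
          where
          shuffle : ∀ a b c → a ℕ.* b ℕ.* c ≡ a ℕ.* c ℕ.* b
          shuffle = ℕSolver.solve-∀

  -- Powerful values

  -- `r` is any positive number, of square at most `n`, that is divisible by all primes of `n`.
  -- Unlike the radical itself, such numbers can simply be multiplied, whether or not the factors
  -- are coprime.
  SmallRadical : ℕ → Set
  SmallRadical n = ∃[ r ] (0 ℕ.< r × r ℕ.* r ℕ.≤ n × (∀ p → Prime p → p ∣ n → p ∣ r))

  ^-SmallRadical : ∀ b {γ} → 2 ℕ.≤ γ → 0 ℕ.< b ℕ.^ γ → SmallRadical (b ℕ.^ γ)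
  ^-SmallRadical zero    {suc (suc γ)} (s≤s (s≤s _)) ()
  ^-SmallRadical (suc b) {suc (suc γ)} (s≤s (s≤s _)) _ = suc b , s≤s z≤n , ℕ.≤-trans
    (ℕ.m≤m*n _ (suc b ℕ.^ γ) {{ℕ.m^n≢0 (suc b) γ}}) (ℕ.≤-reflexive (ℕ.*-assoc (suc b) (suc b) _)) ,
    λ p prime-p → prime∣^ prime-p (suc b) (suc (suc γ))

  *-SmallRadical : ∀ {m n} → SmallRadical m → SmallRadical n → SmallRadical (m ℕ.* n)
  *-SmallRadical {m} {n} (r , 0<r , r² , r-primes) (s , 0<s , s² , s-primes) = r ℕ.* s , ℕ.*-mono-≤ 0<r 0<s ,
    ℕ.≤-trans (ℕ.≤-reflexive (eq r s)) (ℕ.*-mono-≤ r² s²) ,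
    λ p prime-p p∣mn → [ (λ p∣m → ℕ∣.∣-trans (r-primes p prime-p p∣m) (ℕ∣.m∣m*n s)) , (λ p∣n → ℕ∣.∣-trans
      (s-primes p prime-p p∣n) (ℕ∣.n∣m*n r)) ]′ (euclidsLemma m n prime-p p∣mn)
    where
    eq : ∀ r s → r ℕ.* s ℕ.* (r ℕ.* s) ≡ r ℕ.* r ℕ.* (s ℕ.* s)
    eq = ℕSolver.solve-∀

  eval-^ : ∀ p n y → ∣ ℤ[X].eval (p ℤ[X].^ n) y ∣ ≡ ∣ ℤ[X].eval p y ∣ ℕ.^ n
  eval-^ p zero    y = cong ∣_∣ (cong (λ t → 1ℤ + t) (ℤ.*-zeroʳ y))
  eval-^ p (suc n) y = trans (cong ∣_∣ (eval-* p (p ℤ[X].^ n) y)) (trans (ℤ.abs-* (ℤ[X].eval p y) _)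
    (cong (∣ ℤ[X].eval p y ∣ ℕ.*_) (eval-^ p n y)))

  product-SmallRadical : ∀ n (γ : Fin n → ℕ) → (∀ i → 2 ℕ.≤ γ i) → (gs : Fin n → ℤ[X].Poly) → ∀ y →
                     0 ℕ.< ∣ ℤ[X].eval (ℤ[X].product (λ i → gs i ℤ[X].^ γ i)) y ∣ →
                     SmallRadical (∣ ℤ[X].eval (ℤ[X].product (λ i → gs i ℤ[X].^ γ i)) y ∣)
  product-SmallRadical zero    γ 2≤γ gs y _ = subst SmallRadical (cong ∣_∣ (sym (cong (λ t → 1ℤ + t) (ℤ.*-zeroʳ y))))
    (1 , ℕ.≤-refl , ℕ.≤-refl , λ p _ p∣1 → p∣1)
  product-SmallRadical (suc n) γ 2≤γ gs y 0<gy = subst SmallRadical (sym eq)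
    (*-SmallRadical (^-SmallRadical (∣ ℤ[X].eval (gs Fin.zero) y ∣) (2≤γ Fin.zero)
        (ℕ.>-nonZero⁻¹ _ {{ℕ.m*n≢0⇒m≢0 (∣ ℤ[X].eval (gs Fin.zero) y ∣ ℕ.^ γ Fin.zero) {{nz}}}}))
      (product-SmallRadical n (γ ∘ Fin.suc) (2≤γ ∘ Fin.suc) (gs ∘ Fin.suc) y
          (ℕ.>-nonZero⁻¹ _ {{ℕ.m*n≢0⇒n≢0 (∣ ℤ[X].eval (gs Fin.zero) y ∣ ℕ.^ γ Fin.zero) {{nz}}}})))
    where
    rest = ℤ[X].product (λ i → gs (Fin.suc i) ℤ[X].^ γ (Fin.suc i))
    eq : ∣ ℤ[X].eval ((gs Fin.zero ℤ[X].^ γ Fin.zero) ℤ[X].*ᴾ rest) y ∣ ≡ ∣ ℤ[X].eval (gs Fin.zero) y ∣ ℕ.^ γ Fin.zero ℕ.* ∣ ℤ[X].eval rest y ∣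
    eq = trans (cong ∣_∣ (eval-* (gs Fin.zero ℤ[X].^ γ Fin.zero) rest y))
      (trans (ℤ.abs-* (ℤ[X].eval (gs Fin.zero ℤ[X].^ γ Fin.zero) y) _)
      (cong (ℕ._* ∣ ℤ[X].eval rest y ∣) (eval-^ (gs Fin.zero) (γ Fin.zero) y)))
    nz = ℕ.>-nonZero (subst (0 ℕ.<_) eq 0<gy)

  ≋⇒eval : ∀ p q → p ℤ[X].≋ q → ∀ x → ℤ[X].eval p x ≡ ℤ[X].eval q x
  ≋⇒eval []      []      p≋q x = refl
  ≋⇒eval []      (b ∷ q) p≋q x = sym (trans (cong₂ (λ u v → u + x * v) (sym (p≋q 0))
    (sym (≋⇒eval [] q (λ k → p≋q (suc k)) x))) (cong (λ t → 0ℤ + t) (ℤ.*-zeroʳ x)))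
  ≋⇒eval (a ∷ p) []      p≋q x = trans (cong₂ (λ u v → u + x * v) (p≋q 0) (≋⇒eval p [] (λ k → p≋q (suc k)) x))
    (cong (λ t → 0ℤ + t) (ℤ.*-zeroʳ x))
  ≋⇒eval (a ∷ p) (b ∷ q) p≋q x = cong₂ (λ u v → u + x * v) (p≋q 0) (≋⇒eval p q (λ k → p≋q (suc k)) x)

  HasDegree⇒Deg : ∀ p d → ℤ[X].HasDegree p d → Deg (fromList p) d
  HasDegree⇒Deg []      d       (lead≢0 , _) = ⊥-elim (lead≢0 refl)
  HasDegree⇒Deg (a ∷ p) zero    (a≢0 , above) = mkDeg (con 0ℤ) a (<°-zero 0) a≢0 λ x →
    trans (cong (λ t → a + x * t) (trans (⟦fromList⟧ p x) (≋⇒eval p [] (λ k → above (suc k) (s≤s z≤n)) x))) (eq a x)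
    where
    eq : ∀ a x → a + x * 0ℤ ≡ 0ℤ + a * 1ℤ
    eq = solve-∀
  HasDegree⇒Deg (a ∷ p) (suc d) (lead≢0 , above) =
    let mkDeg p₀ c p₀<d c≢0 p≐ = HasDegree⇒Deg p d (lead≢0 , λ k d<k → above (suc k) (s≤s d<k))
    in mkDeg (con a ⊕ X ⊗ p₀) c (<°-⊕ (<°-weaken (s≤s z≤n) (<°-con a)) (<°-X⊗ p₀<d)) c≢0 λ x →
         trans (cong (λ t → a + x * t) (p≐ x)) (eq a x (⟦ p₀ ⟧ x) c (⟦ X ^^ d ⟧ x))
    where
    eq : ∀ a x p c y → a + x * (p + c * y) ≡ a + x * p + c * (x * y)
    eq = solve-∀

  -- With |f| ≥ |x|³/2, |φ′| ≥ |x|^δ/2, |φ| ≥ |x|^(1+δ)/2, |φ(φ − μ)| ≤ C |x|^(2+2δ), and q = 2 + 2δ.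
  module _ (δ : ℕ) where

    open ℕ.≤-Reasoning

    square-bound : ∀ κ c₀ C {x P φ′ f r h} → 0 ℕ.< x → κ ℕ.* P ≡ φ′ ℕ.* f ℕ.* h → r ℕ.* r ℕ.≤ f → x ℕ.^ 3 ℕ.≤ 2 ℕ.* f →
      x ℕ.^ δ ℕ.≤ 2 ℕ.* φ′ →
                   P ℕ.≤ C ℕ.* x ℕ.^ (suc δ ℕ.+ suc δ) →
                   (c₀ ℕ.* r ℕ.* h) ℕ.^ 2 ℕ.≤ 8 ℕ.* (c₀ ℕ.* κ ℕ.* C) ℕ.^ 2 ℕ.* x ℕ.^ suc (δ ℕ.+ δ)
    -- Both sides are multiplied by `x ^ (3 + 2δ) ≤ 8 f φ′²`. With `r² ≤ f` the left side is then
    -- bounded through `(φ′ f h)² = (κ P)²`, and the exponents match: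
    -- `4 + 4δ = (3 + 2δ) + (1 + 2δ)`.
    square-bound κ c₀ C {x} {P} {φ′} {f} {r} {h} 0<x κP≡ r²≤f f≥ φ′≥ P≤ = ℕ.*-cancelˡ-≤ (x ℕ.^ (3 ℕ.+ (δ ℕ.+ δ))) {{ℕ.m^n≢0 x (3 ℕ.+ (δ ℕ.+ δ)) {{ℕ.>-nonZero 0<x}}}} (begin
      x ℕ.^ (3 ℕ.+ (δ ℕ.+ δ)) ℕ.* (c₀ ℕ.* r ℕ.* h) ℕ.^ 2
        ≡⟨ cong (ℕ._* (c₀ ℕ.* r ℕ.* h) ℕ.^ 2) (trans (ℕ.^-distribˡ-+-* x 3 (δ ℕ.+ δ)) (cong (x ℕ.^ 3 ℕ.*_)
            (ℕ.^-distribˡ-+-* x δ δ))) ⟩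
      x ℕ.^ 3 ℕ.* (x ℕ.^ δ ℕ.* x ℕ.^ δ) ℕ.* (c₀ ℕ.* r ℕ.* h) ℕ.^ 2
        ≤⟨ ℕ.*-monoˡ-≤ ((c₀ ℕ.* r ℕ.* h) ℕ.^ 2) (ℕ.*-mono-≤ f≥ (ℕ.*-mono-≤ φ′≥ φ′≥)) ⟩
      2 ℕ.* f ℕ.* (2 ℕ.* φ′ ℕ.* (2 ℕ.* φ′)) ℕ.* (c₀ ℕ.* r ℕ.* h) ℕ.^ 2 ≡⟨ e₁ f φ′ c₀ r h ⟩
      8 ℕ.* (c₀ ℕ.^ 2 ℕ.* (f ℕ.* φ′ ℕ.^ 2 ℕ.* h ℕ.^ 2)) ℕ.* (r ℕ.* r) ≤⟨ ℕ.*-monoʳ-≤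
        (8 ℕ.* (c₀ ℕ.^ 2 ℕ.* (f ℕ.* φ′ ℕ.^ 2 ℕ.* h ℕ.^ 2))) r²≤f ⟩
      8 ℕ.* (c₀ ℕ.^ 2 ℕ.* (f ℕ.* φ′ ℕ.^ 2 ℕ.* h ℕ.^ 2)) ℕ.* f ≡⟨ e₂ f φ′ c₀ h ⟩
      8 ℕ.* (c₀ ℕ.^ 2 ℕ.* (φ′ ℕ.* f ℕ.* h) ℕ.^ 2) ≡⟨ cong (λ t → 8 ℕ.* (c₀ ℕ.^ 2 ℕ.* t ℕ.^ 2)) κP≡ ⟨
      8 ℕ.* (c₀ ℕ.^ 2 ℕ.* (κ ℕ.* P) ℕ.^ 2) ≤⟨ ℕ.*-monoʳ-≤ 8 (ℕ.*-monoʳ-≤ (c₀ ℕ.^ 2) (ℕ.^-monoˡ-≤ 2 (ℕ.*-monoʳ-≤ κ P≤))) ⟩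
      8 ℕ.* (c₀ ℕ.^ 2 ℕ.* (κ ℕ.* (C ℕ.* x ℕ.^ (suc δ ℕ.+ suc δ))) ℕ.^ 2) ≡⟨ e₃ c₀ κ C (x ℕ.^ (suc δ ℕ.+ suc δ)) ⟩
      8 ℕ.* (c₀ ℕ.* κ ℕ.* C) ℕ.^ 2 ℕ.* (x ℕ.^ (suc δ ℕ.+ suc δ) ℕ.* x ℕ.^ (suc δ ℕ.+ suc δ))
        ≡⟨ cong (8 ℕ.* (c₀ ℕ.* κ ℕ.* C) ℕ.^ 2 ℕ.*_) (trans (sym (ℕ.^-distribˡ-+-* x (suc δ ℕ.+ suc δ)
            (suc δ ℕ.+ suc δ))) (trans (cong (x ℕ.^_) (e₄ δ)) (ℕ.^-distribˡ-+-* x (3 ℕ.+ (δ ℕ.+ δ)) (suc (δ ℕ.+ δ))))) ⟩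
      8 ℕ.* (c₀ ℕ.* κ ℕ.* C) ℕ.^ 2 ℕ.* (x ℕ.^ (3 ℕ.+ (δ ℕ.+ δ)) ℕ.* x ℕ.^ suc (δ ℕ.+ δ))
        ≡⟨ e₅ (8 ℕ.* (c₀ ℕ.* κ ℕ.* C) ℕ.^ 2) (x ℕ.^ (3 ℕ.+ (δ ℕ.+ δ))) (x ℕ.^ suc (δ ℕ.+ δ)) ⟩
      x ℕ.^ (3 ℕ.+ (δ ℕ.+ δ)) ℕ.* (8 ℕ.* (c₀ ℕ.* κ ℕ.* C) ℕ.^ 2 ℕ.* x ℕ.^ suc (δ ℕ.+ δ)) ∎)
      where
      e₁ : ∀ f d c r h → 2 ℕ.* f ℕ.* (2 ℕ.* d ℕ.* (2 ℕ.* d)) ℕ.* (c ℕ.* r ℕ.* h ℕ.* (c ℕ.* r ℕ.* h ℕ.* 1)) ≡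
                         8 ℕ.* (c ℕ.* (c ℕ.* 1) ℕ.* (f ℕ.* (d ℕ.* (d ℕ.* 1)) ℕ.* (h ℕ.* (h ℕ.* 1)))) ℕ.* (r ℕ.* r)
      e₁ = ℕSolver.solve-∀
      e₂ : ∀ f d c h → 8 ℕ.* (c ℕ.* (c ℕ.* 1) ℕ.* (f ℕ.* (d ℕ.* (d ℕ.* 1)) ℕ.* (h ℕ.* (h ℕ.* 1)))) ℕ.* f ≡
                       8 ℕ.* (c ℕ.* (c ℕ.* 1) ℕ.* (d ℕ.* f ℕ.* h ℕ.* (d ℕ.* f ℕ.* h ℕ.* 1)))
      e₂ = ℕSolver.solve-∀
      e₃ : ∀ c k C x → 8 ℕ.* (c ℕ.* (c ℕ.* 1) ℕ.* (k ℕ.* (C ℕ.* x) ℕ.* (k ℕ.* (C ℕ.* x) ℕ.* 1))) ≡ 8 ℕ.* (c ℕ.* k ℕ.* C ℕ.* (c ℕ.* k ℕ.* C ℕ.* 1)) ℕ.* (x ℕ.* x)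
      e₃ = ℕSolver.solve-∀
      e₄ : ∀ d → suc d ℕ.+ suc d ℕ.+ (suc d ℕ.+ suc d) ≡ 3 ℕ.+ (d ℕ.+ d) ℕ.+ suc (d ℕ.+ d)
      e₄ = ℕSolver.solve-∀
      e₅ : ∀ a b c → a ℕ.* (b ℕ.* c) ≡ b ℕ.* (a ℕ.* c)
      e₅ = ℕSolver.solve-∀

    private
      q = suc δ ℕ.+ suc δ

    -- The choice of `q` makes `2 q (1 + δ)` exceed `(q + 1)(1 + 2δ)` by exactly one, so a single
    -- factor `x` survives the comparison of powers.
    final-bound : ∀ K L {x a m} → 0 ℕ.< x → x ℕ.^ suc δ ℕ.≤ 2 ℕ.* a → a ℕ.^ q ℕ.≤ L ℕ.* m ℕ.^ (q ℕ.+ 1) →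
      m ℕ.^ 2 ℕ.≤ K ℕ.* x ℕ.^ suc (δ ℕ.+ δ) →
                  x ℕ.≤ (2 ℕ.^ q ℕ.* L) ℕ.^ 2 ℕ.* K ℕ.^ (q ℕ.+ 1)
    final-bound K L {x} {a} {m} 0<x a≥ a≤ m²≤ = ℕ.*-cancelʳ-≤ x _ (x ℕ.^ s) {{ℕ.m^n≢0 x s {{ℕ.>-nonZero 0<x}}}} (begin
      x ℕ.* x ℕ.^ s ≡⟨ cong (x ℕ.^_) (e₁ δ) ⟩
      x ℕ.^ (suc δ ℕ.* (q ℕ.* 2)) ≡⟨ ℕ.^-*-assoc x (suc δ) (q ℕ.* 2) ⟨
      (x ℕ.^ suc δ) ℕ.^ (q ℕ.* 2) ≡⟨ ℕ.^-*-assoc (x ℕ.^ suc δ) q 2 ⟨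
      ((x ℕ.^ suc δ) ℕ.^ q) ℕ.^ 2 ≤⟨ ℕ.^-monoˡ-≤ 2 (ℕ.^-monoˡ-≤ q a≥) ⟩
      ((2 ℕ.* a) ℕ.^ q) ℕ.^ 2 ≡⟨ cong (ℕ._^ 2) (*-distrib-^ 2 a q) ⟩
      (2 ℕ.^ q ℕ.* a ℕ.^ q) ℕ.^ 2 ≤⟨ ℕ.^-monoˡ-≤ 2 (ℕ.*-monoʳ-≤ (2 ℕ.^ q) a≤) ⟩
      (2 ℕ.^ q ℕ.* (L ℕ.* m ℕ.^ (q ℕ.+ 1))) ℕ.^ 2 ≡⟨ cong (ℕ._^ 2) (ℕ.*-assoc (2 ℕ.^ q) L (m ℕ.^ (q ℕ.+ 1))) ⟨
      (2 ℕ.^ q ℕ.* L ℕ.* m ℕ.^ (q ℕ.+ 1)) ℕ.^ 2 ≡⟨ *-distrib-^ (2 ℕ.^ q ℕ.* L) (m ℕ.^ (q ℕ.+ 1)) 2 ⟩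
      (2 ℕ.^ q ℕ.* L) ℕ.^ 2 ℕ.* (m ℕ.^ (q ℕ.+ 1)) ℕ.^ 2 ≡⟨ cong ((2 ℕ.^ q ℕ.* L) ℕ.^ 2 ℕ.*_)
          (trans (ℕ.^-*-assoc m (q ℕ.+ 1) 2) (trans (cong (m ℕ.^_) (ℕ.*-comm (q ℕ.+ 1) 2))
          (sym (ℕ.^-*-assoc m 2 (q ℕ.+ 1))))) ⟩
      (2 ℕ.^ q ℕ.* L) ℕ.^ 2 ℕ.* (m ℕ.^ 2) ℕ.^ (q ℕ.+ 1) ≤⟨ ℕ.*-monoʳ-≤ ((2 ℕ.^ q ℕ.* L) ℕ.^ 2) (ℕ.^-monoˡ-≤ (q ℕ.+ 1) m²≤) ⟩
      (2 ℕ.^ q ℕ.* L) ℕ.^ 2 ℕ.* (K ℕ.* x ℕ.^ suc (δ ℕ.+ δ)) ℕ.^ (q ℕ.+ 1) ≡⟨ cong ((2 ℕ.^ q ℕ.* L) ℕ.^ 2 ℕ.*_)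
          (trans (*-distrib-^ K (x ℕ.^ suc (δ ℕ.+ δ)) (q ℕ.+ 1)) (cong (K ℕ.^ (q ℕ.+ 1) ℕ.*_) (ℕ.^-*-assoc x
          (suc (δ ℕ.+ δ)) (q ℕ.+ 1)))) ⟩
      (2 ℕ.^ q ℕ.* L) ℕ.^ 2 ℕ.* (K ℕ.^ (q ℕ.+ 1) ℕ.* x ℕ.^ s) ≡⟨ ℕ.*-assoc ((2 ℕ.^ q ℕ.* L) ℕ.^ 2) (K ℕ.^ (q ℕ.+ 1)) (x ℕ.^ s) ⟨
      (2 ℕ.^ q ℕ.* L) ℕ.^ 2 ℕ.* K ℕ.^ (q ℕ.+ 1) ℕ.* x ℕ.^ s ∎)
      where
      s = suc (δ ℕ.+ δ) ℕ.* (q ℕ.+ 1)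
      e₁ : ∀ d → suc (suc (d ℕ.+ d) ℕ.* (suc d ℕ.+ suc d ℕ.+ 1)) ≡ suc d ℕ.* ((suc d ℕ.+ suc d) ℕ.* 2)
      e₁ = ℕSolver.solve-∀

  -- Finiteness

  module _ (abc : ABCConjecture) {F : Expr} {d : ℕ} (degF : Deg F d) (2<d : 2 ℕ.< d) (sf : Squarefree F) where

    module _ (belyi : Belyi F) where
      open Belyi belyi

      P : Expr
      P = φ ⊗ (φ ⊕ con (- μ))

      module _ {δ : ℕ} (degφ : Deg φ (suc δ)) (φ′F∣P : D φ ⊗ F ∣ᴱ P) where
        open _∣ᴱ_ φ′F∣P renaming (scale to k; scale≢0 to k≢0; quotient to h; equation to kP≡)

        degP : Deg P (suc δ ℕ.+ suc δ)
        degP = Deg-⊗ degφ (Deg-⊕-lower degφ (<°-weaken (s≤s z≤n) (<°-con (- μ))))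

        -- `P′ = φ′ (2φ − μ)`, so `P′ F h` equals `k P (2φ − μ)`. Through `∣D⊗⇒∣^^`, `P` then
        -- divides a power of `F h`, which confines the primes of `P(x)` to those of `F(x) h(x)` and
        -- finitely many others.
        P∣P′Fh : P ∣ᴱ D P ⊗ (F ⊗ h)
        P∣P′Fh = mk∣ 1ℤ (λ ()) (con k ⊗ (φ ⊕ φ ⊕ con (- μ))) λ x → trans
          (e₁ (⟦ D φ ⟧ x) (⟦ φ ⟧ x) (- μ) (⟦ F ⟧ x) (⟦ h ⟧ x)) (trans (cong (_* (⟦ φ ⟧ x + ⟦ φ ⟧ x + - μ))
              (sym (kP≡ x))) (e₂ k (⟦ P ⟧ x) (⟦ φ ⟧ x + ⟦ φ ⟧ x + - μ)))
          where
          e₁ : ∀ φ′ φ μ F h → 1ℤ * ((φ′ * (φ + μ) + φ * (φ′ + 0ℤ)) * (F * h)) ≡ (φ′ * F * h) * (φ + φ + μ)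
          e₁ = solve-∀
          e₂ : ∀ k P t → k * P * t ≡ P * (k * t)
          e₂ = solve-∀

        module _ {N : ℕ} (P∣Fhᴺ : P ∣ᴱ (F ⊗ h) ^^ N) where
          open _∣ᴱ_ P∣Fhᴺ renaming (scale to k₂; scale≢0 to k₂≢0; quotient to V; equation to k₂Fhᴺ≡)

          -- Collects the exceptional primes: those of `μ`, the third member of the triple, and
          -- those of the scale in the divisibility over ℚ.
          c₀ = ∣ μ ∣ ℕ.* ∣ k₂ ∣

          prime-divisors : ∀ x r p → Prime p → (p ∣ ∣ ⟦ F ⟧ x ∣ → p ∣ r) →
                           p ∣ ∣ ⟦ φ ⟧ x ∣ ℕ.* ∣ ⟦ φ ⟧ x - μ ∣ ℕ.* ∣ μ ∣ → p ∣ c₀ ℕ.* r ℕ.* ∣ ⟦ h ⟧ x ∣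
          prime-divisors x r p prime-p p∣F⇒p∣r p∣ =
            [ (λ p∣P → [ (λ p∣k₂ → ℕ∣.∣-trans p∣k₂ (ℕ∣.∣-trans (ℕ∣.n∣m*n (∣ μ ∣)) ∣c₀))
                       , (λ p∣Fhᴺ → [ (λ p∣F → ℕ∣.∣-trans (p∣F⇒p∣r p∣F) (ℕ∣.∣-trans (ℕ∣.n∣m*n c₀) (ℕ∣.m∣m*n (∣ ⟦ h ⟧ x ∣))))
                                    , (λ p∣h → ℕ∣.∣-trans p∣h (ℕ∣.n∣m*n (c₀ ℕ.* r))) ]′
                           (euclidsLemma (∣ ⟦ F ⟧ x ∣) (∣ ⟦ h ⟧ x ∣) prime-p (prime∣^ prime-p _ N p∣Fhᴺ))) ]′
                 (euclidsLemma (∣ k₂ ∣) ((∣ ⟦ F ⟧ x ∣ ℕ.* ∣ ⟦ h ⟧ x ∣) ℕ.^ N) prime-p (subst (p ∣_) k₂Fh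
                     (ℕ∣.∣-trans p∣P (ℕ∣.m∣m*n (∣ ⟦ V ⟧ x ∣))))))
            , (λ p∣μ → ℕ∣.∣-trans p∣μ (ℕ∣.∣-trans (ℕ∣.m∣m*n (∣ k₂ ∣)) ∣c₀)) ]′
            (euclidsLemma (∣ ⟦ φ ⟧ x ∣ ℕ.* ∣ ⟦ φ ⟧ x - μ ∣) (∣ μ ∣) prime-p p∣)
            where
            ∣c₀ : c₀ ∣ c₀ ℕ.* r ℕ.* ∣ ⟦ h ⟧ x ∣
            ∣c₀ = ℕ∣.∣-trans (ℕ∣.m∣m*n r) (ℕ∣.m∣m*n (∣ ⟦ h ⟧ x ∣))
            abs-^^ : ∀ n → ∣ ⟦ (F ⊗ h) ^^ n ⟧ x ∣ ≡ (∣ ⟦ F ⟧ x ∣ ℕ.* ∣ ⟦ h ⟧ x ∣) ℕ.^ n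
            abs-^^ zero    = refl
            abs-^^ (suc n) = trans (ℤ.abs-* (⟦ F ⟧ x * ⟦ h ⟧ x) (⟦ (F ⊗ h) ^^ n ⟧ x)) (cong₂ ℕ._*_ (ℤ.abs-* (⟦ F ⟧ x)
              (⟦ h ⟧ x)) (abs-^^ n))
            k₂Fh : ∣ ⟦ φ ⟧ x ∣ ℕ.* ∣ ⟦ φ ⟧ x - μ ∣ ℕ.* ∣ ⟦ V ⟧ x ∣ ≡ ∣ k₂ ∣ ℕ.* (∣ ⟦ F ⟧ x ∣ ℕ.* ∣ ⟦ h ⟧ x ∣) ℕ.^ N
            k₂Fh = trans (cong (ℕ._* ∣ ⟦ V ⟧ x ∣) (sym (ℤ.abs-* (⟦ φ ⟧ x) (⟦ φ ⟧ x - μ))))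
              (trans (sym (ℤ.abs-* (⟦ P ⟧ x) (⟦ V ⟧ x)))
              (trans (cong ∣_∣ (sym (k₂Fhᴺ≡ x))) (trans (ℤ.abs-* k₂ (⟦ (F ⊗ h) ^^ N ⟧ x)) (cong (∣ k₂ ∣ ℕ.*_) (abs-^^ N)))))

          bounded : ∃[ B ] (∀ x → (0 ℕ.< ∣ ⟦ F ⟧ x ∣ → SmallRadical (∣ ⟦ F ⟧ x ∣)) → ∣ x ∣ ℕ.≤ B)
          bounded =
            let x₁ , F≥   = Deg-lower d degF
                x₂ , φ′≥  = Deg-lower δ (Deg-D degφ)
                x₃ , φ≥   = Deg-lower (suc δ) degφ
                x₄ , φ>μ  = Deg-large degφ (suc ∣ μ ∣)
                x₅ , P≢0  = Deg⇒EventuallyNonzero degP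
                C , P≤    = <°-upper (suc δ ℕ.+ suc δ) (Deg-<° degP)
                -- The argument is `q − 1`, so the conjecture is used with `ε = 1 / (2 + 2δ)`.
                L , abc≤  = abc-boundℤ abc (δ ℕ.+ suc δ) μ μ≢0
            in bounded-by x₁ F≥ x₂ φ′≥ x₃ φ≥ x₄ φ>μ x₅ P≢0 C P≤ L abc≤
            where
            q = suc δ ℕ.+ suc δ
            bounded-by : ∀ x₁ → (∀ x → x₁ ℕ.≤ ∣ x ∣ → ∣ x ∣ ℕ.^ d ℕ.≤ 2 ℕ.* ∣ ⟦ F ⟧ x ∣) →
                         ∀ x₂ → (∀ x → x₂ ℕ.≤ ∣ x ∣ → ∣ x ∣ ℕ.^ δ ℕ.≤ 2 ℕ.* ∣ ⟦ D φ ⟧ x ∣) →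
                         ∀ x₃ → (∀ x → x₃ ℕ.≤ ∣ x ∣ → ∣ x ∣ ℕ.^ suc δ ℕ.≤ 2 ℕ.* ∣ ⟦ φ ⟧ x ∣) →
                         ∀ x₄ → (∀ x → x₄ ℕ.≤ ∣ x ∣ → suc ∣ μ ∣ ℕ.≤ ∣ ⟦ φ ⟧ x ∣) →
                         ∀ x₅ → (∀ x → x₅ ℕ.≤ ∣ x ∣ → ⟦ P ⟧ x ≢ 0ℤ) →
                         ∀ C → (∀ x → 1 ℕ.≤ ∣ x ∣ → ∣ ⟦ P ⟧ x ∣ ℕ.≤ C ℕ.* ∣ x ∣ ℕ.^ (suc δ ℕ.+ suc δ)) →
                         ∀ L → (∀ A m → ∣ μ ∣ ℕ.< ∣ A ∣ → 0 ℕ.< m → (∀ p → Prime p → p ∣ ∣ A ∣ ℕ.* ∣ A - μ ∣ ℕ.* ∣ μ ∣ → p ∣ m) →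
                                ∣ A ∣ ℕ.^ q ℕ.≤ L ℕ.* m ℕ.^ (q ℕ.+ 1)) →
                         ∃[ B ] (∀ x → (0 ℕ.< ∣ ⟦ F ⟧ x ∣ → SmallRadical (∣ ⟦ F ⟧ x ∣)) → ∣ x ∣ ℕ.≤ B)
            bounded-by x₁ F≥ x₂ φ′≥ x₃ φ≥ x₄ φ>μ x₅ P≢0 C P≤ L abc≤ = x₀ ℕ.+ B , λ x root → [ ≤B x root ,
              (λ x≤x₀ → ℕ.≤-trans x≤x₀ (ℕ.m≤m+n x₀ B)) ]′ (ℕ.≤-total x₀ (∣ x ∣))
              where
              x₀ = 1 ℕ.+ (x₁ ℕ.+ (x₂ ℕ.+ (x₃ ℕ.+ (x₄ ℕ.+ x₅))))
              K = 8 ℕ.* (c₀ ℕ.* ∣ k ∣ ℕ.* C) ℕ.^ 2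
              B = (2 ℕ.^ q ℕ.* L) ℕ.^ 2 ℕ.* K ℕ.^ (q ℕ.+ 1)
              ≤B : ∀ x → (0 ℕ.< ∣ ⟦ F ⟧ x ∣ → SmallRadical (∣ ⟦ F ⟧ x ∣)) → x₀ ℕ.≤ ∣ x ∣ → ∣ x ∣ ℕ.≤ x₀ ℕ.+ B
              ≤B x root x₀≤x = ℕ.≤-trans (large (root 0<F)) (ℕ.m≤n+m B x₀)
                where
                +≤ : ∀ a {b c} → a ℕ.+ b ℕ.≤ c → a ℕ.≤ c × b ℕ.≤ c
                +≤ a h = ℕ.m+n≤o⇒m≤o a h , ℕ.m+n≤o⇒n≤o a h
                0<x = proj₁ (+≤ 1 x₀≤x)
                ≥₁ = +≤ x₁ (proj₂ (+≤ 1 x₀≤x))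
                ≥₂ = +≤ x₂ (proj₂ ≥₁)
                ≥₃ = +≤ x₃ (proj₂ ≥₂)
                ≥₄ = +≤ x₄ (proj₂ ≥₃)
                -- Beyond `x₅` the polynomial `P` has no zeros, hence neither have its factors `F`
                -- and `h`; this makes the modulus `c₀ r h` positive.
                φ′Fh≢0 : ⟦ D φ ⟧ x * ⟦ F ⟧ x * ⟦ h ⟧ x ≢ 0ℤ
                φ′Fh≢0 eq = *-nonzero {k} k≢0 (P≢0 x (proj₂ ≥₄)) (trans (kP≡ x) eq)
                0<F : 0 ℕ.< ∣ ⟦ F ⟧ x ∣
                0<F = nonzero⇒1≤ (nonzeroʳ {⟦ D φ ⟧ x} {⟦ F ⟧ x} (nonzeroˡ {⟦ D φ ⟧ x * ⟦ F ⟧ x} {⟦ h ⟧ x} φ′Fh≢0))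
                0<h : 0 ℕ.< ∣ ⟦ h ⟧ x ∣
                0<h = nonzero⇒1≤ (nonzeroʳ {⟦ D φ ⟧ x * ⟦ F ⟧ x} {⟦ h ⟧ x} φ′Fh≢0)
                0<c₀ : 0 ℕ.< c₀
                0<c₀ = ℕ.*-mono-≤ (nonzero⇒1≤ μ≢0) (nonzero⇒1≤ k₂≢0)
                abs-kP : ∣ k ∣ ℕ.* ∣ ⟦ P ⟧ x ∣ ≡ ∣ ⟦ D φ ⟧ x ∣ ℕ.* ∣ ⟦ F ⟧ x ∣ ℕ.* ∣ ⟦ h ⟧ x ∣
                abs-kP = trans (sym (ℤ.abs-* k (⟦ P ⟧ x))) (trans (cong ∣_∣ (kP≡ x))
                  (trans (ℤ.abs-* (⟦ D φ ⟧ x * ⟦ F ⟧ x) (⟦ h ⟧ x)) (cong (ℕ._* ∣ ⟦ h ⟧ x ∣) (ℤ.abs-* (⟦ D φ ⟧ x)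
                  (⟦ F ⟧ x)))))
                large : SmallRadical (∣ ⟦ F ⟧ x ∣) → ∣ x ∣ ℕ.≤ B
                large (r , 0<r , r²≤F , primes) = final-bound δ K L {∣ x ∣} {∣ ⟦ φ ⟧ x ∣} {c₀ ℕ.* r ℕ.* ∣ ⟦ h ⟧ x ∣} 0<x (φ≥ x (proj₁ ≥₃))
                  (abc≤ (⟦ φ ⟧ x) (c₀ ℕ.* r ℕ.* ∣ ⟦ h ⟧ x ∣) (φ>μ x (proj₁ ≥₄)) (ℕ.*-mono-≤ (ℕ.*-mono-≤ 0<c₀ 0<r) 0<h)
                    λ p prime-p → prime-divisors x r p prime-p (primes p prime-p))
                  (square-bound δ (∣ k ∣) c₀ C {∣ x ∣} {∣ ⟦ P ⟧ x ∣} {∣ ⟦ D φ ⟧ x ∣} {∣ ⟦ F ⟧ x ∣} {r} {∣ ⟦ h ⟧ x ∣} 0<x abs-kP r²≤F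
                    (ℕ.≤-trans (ℕ.^-monoʳ-≤ (∣ x ∣) {{ℕ.>-nonZero 0<x}} 2<d) (F≥ x (proj₁ ≥₁))) (φ′≥ x (proj₁ ≥₂)) (P≤ x 0<x))

    x-bounded : ∃[ B ] (∀ x → (0 ℕ.< ∣ ⟦ F ⟧ x ∣ → SmallRadical (∣ ⟦ F ⟧ x ∣)) → ∣ x ∣ ℕ.≤ B)
    x-bounded =
      let belyi   = Belyi-∣ (≐⇒∣ λ x → sym (ℤ.*-identityˡ (⟦ F ⟧ x))) (Belyi-roots⊗ d [] F (Deg-<° degF) (Deg⇒EventuallyNonzero degF))
          δ , degφ = EventuallyNonzero-D⇒Deg (Belyi.φ′≢0 belyi)
          φ′F∣P   = Belyi.covers belyi sf 1 (∣-^¹ ∣-refl)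
          N , P∣  = ∣D⊗⇒∣^^ (Deg⇒EventuallyNonzero (degP belyi degφ φ′F∣P)) (P∣P′Fh belyi degφ φ′F∣P)
      in bounded belyi degφ φ′F∣P P∣

  ⟦⟧-bounded : ∀ p B → ∃[ M ] (∀ x → ∣ x ∣ ℕ.≤ B → ∣ ⟦ p ⟧ x ∣ ℕ.≤ M)
  ⟦⟧-bounded (con a) B = ∣ a ∣ , λ x _ → ℕ.≤-refl
  ⟦⟧-bounded X       B = B , λ x x≤B → x≤B
  ⟦⟧-bounded (p ⊕ q) B = let M , p≤ = ⟦⟧-bounded p B ; N , q≤ = ⟦⟧-bounded q B in M ℕ.+ N , λ x x≤B →
    ℕ.≤-trans (ℤ.∣i+j∣≤∣i∣+∣j∣ (⟦ p ⟧ x) (⟦ q ⟧ x)) (ℕ.+-mono-≤ (p≤ x x≤B) (q≤ x x≤B))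
  ⟦⟧-bounded (p ⊗ q) B = let M , p≤ = ⟦⟧-bounded p B ; N , q≤ = ⟦⟧-bounded q B in M ℕ.* N , λ x x≤B →
    ℕ.≤-trans (ℕ.≤-reflexive (ℤ.abs-* (⟦ p ⟧ x) (⟦ q ⟧ x))) (ℕ.*-mono-≤ (p≤ x x≤B) (q≤ x x≤B))

  interval : ℕ → List ℤ
  interval B = List.map +_ (upTo (suc B)) List.++ List.map -[1+_] (upTo (suc B))

  ∈-interval : ∀ {B} x → ∣ x ∣ ℕ.≤ B → x ∈ interval B
  ∈-interval     (+ n)    n≤B = ∈-++⁺ˡ (∈-map⁺ +_ (∈-upTo⁺ (s≤s n≤B)))
  ∈-interval {B} -[1+ n ] n<B = ∈-++⁺ʳ (List.map +_ (upTo (suc B))) (∈-map⁺ -[1+_] (∈-upTo⁺ (ℕ.m<n⇒m<1+n n<B)))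

  bounded⇒finite : ∀ {R : ℤ → ℤ → Set} B C → (∀ x y → R x y → ∣ x ∣ ℕ.≤ B × ∣ y ∣ ℕ.≤ C) → FinitelyManySolutions R
  bounded⇒finite B C bound = List.cartesianProduct (interval B) (interval C) , λ x y xRy →
    ∈-cartesianProduct⁺ (∈-interval x (proj₁ (bound x y xRy))) (∈-interval y (proj₂ (bound x y xRy)))

  -- Once `x` is bounded, so is the common value, and a nonconstant `G` exceeds any bound for large
  -- `y`. For a constant `G`, a single `x` could occur with every `y`.
  finitely-many : ABCConjecture → ∀ {F G d e} → Deg F d → 2 ℕ.< d → Squarefree F → Deg G (suc e) →
                  (∀ x y → ⟦ F ⟧ x ≡ ⟦ G ⟧ y → 0 ℕ.< ∣ ⟦ F ⟧ x ∣ → SmallRadical (∣ ⟦ F ⟧ x ∣)) →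
                  FinitelyManySolutions (λ x y → ⟦ F ⟧ x ≡ ⟦ G ⟧ y)
  finitely-many abc {F} {G} degF 2<d sf degG small =
    let B , x≤B = x-bounded abc degF 2<d sf
        M , F≤M = ⟦⟧-bounded F B
        C , G>M = Deg-large degG (suc M)
    in bounded⇒finite B C λ x y Fx≡Gy →
         let x-small = x≤B x (small x y Fx≡Gy)
         in x-small , [ (λ C≤y → ⊥-elim (ℕ.<⇒≱ (G>M y C≤y) (subst (λ t → ∣ t ∣ ℕ.≤ M) Fx≡Gy (F≤M x x-small)))) ,
             (λ y≤C → y≤C) ]′ (ℕ.≤-total C (∣ y ∣))

open PowerfulValues

open import Data.Integer.Base using (∣_∣)
open import Data.Nat.Base using (_<_; _≤_)

theorem1p6 : ABCConjecture →
    (f g : ℤ[X].Poly) →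
    Separable f →
    (d : ℕ) → ℤ[X].HasDegree f d → 2 < d →
    (n : ℕ) → 0 < n →
    (γ : Fin n → ℕ) → (∀ i → 2 ≤ γ i) →
    (gs : Fin n → ℤ[X].Poly) →
    g ℤ[X].≋ ℤ[X].product (λ i → gs i ℤ[X].^ γ i) →
    (e : ℕ) → ℤ[X].HasDegree g e → 0 < e →
    FinitelyManySolutions (λ x y → ℤ[X].eval f x ≡ ℤ[X].eval g y)
theorem1p6 abc f g separable d deg-f 2<d n 0<n γ 2≤γ gs g≋∏ (suc e) deg-g 0<e =
  let S , solutions = finitely-many abc degF 2<d (separable⇒squarefree f separable degF) (HasDegree⇒Deg g (suc e) deg-g) small
  in S , λ x y fx≡gy → solutions x y (trans (⟦fromList⟧ f x) (trans fx≡gy (sym (⟦fromList⟧ g y))))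
  where
  degF : Deg (fromList f) d
  degF = HasDegree⇒Deg f d deg-f
  small : ∀ x y → ⟦ fromList f ⟧ x ≡ ⟦ fromList g ⟧ y → 0 < ∣ ⟦ fromList f ⟧ x ∣ → SmallRadical (∣ ⟦ fromList f ⟧ x ∣)
  small x y fx≡gy 0<fx = subst SmallRadical (sym fx≡∏) (product-SmallRadical n γ 2≤γ gs y (subst (0 <_) fx≡∏ 0<fx))
    where
    fx≡∏ : ∣ ⟦ fromList f ⟧ x ∣ ≡ ∣ ℤ[X].eval (ℤ[X].product (λ i → gs i ℤ[X].^ γ i)) y ∣
    fx≡∏ = cong ∣_∣ (trans fx≡gy (trans (⟦fromList⟧ g y) (≋⇒eval g (ℤ[X].product (λ i → gs i ℤ[X].^ γ i)) g≋∏ y)))
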